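{- Let $p>3$ be a prime and $a\in R_p$ with $a\not\equiv 0\pmod p$. (i) If $p\equiv 2\pmod 3$, then $V_p(x^2+\frac ax)=\frac{2p-1}3$. (ii) If $p\equiv 1\pmod 3$, write $p=A^2+3B^2$ with $A,B\in\mathbb{Z}$ and $A\equiv 1\pmod 3$. Then $V_p(x^2+\frac ax)=\frac{2p-1+2A}3$ if $(2a^2)^{\frac{p-1}3}\equiv 1\pmod p$, and for $\varepsilon\in\{1,-1\}$, $V_p(x^2+\frac ax)=\frac{2p-1-A+3\varepsilon B}3$ if $(2a^2)^{\frac{p-1}3}\equiv \frac{ -1+\varepsilon A/B}2\pmod p$.
   Context: $R_p$ denotes the set of rational numbers whose denominators are not divisible by $p$; congruences modulo $p$ are taken in $\mathbb{Z}/p\mathbb{Z}$. For a rational function $f$, $V_p(f(x))$ denotes the number of residues $b\in\{0,1,\ldots,p-1\}$ such that $f(x)\equiv b\pmod p$ is solvable with $x\in\{1,2,\ldots,p-1\}$. -}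

module Defs where

open import Data.Nat as ℕ using (ℕ; zero; suc)
open import Data.Nat.Divisibility using (_∣_; _∣?_)
open import Data.Integer as ℤ using (ℤ; +_; -[1+_]; ∣_∣)
open import Data.Rational as ℚ using (ℚ; ↥_; ↧ₙ_; 0ℚ; 1ℚ)
open import Data.List using (List; length; filter; upTo; map)
open import Data.List.Relation.Unary.Any using (any?)
open import Relation.Nullary using (¬_)

InR : ℕ → ℚ → Set
InR p a = ¬ (p ∣ ↧ₙ a)

_≡ℚ_[mod_] : ℚ → ℚ → ℕ → Set
r ≡ℚ s [mod p ] = p ∣ ∣ ↥ (r ℚ.- s) ∣

pow : ℚ → ℕ → ℚ
pow q zero = 1ℚ
pow q (suc n) = q ℚ.* pow q n

-- integer division n / d as a rational (junk value 0 when d = 0)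
divℤ : ℤ → ℤ → ℚ
divℤ n (+ zero) = 0ℚ
divℤ n (+ suc k) = n ℚ./ suc k
divℤ n -[1+ k ] = (ℤ.- n) ℚ./ suc k

nℚ : ℕ → ℚ
nℚ n = (+ n) ℚ./ 1

fval : ℚ → ℕ → ℚ
fval a k = nℚ (suc k) ℚ.* nℚ (suc k) ℚ.+ a ℚ.* ((+ 1) ℚ./ suc k)

-- V_p(x^2 + a/x): number of b ∈ {0,…,p-1} such that x^2 + a/x ≡ b (mod p)
-- is solvable with x ∈ {1,…,p-1}
Vp : ℕ → ℚ → ℕ
Vp p a = length (filter (λ b → any? (λ k → p ∣? ∣ ↥ (fval a k ℚ.- nℚ b) ∣) (upTo (p ℕ.∸ 1))) (upTo p))

-- Writing M for the number of (x, y) with x y (x + y) = a, one has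
-- 3 V = 3 (p − 1) − M, fibre by fibre: if x is a root of X³ − b X + a and d(x)
-- is the number of y with x y (x + y) = a, the values 3 − d(x) sum to 3 over
-- the roots.  With y = t x, M is the sum over t of the number of x with
-- (t² + t) x³ = a, so M = p − 2 when cubing is bijective (p ≡ 2 mod 3).
--
-- Let p = 3k + 1 and s(a) = p − 2 − M.  Expanding in k-th powers and using that
-- power sums of degree < p − 1 vanish, s(a) ≡ − aᵏ S mod p with S independent
-- of a, and s(a) depends only on the class of a modulo cubes.  For the classes
-- of 2, 2g, 2g² the values sum to 0; they are 2X, − X − 3Y, − X + 3Y for
-- integers X ≡ 1 (mod 3) and Y, by congruences mod 2 and 3.  Their squares sum
-- to less than 24p, by counting points on the conics c (t² + t) = t′² + t′.
-- Hence X² + 3Y² < 4p, while the congruences mod p say that p divides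
-- X A + 3 B Y and A Y − B X for p = A² + 3B².  So (X, Y) is (A, B) times an
-- element of ℤ[√−3] of norm < 4 which is ≡ 1 mod 3, and that element is 1.
module Submission where

open import Defs
open import Data.Nat as ℕ using (ℕ; zero; suc)
open import Data.Nat.Primality using (Prime; euclidsLemma; prime⇒nonZero; prime⇒nonTrivial)
open import Data.Integer as ℤ using (ℤ; +_; -[1+_])
open import Data.Rational as ℚ using (ℚ; mkℚ; ↥_; ↧_; ↧ₙ_; 0ℚ; 1ℚ; ½)
open import Data.Product using (_×_; ∃; _,_; proj₁; proj₂)
open import Data.Sum using (_⊎_; inj₁; inj₂; [_,_]′)
open import Relation.Nullary using (¬_; Dec; yes; no)
open import Relation.Binary.PropositionalEquality using (_≡_; _≢_; refl; sym; trans; cong; cong₂; subst; subst₂; module ≡-Reasoning)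

-- Both the sizes of the counts and their residues mod p are used. So each count is an exact
-- integer, a sum of indicators `δ` over one period, and only the relation `_≈_` passes to ℤ/p. The
-- constant S is a cubic Jacobi sum mod p and is never evaluated. Only a ratio enters: s(2g²) ≡ h²
-- s(2) for h = gᵏ, a root of h² + h + 1. As p = A² + 3B², such an h is (-1 ± A/B)/2, and this ties
-- X and Y to A and B. The class of 2 is the base because swapping x and y fixes the solutions with
-- 2x³ = a: three for that class, none for the others, which decides the parity of s. The same
-- choice puts 2a² into the theorem: as a³ᵏ ≡ 1, (2a²)ᵏ ≡ 1 says aᵏ ≡ 2ᵏ. The sum of squares turns
-- out to be 6p. The identification of X + Y√-3 tolerates any loss by a factor of less than 4, so it
-- suffices to bound the points counted on each conic by p, or by 2p when c ≡ 1 makes it a pair of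
-- lines.

module Residues (p : ℕ) (p-prime : Prime p) where

  open import Algebra.Bundles using (CommutativeSemiring)
  import Algebra.Definitions.RawMonoid as RawMonoid
  import Algebra.Properties.CommutativeSemiring.Binomial as Binomial
  import Algebra.Properties.Semiring.Sum as SemiringSum
  open import Data.Empty using (⊥-elim)
  open import Data.Fin as Fin using (Fin; toℕ)
  import Data.Fin.Properties as Fin
  open import Data.Integer renaming (suc to sucℤ) hiding (pred; _/_)
  import Data.Integer.DivMod as ℤ
  open import Data.Integer.Divisibility.Signed
  open import Data.Integer.Properties
  open import Data.Integer.Tactic.RingSolver using (solve-∀)
  open import Data.List using (length; filter; upTo; applyUpTo)
  open import Data.List.Relation.Unary.Any using (any?)
  import Data.List.Relation.Unary.Any.Properties as Any
  open import Data.Nat.Base using (_!)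
  open import Data.Nat.Combinatorics using (_C_; nCn≡1; nC1≡n; nCk≡n!/k![n-k]!; nCk≡nC[n∸k]; k![n∸k]!∣n!)
  import Data.Nat.Coprimality as Coprimality
  import Data.Nat.Divisibility as ℕ
  import Data.Nat.DivMod as ℕ
  open import Data.Nat.Induction using (<-rec)
  import Data.Nat.Properties as ℕ
  import Data.Nat.Tactic.RingSolver as ℕSolver
  import Data.Rational.Properties as ℚ
  import Data.Rational.Unnormalised as ℚᵘ
  open import Function using (_∘_)
  open import Relation.Binary.Bundles using (Setoid)
  import Relation.Binary.Reasoning.Setoid as SetoidReasoning
  import Relation.Nullary.Decidable as Dec
  open import Relation.Unary using (Decidable)

  -- Congruences and sums over a period

  module ∑ = SemiringSum +-*-semiring
  open ∑ using (sum)

  instance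
    p-nonZero : ℕ.NonZero p
    p-nonZero = prime⇒nonZero p-prime

  1<p : 1 ℕ.< p
  1<p = ℕ.nonTrivial⇒n>1 p {{prime⇒nonTrivial p-prime}}

  +-cong₃ : ∀ {a a′ b b′ c c′ : ℤ} → a ≡ a′ → b ≡ b′ → c ≡ c′ → a + b + c ≡ a′ + b′ + c′
  +-cong₃ refl refl refl = refl

  infix 4 _≈_ _≉_ _≈?_

  -- A record, and not a mere name for divisibility of x - y, so that x and y can be read off from
  -- the type of a proof.
  record _≈_ (x y : ℤ) : Set where
    constructor mod
    field divides-diff : + p ∣ x - y
  open _≈_ public

  _≉_ : ℤ → ℤ → Set
  x ≉ y = ¬ x ≈ y

  opaque
    _≈?_ : ∀ x y → Dec (x ≈ y)
    x ≈? y = Dec.map′ mod divides-diff (+ p ∣? x - y)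

  ≈-refl : ∀ {x} → x ≈ x
  ≈-refl {x} = mod (divides 0ℤ (+-inverseʳ x))

  ≈-reflexive : ∀ {x y} → x ≡ y → x ≈ y
  ≈-reflexive refl = ≈-refl

  -- A congruence follows from others by a ring identity once the coefficients
  -- c₁, c₂ … of the linear combination are given.
  by₁ : ∀ {x y a₁ b₁} c₁ → a₁ ≈ b₁ → x - y ≡ c₁ * (a₁ - b₁) → x ≈ y
  by₁ c₁ (mod h₁) eq = mod (subst (+ p ∣_) (sym eq) (∣n⇒∣m*n c₁ h₁))

  by₂ : ∀ {x y a₁ b₁ a₂ b₂} c₁ c₂ → a₁ ≈ b₁ → a₂ ≈ b₂ →
    x - y ≡ c₁ * (a₁ - b₁) + c₂ * (a₂ - b₂) → x ≈ y
  by₂ c₁ c₂ (mod h₁) (mod h₂) eq =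
    mod (subst (+ p ∣_) (sym eq) (∣m∣n⇒∣m+n (∣n⇒∣m*n c₁ h₁) (∣n⇒∣m*n c₂ h₂)))

  by₃ : ∀ {x y a₁ b₁ a₂ b₂ a₃ b₃} c₁ c₂ c₃ → a₁ ≈ b₁ → a₂ ≈ b₂ → a₃ ≈ b₃ →
    x - y ≡ c₁ * (a₁ - b₁) + c₂ * (a₂ - b₂) + c₃ * (a₃ - b₃) → x ≈ y
  by₃ c₁ c₂ c₃ (mod h₁) (mod h₂) (mod h₃) eq = mod (subst (+ p ∣_) (sym eq)
    (∣m∣n⇒∣m+n (∣m∣n⇒∣m+n (∣n⇒∣m*n c₁ h₁) (∣n⇒∣m*n c₂ h₂)) (∣n⇒∣m*n c₃ h₃)))

  ≈-sym : ∀ {x y} → x ≈ y → y ≈ x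
  ≈-sym {x} {y} h = by₁ (- 1ℤ) h (eq x y)
    where
    eq : ∀ x y → y - x ≡ - 1ℤ * (x - y)
    eq = solve-∀

  ≈-trans : ∀ {x y z} → x ≈ y → y ≈ z → x ≈ z
  ≈-trans {x} {y} {z} h h′ = by₂ 1ℤ 1ℤ h h′ (eq x y z)
    where
    eq : ∀ x y z → x - z ≡ 1ℤ * (x - y) + 1ℤ * (y - z)
    eq = solve-∀

  ≈-setoid : Setoid _ _
  ≈-setoid = record
    { Carrier = ℤ ; _≈_ = _≈_
    ; isEquivalence = record { refl = ≈-refl ; sym = ≈-sym ; trans = ≈-trans } }

  module ≈-Reasoning = SetoidReasoning ≈-setoid

  +-cong-≈ : ∀ {x x′ y y′} → x ≈ x′ → y ≈ y′ → x + y ≈ x′ + y′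
  +-cong-≈ {x} {x′} {y} {y′} h h′ = by₂ 1ℤ 1ℤ h h′ (eq x x′ y y′)
    where
    eq : ∀ x x′ y y′ → (x + y) - (x′ + y′) ≡ 1ℤ * (x - x′) + 1ℤ * (y - y′)
    eq = solve-∀

  *-cong-≈ : ∀ {x x′ y y′} → x ≈ x′ → y ≈ y′ → x * y ≈ x′ * y′
  *-cong-≈ {x} {x′} {y} {y′} h h′ = by₂ y x′ h h′ (eq x x′ y y′)
    where
    eq : ∀ x x′ y y′ → x * y - x′ * y′ ≡ y * (x - x′) + x′ * (y - y′)
    eq = solve-∀

  neg-cong-≈ : ∀ {x x′} → x ≈ x′ → - x ≈ - x′
  neg-cong-≈ {x} {x′} h = by₁ (- 1ℤ) h (eq x x′)
    where
    eq : ∀ x x′ → - x - - x′ ≡ - 1ℤ * (x - x′)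
    eq = solve-∀

  ∸-cong-≈ : ∀ {x x′ y y′} → x ≈ x′ → y ≈ y′ → x - y ≈ x′ - y′
  ∸-cong-≈ h h′ = +-cong-≈ h (neg-cong-≈ h′)

  ^-cong-≈ : ∀ {x x′} n → x ≈ x′ → x ^ n ≈ x′ ^ n
  ^-cong-≈ zero    h = ≈-refl
  ^-cong-≈ (suc n) h = *-cong-≈ h (^-cong-≈ n h)

  p≈0 : + p ≈ 0ℤ
  p≈0 = mod (divides 1ℤ (eq (+ p)))
    where
    eq : ∀ x → x - 0ℤ ≡ 1ℤ * x
    eq = solve-∀

  ≈0⇒∣ : ∀ {x} → x ≈ 0ℤ → p ℕ.∣ ∣ x ∣
  ≈0⇒∣ {x} (mod h) = ∣⇒∣ᵤ (subst (+ p ∣_) (+-identityʳ x) h)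

  ∣⇒≈0 : ∀ x → p ℕ.∣ ∣ x ∣ → x ≈ 0ℤ
  ∣⇒≈0 x h = mod (subst (+ p ∣_) (sym (+-identityʳ x)) (∣ᵤ⇒∣ h))

  -≈0⇒≈ : ∀ {x y} → x - y ≈ 0ℤ → x ≈ y
  -≈0⇒≈ {x} {y} h = by₁ 1ℤ h (eq x y)
    where
    eq : ∀ x y → x - y ≡ 1ℤ * ((x - y) - 0ℤ)
    eq = solve-∀

  ≈⇒-≈0 : ∀ {x y} → x ≈ y → x - y ≈ 0ℤ
  ≈⇒-≈0 {x} {y} h = by₁ 1ℤ h (eq x y)
    where
    eq : ∀ x y → (x - y) - 0ℤ ≡ 1ℤ * (x - y)
    eq = solve-∀

  *-zeroˡ-≈ : ∀ {x} y → x ≈ 0ℤ → x * y ≈ 0ℤ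
  *-zeroˡ-≈ {x} y h = by₁ y h (eq x y)
    where
    eq : ∀ x y → x * y - 0ℤ ≡ y * (x - 0ℤ)
    eq = solve-∀

  *-zeroʳ-≈ : ∀ x {y} → y ≈ 0ℤ → x * y ≈ 0ℤ
  *-zeroʳ-≈ x {y} h = by₁ x h (eq x y)
    where
    eq : ∀ x y → x * y - 0ℤ ≡ x * (y - 0ℤ)
    eq = solve-∀

  opaque
    *≈0 : ∀ x y → x * y ≈ 0ℤ → x ≈ 0ℤ ⊎ y ≈ 0ℤ
    *≈0 x y h with euclidsLemma ∣ x ∣ ∣ y ∣ p-prime (subst (p ℕ.∣_) (abs-* x y) (≈0⇒∣ h))
    ... | inj₁ d = inj₁ (∣⇒≈0 x d)
    ... | inj₂ d = inj₂ (∣⇒≈0 y d)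

  *≉0 : ∀ {x y} → x ≉ 0ℤ → y ≉ 0ℤ → x * y ≉ 0ℤ
  *≉0 {x} {y} x≉0 y≉0 h = [ x≉0 , y≉0 ]′ (*≈0 x y h)

  ^≉0 : ∀ {x} n → x ≉ 0ℤ → x ^ n ≉ 0ℤ
  small≉0 : ∀ {n} → 0 ℕ.< n → n ℕ.< p → + n ≉ 0ℤ
  small≉0 {n@(suc _)} _ n<p h = ℕ.<⇒≱ n<p (ℕ.∣⇒≤ (≈0⇒∣ h))

  1≉0 : 1ℤ ≉ 0ℤ
  1≉0 = small≉0 (ℕ.s≤s ℕ.z≤n) 1<p

  ^≉0 zero    x≉0 = 1≉0
  ^≉0 (suc n) x≉0 = *≉0 x≉0 (^≉0 n x≉0)

  *-cancelˡ-≈ : ∀ {x y} c → c ≉ 0ℤ → c * x ≈ c * y → x ≈ y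
  *-cancelˡ-≈ {x} {y} c c≉0 h with *≈0 c (x - y) (by₁ 1ℤ h (eq c x y))
    where
    eq : ∀ c x y → c * (x - y) - 0ℤ ≡ 1ℤ * (c * x - c * y)
    eq = solve-∀
  ... | inj₁ c≈0 = ⊥-elim (c≉0 c≈0)
  ... | inj₂ d   = -≈0⇒≈ d

  opaque
    residue : ∀ x → ∃ λ (i : Fin p) → x ≈ + toℕ i
    residue x = Fin.fromℕ< r<p , mod (divides (x ℤ./ℕ p) (trans (cong (λ i → x - + i) (Fin.toℕ-fromℕ< r<p)) eq₁))
      where
      r<p : x ℤ.%ℕ p ℕ.< p
      r<p = ℤ.n%ℕd<d x p
      eq : ∀ x r q → x ≡ r + q → x - r ≡ q
      eq x r q refl = lem r q
        where
        lem : ∀ r q → r + q - r ≡ q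
        lem = solve-∀
      eq₁ : x - + (x ℤ.%ℕ p) ≡ (x ℤ./ℕ p) * + p
      eq₁ = eq x (+ (x ℤ.%ℕ p)) _ (ℤ.a≡a%ℕn+[a/ℕn]*n x p)

  residue-unique : ∀ {i j : Fin p} → + toℕ i ≈ + toℕ j → i ≡ j
  residue-unique {i} {j} h = Fin.toℕ-injective (helper (ℕ.≤-total (toℕ i) (toℕ j)))
    where
    aux : ∀ {m n} → m ℕ.≤ n → n ℕ.< p → + n ≈ + m → m ≡ n
    aux {m} {n} m≤n n<p h with n ℕ.∸ m in eq
    ... | zero  = ℕ.≤-antisym m≤n (ℕ.m∸n≡0⇒m≤n eq)
    ... | suc d = ⊥-elim (small≉0 {suc d} (ℕ.s≤s ℕ.z≤n) (ℕ.≤-<-trans (ℕ.≤-trans (ℕ.≤-reflexive (sym eq)) (ℕ.m∸n≤m n m)) n<p)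
            (≈-trans (≈-reflexive (trans (sym (cong +_ eq)) (trans (sym (⊖-≥ m≤n)) (sym (m-n≡m⊖n n m))))) (≈⇒-≈0 h)))
    helper : toℕ i ℕ.≤ toℕ j ⊎ toℕ j ℕ.≤ toℕ i → toℕ i ≡ toℕ j
    helper (inj₁ i≤j) = aux i≤j (Fin.toℕ<n j) (≈-sym h)
    helper (inj₂ j≤i) = sym (aux j≤i (Fin.toℕ<n i) h)

  indicator : ∀ {a} {A : Set a} → Dec A → ℤ
  indicator (yes _) = 1ℤ
  indicator (no _)  = 0ℤ

  opaque
    δ : ℤ → ℤ
    δ x = indicator (x ≈? 0ℤ)

    δ≡1 : ∀ {x} → x ≈ 0ℤ → δ x ≡ 1ℤ
    δ≡1 {x} h with x ≈? 0ℤ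
    ... | yes _ = refl
    ... | no ¬h = ⊥-elim (¬h h)

    δ≡0 : ∀ {x} → x ≉ 0ℤ → δ x ≡ 0ℤ
    δ≡0 {x} ¬h with x ≈? 0ℤ
    ... | yes h = ⊥-elim (¬h h)
    ... | no _  = refl

  δ-cases : ∀ x → (x ≈ 0ℤ × δ x ≡ 1ℤ) ⊎ (x ≉ 0ℤ × δ x ≡ 0ℤ)
  δ-cases x with x ≈? 0ℤ
  ... | yes h = inj₁ (h , δ≡1 h)
  ... | no ¬h = inj₂ (¬h , δ≡0 ¬h)

  δ-⇔ : ∀ {x y} → (x ≈ 0ℤ → y ≈ 0ℤ) → (y ≈ 0ℤ → x ≈ 0ℤ) → δ x ≡ δ y
  δ-⇔ {x} f g with δ-cases x
  ... | inj₁ (h , eq)  = trans eq (sym (δ≡1 (f h)))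
  ... | inj₂ (¬h , eq) = trans eq (sym (δ≡0 (¬h ∘ g)))

  δ-cong : ∀ {x y} → x ≈ y → δ x ≡ δ y
  δ-cong h = δ-⇔ (≈-trans (≈-sym h)) (≈-trans h)

  0≤δ : ∀ x → 0ℤ ≤ δ x
  0≤δ x with δ-cases x
  ... | inj₁ (_ , eq) = ≤-trans (+≤+ ℕ.z≤n) (≤-reflexive (sym eq))
  ... | inj₂ (_ , eq) = ≤-reflexive (sym eq)

  δ≤1 : ∀ x → δ x ≤ 1ℤ
  δ≤1 x with δ-cases x
  ... | inj₁ (_ , eq) = ≤-reflexive eq
  ... | inj₂ (_ , eq) = ≤-trans (≤-reflexive eq) (+≤+ ℕ.z≤n)

  -- Such an f factors through ℤ/p with exact integer values; only then may the representatives 0,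
  -- ..., p - 1 be exchanged for others under the sum.
  Periodic : (ℤ → ℤ) → Set
  Periodic f = ∀ {x y} → x ≈ y → f x ≡ f y

  sum-const : ∀ n c → sum {n} (λ _ → c) ≡ + n * c
  sum-const zero    c = refl
  sum-const (suc n) c = trans (cong (λ z → c + z) (sum-const n c)) (sym (suc-* (+ n) c))

  sum-mono : ∀ {n} {f g : Fin n → ℤ} → (∀ i → f i ≤ g i) → sum f ≤ sum g
  sum-mono {zero}  h = ≤-refl
  sum-mono {suc n} h = +-mono-≤ (h Fin.zero) (sum-mono (λ i → h (Fin.suc i)))

  sum-cong-≈ : ∀ {n} {f g : Fin n → ℤ} → (∀ i → f i ≈ g i) → sum f ≈ sum g
  sum-cong-≈ {zero}  h = ≈-refl
  sum-cong-≈ {suc n} h = +-cong-≈ (h Fin.zero) (sum-cong-≈ (λ i → h (Fin.suc i)))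

  sum-single : ∀ {n} (f : Fin n → ℤ) i → (∀ j → j ≢ i → f j ≡ 0ℤ) → sum f ≡ f i
  sum-single {suc n} f Fin.zero h = trans (cong (λ z → f Fin.zero + z)
    (trans (∑.sum-cong-≗ (λ j → h (Fin.suc j) λ ())) (trans (sum-const n 0ℤ) (*-zeroʳ (+ n))))) (+-identityʳ _)
  sum-single {suc n} f (Fin.suc i) h = trans (cong₂ _+_ (h Fin.zero λ ())
    (sum-single (f ∘ Fin.suc) i (λ j j≢i → h (Fin.suc j) (λ eq → j≢i (Fin.suc-injective eq))))) (+-identityˡ _)

  opaque
    ∑ₚ : (ℤ → ℤ) → ℤ
    ∑ₚ f = sum {p} (λ i → f (+ toℕ i))

    ∑ₚ-def : ∀ f → ∑ₚ f ≡ sum {p} (λ i → f (+ toℕ i))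
    ∑ₚ-def f = refl

    ∑-cong : ∀ {f g} → (∀ x → f x ≡ g x) → ∑ₚ f ≡ ∑ₚ g
    ∑-cong h = ∑.sum-cong-≗ {p} (λ i → h (+ toℕ i))

    ∑-cong-≈ : ∀ {f g} → (∀ x → f x ≈ g x) → ∑ₚ f ≈ ∑ₚ g
    ∑-cong-≈ h = sum-cong-≈ {p} (λ i → h (+ toℕ i))

    ∑-mono : ∀ {f g} → (∀ x → f x ≤ g x) → ∑ₚ f ≤ ∑ₚ g
    ∑-mono h = sum-mono {p} (λ i → h (+ toℕ i))

    ∑-+ : ∀ f g → ∑ₚ (λ x → f x + g x) ≡ ∑ₚ f + ∑ₚ g
    ∑-+ f g = ∑.∑-distrib-+ {p} (λ i → f (+ toℕ i)) (λ i → g (+ toℕ i))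

    ∑-* : ∀ c f → ∑ₚ (λ x → c * f x) ≡ c * ∑ₚ f
    ∑-* c f = sym (∑.*-distribˡ-sum {p} c (λ i → f (+ toℕ i)))

    ∑-const : ∀ c → ∑ₚ (λ _ → c) ≡ + p * c
    ∑-const = sum-const p

    ∑-sum-swap : ∀ n (f : ℤ → ℕ → ℤ) → ∑ₚ (λ x → sum {n} (f x ∘ toℕ)) ≡ sum {n} (λ i → ∑ₚ (λ x → f x (toℕ i)))
    ∑-sum-swap n f = ∑.∑-comm {p} {n} (λ i j → f (+ toℕ i) (toℕ j))

    ∑-swap : ∀ (f : ℤ → ℤ → ℤ) → ∑ₚ (λ x → ∑ₚ (λ y → f x y)) ≡ ∑ₚ (λ y → ∑ₚ (λ x → f x y))
    ∑-swap f = ∑.∑-comm {p} {p} (λ i j → f (+ toℕ i) (+ toℕ j))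

  ∑-neg : ∀ f → ∑ₚ (λ x → - f x) ≡ - ∑ₚ f
  ∑-neg f = trans (∑-cong (λ x → sym (-1*i≡-i (f x)))) (trans (∑-* (- 1ℤ) f) (-1*i≡-i (∑ₚ f)))

  ∑-∸ : ∀ f g → ∑ₚ (λ x → f x - g x) ≡ ∑ₚ f - ∑ₚ g
  ∑-∸ f g = trans (∑-+ f (λ x → - g x)) (cong (λ z → ∑ₚ f + z) (∑-neg g))

  ∑-zero : ∀ {f} → (∀ x → f x ≡ 0ℤ) → ∑ₚ f ≡ 0ℤ
  ∑-zero h = trans (∑-cong h) (trans (∑-const 0ℤ) (*-zeroʳ (+ p)))

  ∑-δ : ∀ {f} → Periodic f → ∀ c → ∑ₚ (λ x → δ (x - c) * f x) ≡ f c
  ∑-δ {f} f-per c with residue c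
  ... | i , c≈i = trans (∑ₚ-def _) (trans (sum-single (λ j → δ (+ toℕ j - c) * f (+ toℕ j)) i off) on)
    where
    on : δ (+ toℕ i - c) * f (+ toℕ i) ≡ f c
    on = trans (cong₂ _*_ (δ≡1 (≈⇒-≈0 (≈-sym c≈i))) (f-per (≈-sym c≈i))) (*-identityˡ (f c))
    off : ∀ j → j ≢ i → δ (+ toℕ j - c) * f (+ toℕ j) ≡ 0ℤ
    off j j≢i = cong (_* f (+ toℕ j)) (δ≡0 (λ h → j≢i (residue-unique (≈-trans (-≈0⇒≈ h) c≈i))))

  ∑-δ-1 : ∀ c → ∑ₚ (λ x → δ (x - c)) ≡ 1ℤ
  ∑-δ-1 c = trans (∑-cong (λ x → sym (*-identityʳ (δ (x - c))))) (∑-δ {λ _ → 1ℤ} (λ _ → refl) c)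

  -- Fermat's little theorem and power sums

  sum-last : ∀ n (f : ℕ → ℤ) → sum {suc n} (f ∘ toℕ) ≡ sum {n} (f ∘ toℕ) + f n
  sum-last zero    f = +-comm (f 0) 0ℤ
  sum-last (suc n) f = trans (cong (λ z → f 0 + z) (sum-last n (f ∘ suc)))
    (sym (+-assoc (f 0) (sum {n} (f ∘ suc ∘ toℕ)) (f (suc n))))

  sum≈last : ∀ n (f : ℕ → ℤ) → (∀ i → i ℕ.< n → f i ≈ 0ℤ) → sum {suc n} (f ∘ toℕ) ≈ f n
  sum≈last n f h = begin
    sum {suc n} (f ∘ toℕ)     ≡⟨ sum-last n f ⟩
    sum {n} (f ∘ toℕ) + f n   ≈⟨ +-cong-≈ (≈-trans (sum-cong-≈ {n} (λ i → h (toℕ i) (Fin.toℕ<n i)))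
                                   (≈-reflexive (trans (sum-const n 0ℤ) (*-zeroʳ (+ n))))) ≈-refl ⟩
    0ℤ + f n                  ≡⟨ +-identityˡ (f n) ⟩
    f n                       ∎
    where open ≈-Reasoning

  binomial-expansion : ∀ x n → (x + 1ℤ) ^ n ≡ sum {suc n} (λ i → + (n C toℕ i) * x ^ toℕ i)
  binomial-expansion x n = trans (^-lib (x + 1ℤ) n)
    (trans (Binomial.theorem +-*-commutativeSemiring n x 1ℤ) (∑.sum-cong-≗ {suc n} term))
    where
    open RawMonoid (CommutativeSemiring.+-rawMonoid +-*-commutativeSemiring) using () renaming (_×_ to _·_)
    open RawMonoid (CommutativeSemiring.*-rawMonoid +-*-commutativeSemiring) using () renaming (_×_ to _↑_)
    ^-lib : ∀ y n → y ^ n ≡ n ↑ y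
    ^-lib y zero    = refl
    ^-lib y (suc n) = cong (y *_) (^-lib y n)
    ·-lib : ∀ n y → n · y ≡ + n * y
    ·-lib zero    y = refl
    ·-lib (suc n) y = trans (cong (λ z → y + z) (·-lib n y)) (sym (suc-* (+ n) y))
    term : ∀ (i : Fin (suc n)) → (n C toℕ i) · ((toℕ i ↑ x) * ((n ℕ.∸ toℕ i) ↑ 1ℤ)) ≡ + (n C toℕ i) * x ^ toℕ i
    term i = trans (·-lib (n C toℕ i) _) (cong (λ z → + (n C toℕ i) * z)
      (trans (cong₂ _*_ (sym (^-lib x (toℕ i))) (trans (sym (^-lib 1ℤ (n ℕ.∸ toℕ i))) (^-zeroˡ (n ℕ.∸ toℕ i)))) (*-identityʳ _)))

  p∤! : ∀ {n} → n ℕ.< p → ¬ p ℕ.∣ n !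
  p∤! {zero}  _   d = ℕ.<⇒≱ 1<p (ℕ.∣⇒≤ d)
  p∤! {suc n} n<p d with euclidsLemma (suc n) (n !) p-prime d
  ... | inj₁ d′ = ℕ.<⇒≱ n<p (ℕ.∣⇒≤ d′)
  ... | inj₂ d′ = p∤! (ℕ.<-trans (ℕ.n<1+n n) n<p) d′

  p∣p! : p ℕ.∣ p !
  p∣p! = ∣n! p
    where
    ∣n! : ∀ n → .{{ℕ.NonZero n}} → n ℕ.∣ n !
    ∣n! (suc n) = ℕ.m∣m*n (n !)

  C*!*! : ∀ {n i} → i ℕ.≤ n → (n C i) ℕ.* (i ! ℕ.* (n ℕ.∸ i) !) ≡ n !
  C*!*! {n} {i} i≤n = trans (cong (ℕ._* (i ! ℕ.* (n ℕ.∸ i) !)) (nCk≡n!/k![n-k]! i≤n)) (ℕ.m/n*n≡m (k![n∸k]!∣n! i≤n))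
    where instance _ = ℕ._!*_!≢0 i (n ℕ.∸ i)

  p∣pCi : ∀ {i} → 0 ℕ.< i → i ℕ.< p → p ℕ.∣ p C i
  p∣pCi {i} 0<i i<p with euclidsLemma (p C i) (i ! ℕ.* (p ℕ.∸ i) !) p-prime (subst (p ℕ.∣_) (sym (C*!*! (ℕ.<⇒≤ i<p))) p∣p!)
  ... | inj₁ d = d
  ... | inj₂ d with euclidsLemma (i !) ((p ℕ.∸ i) !) p-prime d
  ...   | inj₁ d′ = ⊥-elim (p∤! i<p d′)
  ...   | inj₂ d′ = ⊥-elim (p∤! (ℕ.∸-monoʳ-< 0<i (ℕ.<⇒≤ i<p)) d′)

  frobenius-+1 : ∀ x → (x + 1ℤ) ^ p ≈ x ^ p + 1ℤ
  frobenius-+1 x = begin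
    (x + 1ℤ) ^ p                                      ≡⟨ binomial-expansion x p ⟩
    sum {suc p} (f ∘ toℕ)                             ≡⟨ sum-last p f ⟩
    sum {p} (f ∘ toℕ) + f p                           ≈⟨ +-cong-≈ (front p f refl middle) ≈-refl ⟩
    1ℤ + f p                                          ≡⟨ +-comm 1ℤ (f p) ⟩
    f p + 1ℤ                                          ≡⟨ cong (_+ 1ℤ) (trans (cong (λ m → + m * x ^ p) (nCn≡1 p)) (*-identityˡ (x ^ p))) ⟩
    x ^ p + 1ℤ                                        ∎
    where
    open ≈-Reasoning
    f : ℕ → ℤ
    f i = + (p C i) * x ^ i
    middle : ∀ i → 0 ℕ.< i → i ℕ.< p → f i ≈ 0ℤ
    middle i 0<i i<p = *-zeroˡ-≈ {+ (p C i)} (x ^ i) (∣⇒≈0 (+ (p C i)) (p∣pCi 0<i i<p))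
    front : ∀ n → .{{ℕ.NonZero n}} → ∀ f → f 0 ≡ 1ℤ → (∀ i → 0 ℕ.< i → i ℕ.< n → f i ≈ 0ℤ) → sum {n} (f ∘ toℕ) ≈ 1ℤ
    front (suc n) f f0≡1 h = +-cong-≈ (≈-reflexive f0≡1) (≈-trans
      (sum-cong-≈ {n} (λ i → h (suc (toℕ i)) (ℕ.s≤s ℕ.z≤n) (ℕ.s≤s (Fin.toℕ<n i))))
      (≈-reflexive (trans (sum-const n 0ℤ) (*-zeroʳ (+ n)))))

  0^ : ∀ n → .{{ℕ.NonZero n}} → 0ℤ ^ n ≡ 0ℤ
  0^ (suc n) = refl

  fermat-ℕ : ∀ n → (+ n) ^ p ≈ + n
  fermat-ℕ zero    = ≈-reflexive (0^ p)
  fermat-ℕ (suc n) = begin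
    (+ suc n) ^ p      ≡⟨ cong (λ m → (+ m) ^ p) (sym (ℕ.+-comm n 1)) ⟩
    (+ n + 1ℤ) ^ p     ≈⟨ frobenius-+1 (+ n) ⟩
    (+ n) ^ p + 1ℤ     ≈⟨ +-cong-≈ (fermat-ℕ n) ≈-refl ⟩
    + n + 1ℤ           ≡⟨ cong +_ (ℕ.+-comm n 1) ⟩
    + suc n            ∎
    where open ≈-Reasoning

  fermat : ∀ {x} → x ≉ 0ℤ → x ^ (p ℕ.∸ 1) ≈ 1ℤ
  fermat {x} x≉0 with residue x
  ... | i , x≈i = *-cancelˡ-≈ x x≉0 (begin
    x * x ^ (p ℕ.∸ 1)   ≡⟨ cong (x ^_) (ℕ.suc-pred p) ⟩
    x ^ p               ≈⟨ ^-cong-≈ p x≈i ⟩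
    (+ toℕ i) ^ p       ≈⟨ fermat-ℕ (toℕ i) ⟩
    + toℕ i             ≈⟨ ≈-sym x≈i ⟩
    x                   ≡⟨ sym (*-identityʳ x) ⟩
    x * 1ℤ              ∎)
    where open ≈-Reasoning

  opaque
    inverse : ∀ {x} → x ≉ 0ℤ → ∃ λ y → y * x ≈ 1ℤ
    inverse {x} x≉0 = x ^ (p ℕ.∸ 2) , ≈-trans (≈-reflexive (trans (*-comm (x ^ (p ℕ.∸ 2)) x)
      (cong (x ^_) (sym (ℕ.+-∸-assoc 1 1<p))))) (fermat x≉0)

  ∑-δ-linear : ∀ {c} b → c ≉ 0ℤ → ∑ₚ (λ x → δ (c * x - b)) ≡ 1ℤ
  ∑-δ-linear {c} b c≉0 with inverse c≉0
  ... | d , dc≈1 = trans (∑-cong (λ x → δ-⇔ (to x) (from x))) (∑-δ-1 (d * b))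
    where
    eq₁ : ∀ c d x b → (x - d * b) - 0ℤ ≡ d * (c * x - b - 0ℤ) + - x * (d * c - 1ℤ)
    eq₁ = solve-∀
    to : ∀ x → c * x - b ≈ 0ℤ → x - d * b ≈ 0ℤ
    to x h = by₂ d (- x) h dc≈1 (eq₁ c d x b)
    eq₂ : ∀ c d x b → (c * x - b) - 0ℤ ≡ c * (x - d * b - 0ℤ) + b * (d * c - 1ℤ)
    eq₂ = solve-∀
    from : ∀ x → x - d * b ≈ 0ℤ → c * x - b ≈ 0ℤ
    from x h = by₂ c b h dc≈1 (eq₂ c d x b)

  -- Double counting replaces a permutation of the residues: f (c x + d) is expanded as a sum over y
  -- of `δ (y - (c * x + d)) * f y`, and after the exchange of sums each y has exactly one x.
  ∑-reindex : ∀ {f} → Periodic f → ∀ {c} d → c ≉ 0ℤ → ∑ₚ (λ x → f (c * x + d)) ≡ ∑ₚ f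
  ∑-reindex {f} f-per {c} d c≉0 = begin
    ∑ₚ (λ x → f (c * x + d))                             ≡⟨ ∑-cong (λ x → sym (∑-δ {f} f-per (c * x + d))) ⟩
    ∑ₚ (λ x → ∑ₚ (λ y → δ (y - (c * x + d)) * f y))      ≡⟨ ∑-swap (λ x y → δ (y - (c * x + d)) * f y) ⟩
    ∑ₚ (λ y → ∑ₚ (λ x → δ (y - (c * x + d)) * f y))      ≡⟨ ∑-cong (λ y → trans
                                                               (∑-cong (λ x → trans (*-comm (δ (y - (c * x + d))) (f y)) (cong (λ z → f y * z) (δ-⇔ (to x y) (from x y)))))
                                                               (∑-* (f y) (λ x → δ (c * x - (y - d))))) ⟩
    ∑ₚ (λ y → f y * ∑ₚ (λ x → δ (c * x - (y - d))))      ≡⟨ ∑-cong (λ y → trans (cong (f y *_) (∑-δ-linear (y - d) c≉0)) (*-identityʳ (f y))) ⟩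
    ∑ₚ f                                                 ∎
    where
    open ≡-Reasoning
    eq : ∀ c d x y → (c * x - (y - d)) - 0ℤ ≡ - 1ℤ * (y - (c * x + d) - 0ℤ)
    eq = solve-∀
    eq′ : ∀ c d x y → (y - (c * x + d)) - 0ℤ ≡ - 1ℤ * (c * x - (y - d) - 0ℤ)
    eq′ = solve-∀
    to : ∀ x y → y - (c * x + d) ≈ 0ℤ → c * x - (y - d) ≈ 0ℤ
    to x y h = by₁ (- 1ℤ) h (eq c d x y)
    from : ∀ x y → c * x - (y - d) ≈ 0ℤ → y - (c * x + d) ≈ 0ℤ
    from x y h = by₁ (- 1ℤ) h (eq′ c d x y)

  ∑-telescope : ∀ f → ∑ₚ (λ x → f (x + 1ℤ) - f x) ≡ f (+ p) - f 0ℤ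
  ∑-telescope f = trans (∑-∸ (λ x → f (x + 1ℤ)) f)
    (rearrange (f 0ℤ) (∑ₚ (λ x → f (x + 1ℤ))) (∑ₚ f) (f (+ p)) (begin
      f 0ℤ + ∑ₚ (λ x → f (x + 1ℤ))   ≡⟨ cong (λ z → f 0ℤ + z) (trans (∑ₚ-def (λ x → f (x + 1ℤ)))
                                         (∑.sum-cong-≗ {p} (λ i → cong (λ m → f (+ m)) (ℕ.+-comm (toℕ i) 1)))) ⟩
      sum {suc p} (λ i → f (+ toℕ i)) ≡⟨ sum-last p (λ m → f (+ m)) ⟩
      sum {p} (λ i → f (+ toℕ i)) + f (+ p) ≡⟨ cong (λ z → z + f (+ p)) (sym (∑ₚ-def f)) ⟩
      ∑ₚ f + f (+ p) ∎))
    where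
    open ≡-Reasoning
    rearrange : ∀ a b c d → a + b ≡ c + d → b - c ≡ d - a
    rearrange a b c d h = trans (lem₁ a b c) (trans (cong (λ z → z - a - c) h) (lem₂ a c d))
      where
      lem₁ : ∀ a b c → b - c ≡ (a + b) - a - c
      lem₁ = solve-∀
      lem₂ : ∀ a c d → (c + d) - a - c ≡ d - a
      lem₂ = solve-∀

  -- Summing (x+1)ⁿ⁺¹ − xⁿ⁺¹ over a period gives 0, and the binomial expansion
  -- of the summand has leading term (n+1) xⁿ.
  power-sum : ∀ n → suc n ℕ.< p → ∑ₚ (_^ n) ≈ 0ℤ
  power-sum = <-rec _ step
    where
    open ≈-Reasoning
    step : ∀ n → (∀ {m} → m ℕ.< n → suc m ℕ.< p → ∑ₚ (_^ m) ≈ 0ℤ) → suc n ℕ.< p → ∑ₚ (_^ n) ≈ 0ℤ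
    step n ih n<p = [ (λ h → ⊥-elim (small≉0 (ℕ.s≤s ℕ.z≤n) n<p h)) , (λ h → h) ]′ (*≈0 (+ suc n) (∑ₚ (_^ n)) (begin
      + suc n * ∑ₚ (_^ n)
        ≡⟨ cong (λ m → + m * ∑ₚ (_^ n)) (sym [1+n]Cn) ⟩
      term n
        ≈⟨ ≈-sym (sum≈last n term λ m m<n → *-zeroʳ-≈ (+ (suc n C m)) {∑ₚ (_^ m)} (ih m<n (ℕ.<-trans (ℕ.s≤s m<n) n<p))) ⟩
      sum {suc n} (term ∘ toℕ)
        ≡⟨ ∑.sum-cong-≗ {suc n} (λ i → sym (∑-* (+ (suc n C toℕ i)) (_^ toℕ i))) ⟩
      sum {suc n} (λ i → ∑ₚ (λ x → c x (toℕ i)))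
        ≡⟨ sym (∑-sum-swap (suc n) c) ⟩
      ∑ₚ (λ x → sum {suc n} (c x ∘ toℕ))
        ≡⟨ ∑-cong (λ x → difference x) ⟩
      ∑ₚ (λ x → (x + 1ℤ) ^ suc n - x ^ suc n)
        ≡⟨ ∑-telescope (_^ suc n) ⟩
      (+ p) ^ suc n - 0ℤ
        ≡⟨ +-identityʳ ((+ p) ^ suc n) ⟩
      (+ p) ^ suc n
        ≈⟨ *-zeroˡ-≈ {+ p} ((+ p) ^ n) p≈0 ⟩
      0ℤ ∎))
      where
      c : ℤ → ℕ → ℤ
      c x i = + (suc n C i) * x ^ i
      term : ℕ → ℤ
      term i = + (suc n C i) * ∑ₚ (_^ i)
      [1+n]Cn : suc n C n ≡ suc n
      [1+n]Cn = trans (nCk≡nC[n∸k] (ℕ.n≤1+n n)) (trans (cong (suc n C_) (ℕ.m+n∸n≡m 1 n)) (nC1≡n (suc n)))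
      solve-for : ∀ s e x → e ≡ s + x → s ≡ e - x
      solve-for s _ x refl = lem s x
        where
        lem : ∀ s x → s ≡ (s + x) - x
        lem = solve-∀
      difference : ∀ x → sum {suc n} (c x ∘ toℕ) ≡ (x + 1ℤ) ^ suc n - x ^ suc n
      difference x = solve-for (sum {suc n} (c x ∘ toℕ)) ((x + 1ℤ) ^ suc n) (x ^ suc n) (trans (binomial-expansion x (suc n)) (trans (sum-last (suc n) (c x))
        (cong (λ z → sum {suc n} (c x ∘ toℕ) + z) (trans (cong (λ m → + m * x ^ suc n) (nCn≡1 (suc n))) (*-identityˡ (x ^ suc n))))))

  -- Fibres of x ↦ x² + e / x

  opaque
    search : ∀ {P : ℤ → Set} → (∀ {x y} → x ≈ y → P x → P y) → Decidable P → ∃ P ⊎ (∀ x → ¬ P x)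
    search resp P? with Fin.any? {n = p} (λ i → P? (+ toℕ i))
    ... | yes (i , Pi) = inj₁ (+ toℕ i , Pi)
    ... | no ¬P        = inj₂ λ x Px → ¬P (proj₁ (residue x) , resp (proj₂ (residue x)) Px)

  δ-* : ∀ x y → δ (x * y) ≡ δ x + δ y - δ x * δ y
  δ-* x y = helper (δ-cases x) (δ-cases y)
    where
    eq₁ : ∀ d → 1ℤ ≡ 1ℤ + d - 1ℤ * d
    eq₁ = solve-∀
    eq₂ : ∀ d → 1ℤ ≡ d + 1ℤ - d * 1ℤ
    eq₂ = solve-∀
    helper : (x ≈ 0ℤ × δ x ≡ 1ℤ) ⊎ (x ≉ 0ℤ × δ x ≡ 0ℤ) → (y ≈ 0ℤ × δ y ≡ 1ℤ) ⊎ (y ≉ 0ℤ × δ y ≡ 0ℤ) →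
      δ (x * y) ≡ δ x + δ y - δ x * δ y
    helper (inj₁ (x≈0 , δx≡1)) _ = trans (δ≡1 (*-zeroˡ-≈ {x} y x≈0))
      (subst (λ d → 1ℤ ≡ d + δ y - d * δ y) (sym δx≡1) (eq₁ (δ y)))
    helper (inj₂ _) (inj₁ (y≈0 , δy≡1)) = trans (δ≡1 (*-zeroʳ-≈ x {y} y≈0))
      (subst (λ d → 1ℤ ≡ δ x + d - δ x * d) (sym δy≡1) (eq₂ (δ x)))
    helper (inj₂ (x≉0 , δx≡0)) (inj₂ (y≉0 , δy≡0)) = trans (δ≡0 (*≉0 {x} {y} x≉0 y≉0))
      (subst₂ (λ d d′ → 0ℤ ≡ d + d′ - d * d′) (sym δx≡0) (sym δy≡0) refl)

  δ-shift-periodic : ∀ c → Periodic (λ x → δ (x - c))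
  δ-shift-periodic c h = δ-cong (∸-cong-≈ h (≈-refl {c}))

  ∑-δ-pair : ∀ u v → ∑ₚ (λ y → δ ((y - u) * (y - v))) ≡ + 2 - δ (u - v)
  ∑-δ-pair u v = begin
    ∑ₚ (λ y → δ ((y - u) * (y - v)))
      ≡⟨ ∑-cong (λ y → δ-* (y - u) (y - v)) ⟩
    ∑ₚ (λ y → δ (y - u) + δ (y - v) - δ (y - u) * δ (y - v))
      ≡⟨ ∑-∸ (λ y → δ (y - u) + δ (y - v)) (λ y → δ (y - u) * δ (y - v)) ⟩
    ∑ₚ (λ y → δ (y - u) + δ (y - v)) - ∑ₚ (λ y → δ (y - u) * δ (y - v))
      ≡⟨ cong₂ _-_ (trans (∑-+ (λ y → δ (y - u)) (λ y → δ (y - v))) (cong₂ _+_ (∑-δ-1 u) (∑-δ-1 v)))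
                   (∑-δ {λ y → δ (y - v)} (δ-shift-periodic v) u) ⟩
    + 2 - δ (u - v) ∎
    where open ≡-Reasoning

  pairs : ℤ → ℤ
  pairs e = ∑ₚ (λ x → ∑ₚ (λ y → δ (x * y * (x + y) - e)))

  module Fibres (e : ℤ) (e≉0 : e ≉ 0ℤ) (3≉0 : + 3 ≉ 0ℤ) where

    cubic : ℤ → ℤ → ℤ
    cubic b x = x * x * x - b * x + e

    partners : ℤ → ℤ
    partners x = ∑ₚ (λ y → δ (x * y * (x + y) - e))

    weight : ℤ → ℤ
    weight x = + 3 - partners x

    weight-periodic : Periodic weight
    weight-periodic {x} {x′} h = cong (λ d → + 3 - d) (∑-cong λ y → δ-cong
      (∸-cong-≈ (*-cong-≈ (*-cong-≈ h (≈-refl {y})) (+-cong-≈ h (≈-refl {y}))) (≈-refl {e})))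

    factor≉0 : ∀ x y → x * y ≈ e → x ≉ 0ℤ
    factor≉0 x y h x≈0 = e≉0 (≈-trans (≈-sym h) (*-zeroˡ-≈ {x} y x≈0))

    -- The hypotheses are Vieta's relations for the roots of X³ - b X + e, with b eliminated. The
    -- partners of x₀ are the other two roots, because x₀ w (x₀ + w) - e ≡ x₀ (w - y₀)(w - z₀).
    module Triple (x₀ y₀ z₀ : ℤ) (sum≈0 : x₀ + y₀ + z₀ ≈ 0ℤ) (product≈-e : x₀ * y₀ * z₀ ≈ - e) where

      x₀≉0 : x₀ ≉ 0ℤ
      x₀≉0 = factor≉0 x₀ (- (y₀ * z₀)) (by₁ (- 1ℤ) product≈-e (eq x₀ y₀ z₀ e))
        where
        eq : ∀ x y z e → x * (- (y * z)) - e ≡ - 1ℤ * (x * y * z - - e)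
        eq = solve-∀

      partners-δ : partners x₀ ≡ + 2 - δ (y₀ - z₀)
      partners-δ = trans (∑-cong λ w → δ-⇔ (to w) (from w)) (∑-δ-pair y₀ z₀)
        where
        key : ∀ w → x₀ * w * (x₀ + w) - e ≈ x₀ * ((w - y₀) * (w - z₀))
        key w = by₂ (x₀ * w) (- 1ℤ) sum≈0 product≈-e (eq x₀ y₀ z₀ w e)
          where
          eq : ∀ x y z w e → (x * w * (x + w) - e) - x * ((w - y) * (w - z)) ≡
            x * w * ((x + y + z) - 0ℤ) + - 1ℤ * (x * y * z - - e)
          eq = solve-∀
        to : ∀ w → x₀ * w * (x₀ + w) - e ≈ 0ℤ → (w - y₀) * (w - z₀) ≈ 0ℤ
        to w h = [ (λ x₀≈0 → ⊥-elim (x₀≉0 x₀≈0)) , (λ h′ → h′) ]′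
          (*≈0 x₀ ((w - y₀) * (w - z₀)) (≈-trans (≈-sym (key w)) h))
        from : ∀ w → (w - y₀) * (w - z₀) ≈ 0ℤ → x₀ * w * (x₀ + w) - e ≈ 0ℤ
        from w h = ≈-trans (key w) (*-zeroʳ-≈ x₀ {(w - y₀) * (w - z₀)} h)

      weight-δ : weight x₀ ≡ 1ℤ + δ (y₀ - z₀)
      weight-δ = trans (cong (λ d → + 3 - d) partners-δ) (eq (δ (y₀ - z₀)))
        where
        eq : ∀ d → + 3 - (+ 2 - d) ≡ 1ℤ + d
        eq = solve-∀

      δδ≡0 : δ (x₀ - y₀) * δ (y₀ - z₀) ≡ 0ℤ
      δδ≡0 = helper (δ-cases (x₀ - y₀)) (δ-cases (y₀ - z₀))
        where
        eq : ∀ x y z → + 3 * x - 0ℤ ≡ 1ℤ * ((x + y + z) - 0ℤ) + + 2 * ((x - y) - 0ℤ) + 1ℤ * ((y - z) - 0ℤ)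
        eq = solve-∀
        helper : (x₀ - y₀ ≈ 0ℤ × δ (x₀ - y₀) ≡ 1ℤ) ⊎ (x₀ - y₀ ≉ 0ℤ × δ (x₀ - y₀) ≡ 0ℤ) →
          (y₀ - z₀ ≈ 0ℤ × δ (y₀ - z₀) ≡ 1ℤ) ⊎ (y₀ - z₀ ≉ 0ℤ × δ (y₀ - z₀) ≡ 0ℤ) →
          δ (x₀ - y₀) * δ (y₀ - z₀) ≡ 0ℤ
        helper (inj₂ (_ , d≡0)) _ = cong (λ d → d * δ (y₀ - z₀)) d≡0
        helper (inj₁ _) (inj₂ (_ , d≡0)) = trans (cong (λ d → δ (x₀ - y₀) * d) d≡0) (*-zeroʳ (δ (x₀ - y₀)))
        helper (inj₁ (x≈y , _)) (inj₁ (y≈z , _)) =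
          ⊥-elim (*≉0 {+ 3} {x₀} 3≉0 x₀≉0 (by₃ 1ℤ (+ 2) 1ℤ sum≈0 x≈y y≈z (eq x₀ y₀ z₀)))

    -- Inclusion–exclusion over the three roots; no two of the coincidences
    -- x = y, y = z, z = x happen together, since 3 x₀ ≢ 0.
    fibre-triple : ∀ x₀ y₀ z₀ → x₀ + y₀ + z₀ ≈ 0ℤ → x₀ * y₀ * z₀ ≈ - e →
      ∑ₚ (λ x → δ ((x - x₀) * ((x - y₀) * (x - z₀))) * weight x) ≡ + 3
    fibre-triple x₀ y₀ z₀ sum≈0 product≈-e = begin
      ∑ₚ (λ x → δ ((x - x₀) * ((x - y₀) * (x - z₀))) * weight x)
        ≡⟨ ∑-cong expand ⟩
      ∑ₚ (λ x → (α x * weight x + β x * weight x + γ x * weight x) - (α x * (β x * weight x) + β x * (γ x * weight x) + γ x * (α x * weight x)) + α x * (β x * (γ x * weight x)))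
        ≡⟨ ∑-+ _ (λ x → α x * (β x * (γ x * weight x))) ⟩
      ∑ₚ (λ x → (α x * weight x + β x * weight x + γ x * weight x) - (α x * (β x * weight x) + β x * (γ x * weight x) + γ x * (α x * weight x))) + ∑ₚ (λ x → α x * (β x * (γ x * weight x)))
        ≡⟨ cong₂ _+_ (trans (∑-∸ (λ x → α x * weight x + β x * weight x + γ x * weight x) (λ x → α x * (β x * weight x) + β x * (γ x * weight x) + γ x * (α x * weight x)))
             (cong₂ _-_ (trans (∑₃ (λ x → α x * weight x) (λ x → β x * weight x) (λ x → γ x * weight x)) (+-cong₃ (at x₀ weight-periodic) (at y₀ weight-periodic) (at z₀ weight-periodic)))
                        (trans (∑₃ (λ x → α x * (β x * weight x)) (λ x → β x * (γ x * weight x)) (λ x → γ x * (α x * weight x)))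
                          (+-cong₃ (at x₀ (per y₀ weight-periodic)) (at y₀ (per z₀ weight-periodic)) (at z₀ (per x₀ weight-periodic))))))
             (at x₀ (per y₀ (per z₀ weight-periodic))) ⟩
      (weight x₀ + weight y₀ + weight z₀) - (β x₀ * weight x₀ + γ y₀ * weight y₀ + α z₀ * weight z₀) + β x₀ * (γ x₀ * weight x₀)
        ≡⟨ cong₂ (λ w w′ → w - w′ + β x₀ * (γ x₀ * weight x₀)) (+-cong₃ T₁.weight-δ T₂.weight-δ T₃.weight-δ)
             (+-cong₃ (cong (λ w → β x₀ * w) T₁.weight-δ) (cong (λ w → γ y₀ * w) T₂.weight-δ) (cong (λ w → α z₀ * w) T₃.weight-δ)) ⟩
      ((1ℤ + γ y₀) + (1ℤ + α z₀) + (1ℤ + β x₀)) - (β x₀ * (1ℤ + γ y₀) + γ y₀ * (1ℤ + α z₀) + α z₀ * (1ℤ + β x₀)) + β x₀ * (γ x₀ * weight x₀)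
        ≡⟨ eq (β x₀) (γ y₀) (α z₀) (γ x₀ * weight x₀) ⟩
      + 3 - (β x₀ * γ y₀) - (γ y₀ * α z₀) - (α z₀ * β x₀) + β x₀ * (γ x₀ * weight x₀)
        ≡⟨ cong₂ (λ a b → + 3 - a - b - (α z₀ * β x₀) + β x₀ * (γ x₀ * weight x₀)) T₁.δδ≡0 T₂.δδ≡0 ⟩
      + 3 - 0ℤ - 0ℤ - (α z₀ * β x₀) + β x₀ * (γ x₀ * weight x₀)
        ≡⟨ cong₂ (λ a b → + 3 - 0ℤ - 0ℤ - a + b) T₃.δδ≡0
             (trans (cong (λ d → β x₀ * (d * weight x₀)) (δ-⇔ (flip x₀ z₀) (flip z₀ x₀)))
               (trans (eq′ (β x₀) (α z₀) (weight x₀)) (cong (λ d → d * weight x₀) T₃.δδ≡0))) ⟩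
      + 3 ∎
      where
      open ≡-Reasoning
      α β γ : ℤ → ℤ
      α x = δ (x - x₀)
      β x = δ (x - y₀)
      γ x = δ (x - z₀)
      rot-sum : ∀ x y z → x + y + z ≈ 0ℤ → y + z + x ≈ 0ℤ
      rot-sum x y z h = ≈-trans (≈-reflexive (trans (+-comm (y + z) x) (sym (+-assoc x y z)))) h
      rot-product : ∀ x y z → x * y * z ≈ - e → y * z * x ≈ - e
      rot-product x y z h = ≈-trans (≈-reflexive (trans (*-comm (y * z) x) (sym (*-assoc x y z)))) h
      module T₁ = Triple x₀ y₀ z₀ sum≈0 product≈-e
      module T₂ = Triple y₀ z₀ x₀ (rot-sum x₀ y₀ z₀ sum≈0) (rot-product x₀ y₀ z₀ product≈-e)
      module T₃ = Triple z₀ x₀ y₀ (rot-sum y₀ z₀ x₀ (rot-sum x₀ y₀ z₀ sum≈0)) (rot-product y₀ z₀ x₀ (rot-product x₀ y₀ z₀ product≈-e))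
      flip : ∀ x y → x - y ≈ 0ℤ → y - x ≈ 0ℤ
      flip x y h = ≈⇒-≈0 {y} {x} (≈-sym (-≈0⇒≈ {x} {y} h))
      at : ∀ c {f} → Periodic f → ∑ₚ (λ x → δ (x - c) * f x) ≡ f c
      at c {f} f-per = ∑-δ {f} f-per c
      per : ∀ c {f} → Periodic f → Periodic (λ x → δ (x - c) * f x)
      per c f-per h = cong₂ _*_ (δ-shift-periodic c h) (f-per h)
      ∑₃ : ∀ f g h → ∑ₚ (λ x → f x + g x + h x) ≡ ∑ₚ f + ∑ₚ g + ∑ₚ h
      ∑₃ f g h = trans (∑-+ (λ x → f x + g x) h) (cong (λ s → s + ∑ₚ h) (∑-+ f g))
      ring : ∀ a b c w → (a + (b + c - b * c) - a * (b + c - b * c)) * w ≡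
        (a * w + b * w + c * w) - (a * (b * w) + b * (c * w) + c * (a * w)) + a * (b * (c * w))
      ring = solve-∀
      expand : ∀ x → δ ((x - x₀) * ((x - y₀) * (x - z₀))) * weight x ≡
        (α x * weight x + β x * weight x + γ x * weight x) - (α x * (β x * weight x) + β x * (γ x * weight x) + γ x * (α x * weight x)) + α x * (β x * (γ x * weight x))
      expand x = trans (cong (λ d → d * weight x) (trans (δ-* (x - x₀) ((x - y₀) * (x - z₀)))
        (cong (λ d → α x + d - α x * d) (δ-* (x - y₀) (x - z₀))))) (ring (α x) (β x) (γ x) (weight x))
      eq : ∀ a b c w → ((1ℤ + b) + (1ℤ + c) + (1ℤ + a)) - (a * (1ℤ + b) + b * (1ℤ + c) + c * (1ℤ + a)) + a * w ≡
        + 3 - (a * b) - (b * c) - (c * a) + a * w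
      eq = solve-∀
      eq′ : ∀ a c w → a * (c * w) ≡ c * a * w
      eq′ = solve-∀

    cubic-cong : ∀ b {x y} → x ≈ y → cubic b x ≈ cubic b y
    cubic-cong b x≈y = +-cong-≈ (∸-cong-≈ (*-cong-≈ (*-cong-≈ x≈y x≈y) x≈y) (*-cong-≈ (≈-refl {b}) x≈y)) (≈-refl {e})

    fibre-empty : ∀ b → (∀ x → cubic b x ≉ 0ℤ) → ∑ₚ (λ x → δ (cubic b x) * weight x) ≡ 0ℤ
    fibre-empty b no-root = ∑-zero λ x → cong (λ d → d * weight x) (δ≡0 (no-root x))

    -- A partner y₀ of the root x₀ makes the cubic split, with third root -(x₀ + y₀). Without a
    -- partner x₀ is the only root and carries the whole weight 3: for two roots x₀ and x, (x -
    -- x₀)(x₀ x (x₀ + x) - e) ≡ 0.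
    fibre-inhabited : ∀ b x₀ → cubic b x₀ ≈ 0ℤ → ∑ₚ (λ x → δ (cubic b x) * weight x) ≡ + 3
    fibre-inhabited b x₀ root = [ (λ (y₀ , h) → three-roots y₀ h) , one-root ]′
      (search {λ y → x₀ * y * (x₀ + y) ≈ e} (λ {x} {y} x≈y h → ≈-trans (*-cong-≈ (*-cong-≈ (≈-refl {x₀}) (≈-sym x≈y)) (+-cong-≈ (≈-refl {x₀}) (≈-sym x≈y))) h)
        (λ y → x₀ * y * (x₀ + y) ≈? e))
      where
      three-roots : ∀ y₀ → x₀ * y₀ * (x₀ + y₀) ≈ e → ∑ₚ (λ x → δ (cubic b x) * weight x) ≡ + 3
      three-roots y₀ h = trans (∑-cong λ x → cong (λ d → d * weight x) (δ-cong (factorisation x)))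
        (fibre-triple x₀ y₀ (- (x₀ + y₀)) (≈-reflexive (+-inverseʳ (x₀ + y₀))) (by₁ (- 1ℤ) h (eq₁ x₀ y₀ e)))
        where
        eq₁ : ∀ x y e → x * y * (- (x + y)) - - e ≡ - 1ℤ * (x * y * (x + y) - e)
        eq₁ = solve-∀
        eq₂ : ∀ x y e → x * (y * (x + y)) - e ≡ 1ℤ * (x * y * (x + y) - e)
        eq₂ = solve-∀
        eq₃ : ∀ x y b e → x * b - x * (x * x + x * y + y * y) ≡ - 1ℤ * ((x * x * x - b * x + e) - 0ℤ) + - 1ℤ * (x * y * (x + y) - e)
        eq₃ = solve-∀
        b≈ : b ≈ x₀ * x₀ + x₀ * y₀ + y₀ * y₀
        b≈ = *-cancelˡ-≈ x₀ (factor≉0 x₀ (y₀ * (x₀ + y₀)) (by₁ 1ℤ h (eq₂ x₀ y₀ e))) (by₂ (- 1ℤ) (- 1ℤ) root h (eq₃ x₀ y₀ b e))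
        eq₄ : ∀ x y b e u → (u * u * u - b * u + e) - (u - x) * ((u - y) * (u - (- (x + y)))) ≡
          - u * (b - (x * x + x * y + y * y)) + - 1ℤ * (x * y * (x + y) - e)
        eq₄ = solve-∀
        factorisation : ∀ x → cubic b x ≈ (x - x₀) * ((x - y₀) * (x - (- (x₀ + y₀))))
        factorisation x = by₂ (- x) (- 1ℤ) b≈ h (eq₄ x₀ y₀ b e x)
      one-root : (∀ y → ¬ x₀ * y * (x₀ + y) ≈ e) → ∑ₚ (λ x → δ (cubic b x) * weight x) ≡ + 3
      one-root no-partner = trans (∑-cong λ x → cong (λ d → d * weight x) (δ-⇔ (to x) (from x)))
        (trans (∑-δ {weight} weight-periodic x₀) (cong (λ d → + 3 - d) (∑-zero λ y → δ≡0 (no-partner y ∘ -≈0⇒≈))))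
        where
        eq : ∀ x₀ x b e → (x - x₀) * (x₀ * x * (x₀ + x) - e) - 0ℤ ≡
          x₀ * ((x * x * x - b * x + e) - 0ℤ) + - x * ((x₀ * x₀ * x₀ - b * x₀ + e) - 0ℤ)
        eq = solve-∀
        to : ∀ x → cubic b x ≈ 0ℤ → x - x₀ ≈ 0ℤ
        to x h = [ (λ x≈x₀ → x≈x₀) , (λ h′ → ⊥-elim (no-partner x (-≈0⇒≈ h′))) ]′
          (*≈0 (x - x₀) (x₀ * x * (x₀ + x) - e) (by₂ x₀ (- x) h root (eq x₀ x b e)))
        from : ∀ x → x - x₀ ≈ 0ℤ → cubic b x ≈ 0ℤ
        from x h = ≈-trans (cubic-cong b {x} {x₀} (-≈0⇒≈ h)) root

    ∑-cubic : ∀ x → ∑ₚ (λ b → δ (cubic b x)) ≡ 1ℤ - δ x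
    ∑-cubic x = [ (λ (x≈0 , eq) → trans (∑-zero (λ b → δ≡0 λ h → e≉0 (by₂ 1ℤ (b - x * x) h x≈0 (eq₁ x b e))))
                                    (cong (λ d → 1ℤ - d) (sym eq)))
                , (λ (x≉0 , eq) → trans (∑-cong (λ b → δ-⇔ (to b) (from b))) (trans (∑-δ-linear (x * x * x + e) x≉0)
                                    (cong (λ d → 1ℤ - d) (sym eq)))) ]′ (δ-cases x)
      where
      eq₁ : ∀ x b e → e - 0ℤ ≡ 1ℤ * ((x * x * x - b * x + e) - 0ℤ) + (b - x * x) * (x - 0ℤ)
      eq₁ = solve-∀
      eq₂ : ∀ x b e → (x * b - (x * x * x + e)) - 0ℤ ≡ - 1ℤ * ((x * x * x - b * x + e) - 0ℤ)
      eq₂ = solve-∀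
      eq₃ : ∀ x b e → (x * x * x - b * x + e) - 0ℤ ≡ - 1ℤ * ((x * b - (x * x * x + e)) - 0ℤ)
      eq₃ = solve-∀
      to : ∀ b → cubic b x ≈ 0ℤ → x * b - (x * x * x + e) ≈ 0ℤ
      to b h = by₁ (- 1ℤ) h (eq₂ x b e)
      from : ∀ b → x * b - (x * x * x + e) ≈ 0ℤ → cubic b x ≈ 0ℤ
      from b h = by₁ (- 1ℤ) h (eq₃ x b e)

    partners-0 : partners 0ℤ ≡ 0ℤ
    partners-0 = ∑-zero λ y → δ≡0 λ h → e≉0 (by₁ (- 1ℤ) h (eq y e))
      where
      eq : ∀ y e → e - 0ℤ ≡ - 1ℤ * ((0ℤ * y * (0ℤ + y) - e) - 0ℤ)
      eq = solve-∀

    -- Double counting of the pairs (b, x) with `cubic b x ≈ 0ℤ`, weighted by `weight x`. For fixed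
    -- b the total is 3 or 0; for fixed x ≢ 0 there is exactly one b, since b occurs linearly with
    -- coefficient -x. What remains is the total weight less that of 0, which is 3.
    value-count : ∀ (v : ℤ → ℤ) → (∀ b x → cubic b x ≈ 0ℤ → v b ≡ 1ℤ) → (∀ b → (∀ x → cubic b x ≉ 0ℤ) → v b ≡ 0ℤ) →
      + 3 * ∑ₚ v ≡ + 3 * + p - + 3 - pairs e
    value-count v v≡1 v≡0 = begin
      + 3 * ∑ₚ v
        ≡⟨ sym (∑-* (+ 3) v) ⟩
      ∑ₚ (λ b → + 3 * v b)
        ≡⟨ ∑-cong fibre ⟩
      ∑ₚ (λ b → ∑ₚ (λ x → δ (cubic b x) * weight x))
        ≡⟨ ∑-swap (λ b x → δ (cubic b x) * weight x) ⟩
      ∑ₚ (λ x → ∑ₚ (λ b → δ (cubic b x) * weight x))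
        ≡⟨ ∑-cong (λ x → trans (∑-cong (λ b → *-comm (δ (cubic b x)) (weight x)))
             (trans (∑-* (weight x) (λ b → δ (cubic b x))) (trans (cong (λ s → weight x * s) (∑-cubic x)) (ring (δ x) (weight x))))) ⟩
      ∑ₚ (λ x → weight x - δ x * weight x)
        ≡⟨ trans (∑-∸ weight (λ x → δ x * weight x)) (cong₂ _-_ (∑-∸ (λ _ → + 3) partners)
             (trans (∑-cong (λ x → cong (λ z → δ z * weight x) (sym (+-identityʳ x)))) (∑-δ {weight} weight-periodic 0ℤ))) ⟩
      ∑ₚ (λ _ → + 3) - pairs e - weight 0ℤ
        ≡⟨ cong₂ (λ a b → a - pairs e - (+ 3 - b)) (∑-const (+ 3)) partners-0 ⟩
      + p * + 3 - pairs e - (+ 3 - 0ℤ)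
        ≡⟨ ring′ (+ p) (pairs e) ⟩
      + 3 * + p - + 3 - pairs e ∎
      where
      open ≡-Reasoning
      ring : ∀ d w → w * (1ℤ - d) ≡ w - d * w
      ring = solve-∀
      ring′ : ∀ q m → q * + 3 - m - (+ 3 - 0ℤ) ≡ + 3 * q - + 3 - m
      ring′ = solve-∀
      fibre : ∀ b → + 3 * v b ≡ ∑ₚ (λ x → δ (cubic b x) * weight x)
      fibre b = [ (λ (x , h) → trans (cong (λ z → + 3 * z) (v≡1 b x h)) (sym (fibre-inhabited b x h)))
                , (λ none → trans (cong (λ z → + 3 * z) (v≡0 b none)) (sym (fibre-empty b none))) ]′
        (search {λ x → cubic b x ≈ 0ℤ} (λ x≈y → ≈-trans (cubic-cong b (≈-sym x≈y))) (λ x → cubic b x ≈? 0ℤ))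

  -- Cubic residues

  cubeCount : ℤ → ℤ → ℤ
  cubeCount e w = ∑ₚ (λ x → δ (w * (x * x * x) - e))

  quad : ℤ → ℤ
  quad t = t * t + t

  -- Substitute y = t x.
  pairs-cubeCount : ∀ {e} → e ≉ 0ℤ → pairs e ≡ ∑ₚ (λ t → cubeCount e (quad t))
  pairs-cubeCount {e} e≉0 = trans (∑-cong slope) (∑-swap (λ x t → δ (quad t * (x * x * x) - e)))
    where
    eq₁ : ∀ x y e → e - 0ℤ ≡ - 1ℤ * ((x * y * (x + y) - e) - 0ℤ) + y * (x + y) * (x - 0ℤ)
    eq₁ = solve-∀
    eq₂ : ∀ x q e → e - 0ℤ ≡ - 1ℤ * ((q * (x * x * x) - e) - 0ℤ) + q * (x * x) * (x - 0ℤ)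
    eq₂ = solve-∀
    eq₃ : ∀ x t e → x * (x * t + 0ℤ) * (x + (x * t + 0ℤ)) - e ≡ (t * t + t) * (x * x * x) - e
    eq₃ = solve-∀
    slope : ∀ x → ∑ₚ (λ y → δ (x * y * (x + y) - e)) ≡ ∑ₚ (λ t → δ (quad t * (x * x * x) - e))
    slope x = [ (λ (x≈0 , _) → trans (∑-zero λ y → δ≡0 λ h → e≉0 (by₂ (- 1ℤ) (y * (x + y)) h x≈0 (eq₁ x y e)))
                  (sym (∑-zero λ t → δ≡0 λ h → e≉0 (by₂ (- 1ℤ) (quad t * (x * x)) h x≈0 (eq₂ x (quad t) e)))))
              , (λ (x≉0 , _) → trans (sym (∑-reindex {λ y → δ (x * y * (x + y) - e)}
                    (λ h → δ-cong (∸-cong-≈ (*-cong-≈ (*-cong-≈ (≈-refl {x}) h) (+-cong-≈ (≈-refl {x}) h)) (≈-refl {e}))) {x} 0ℤ x≉0))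
                  (∑-cong λ t → cong δ (eq₃ x t e))) ]′ (δ-cases x)

  ∑-nonzero-quad : ∑ₚ (λ t → 1ℤ - δ (quad t)) ≡ + p - + 2
  ∑-nonzero-quad = trans (∑-∸ (λ _ → 1ℤ) (λ t → δ (quad t))) (cong₂ _-_ (trans (∑-const 1ℤ) (*-identityʳ (+ p)))
    (trans (∑-cong λ t → cong δ (eq t)) (trans (∑-δ-pair 0ℤ (- 1ℤ)) (cong (λ d → + 2 - d) (δ≡0 1≉0)))))
    where
    eq : ∀ t → t * t + t ≡ (t - 0ℤ) * (t - - 1ℤ)
    eq = solve-∀

  cubeCount-zero : ∀ {e w} → e ≉ 0ℤ → w ≈ 0ℤ → cubeCount e w ≡ 0ℤ
  cubeCount-zero {e} {w} e≉0 w≈0 = ∑-zero λ x → δ≡0 λ h → e≉0 (by₂ (- 1ℤ) (x * x * x) h w≈0 (eq x w e))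
    where
    eq : ∀ x w e → e - 0ℤ ≡ - 1ℤ * ((w * (x * x * x) - e) - 0ℤ) + x * x * x * (w - 0ℤ)
    eq = solve-∀

  ^-distribʳ-* : ∀ x y n → (x * y) ^ n ≡ x ^ n * y ^ n
  ^-distribʳ-* x y zero    = refl
  ^-distribʳ-* x y (suc n) = trans (cong (λ z → x * y * z) (^-distribʳ-* x y n)) (eq x y (x ^ n) (y ^ n))
    where
    eq : ∀ x y a b → x * y * (a * b) ≡ x * a * (y * b)
    eq = solve-∀

  cube-^ : ∀ x n → (x * x * x) ^ n ≡ x ^ (n ℕ.+ n ℕ.+ n)
  cube-^ x n = trans (^-distribʳ-* (x * x) x n) (trans (cong (λ z → z * x ^ n) (trans (^-distribʳ-* x x n) (sym (^-distribˡ-+-* x n n))))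
    (sym (^-distribˡ-+-* x (n ℕ.+ n) n)))

  ^-cube : ∀ x n → x ^ n * x ^ n * x ^ n ≡ x ^ (n ℕ.+ n ℕ.+ n)
  ^-cube x n = trans (cong (λ z → z * x ^ n) (sym (^-distribˡ-+-* x n n))) (sym (^-distribˡ-+-* x (n ℕ.+ n) n))

  -- If p ≡ 2 (mod 3), x ↦ x²ᵏ⁺¹ inverts cubing.
  module TwoMod3 (k : ℕ) (p≡ : p ≡ 2 ℕ.+ (k ℕ.+ k ℕ.+ k)) where

    m : ℕ
    m = suc (k ℕ.+ k)

    3m≡ : m ℕ.+ m ℕ.+ m ≡ suc ((p ℕ.∸ 1) ℕ.+ (p ℕ.∸ 1))
    3m≡ = subst (λ q → m ℕ.+ m ℕ.+ m ≡ suc ((q ℕ.∸ 1) ℕ.+ (q ℕ.∸ 1))) (sym p≡) (eq k)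
      where
      eq : ∀ k → suc (k ℕ.+ k) ℕ.+ suc (k ℕ.+ k) ℕ.+ suc (k ℕ.+ k) ≡ suc (suc (k ℕ.+ k ℕ.+ k) ℕ.+ suc (k ℕ.+ k ℕ.+ k))
      eq = ℕSolver.solve-∀

    ^3m : ∀ {x} → x ≉ 0ℤ → x ^ (m ℕ.+ m ℕ.+ m) ≈ x
    ^3m {x} x≉0 = begin
      x ^ (m ℕ.+ m ℕ.+ m)                        ≡⟨ cong (x ^_) 3m≡ ⟩
      x * x ^ ((p ℕ.∸ 1) ℕ.+ (p ℕ.∸ 1))          ≡⟨ cong (x *_) (^-distribˡ-+-* x (p ℕ.∸ 1) (p ℕ.∸ 1)) ⟩
      x * (x ^ (p ℕ.∸ 1) * x ^ (p ℕ.∸ 1))        ≈⟨ *-cong-≈ (≈-refl {x}) (*-cong-≈ (fermat x≉0) (fermat x≉0)) ⟩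
      x * (1ℤ * 1ℤ)                              ≡⟨ *-identityʳ x ⟩
      x                                          ∎
      where open ≈-Reasoning

    cubeCount-one : ∀ {e w} → e ≉ 0ℤ → w ≉ 0ℤ → cubeCount e w ≡ 1ℤ
    cubeCount-one {e} {w} e≉0 w≉0 = trans (∑-cong λ x → δ-⇔ (to x) (from x)) (∑-δ-1 c)
      where
      d : ℤ
      d = proj₁ (inverse w≉0)
      dw≈1 : d * w ≈ 1ℤ
      dw≈1 = proj₂ (inverse w≉0)
      c : ℤ
      c = (d * e) ^ m
      eq₀ : ∀ d w e → e - 0ℤ ≡ w * (d * e - 0ℤ) + - e * (d * w - 1ℤ)
      eq₀ = solve-∀
      de≉0 : d * e ≉ 0ℤ
      de≉0 h = e≉0 (by₂ w (- e) h dw≈1 (eq₀ d w e))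
      eq₁ : ∀ d w e X → X - d * e ≡ d * ((w * X - e) - 0ℤ) + - X * (d * w - 1ℤ)
      eq₁ = solve-∀
      eq₂ : ∀ x w e → e - 0ℤ ≡ - 1ℤ * ((w * (x * x * x) - e) - 0ℤ) + w * (x * x) * (x - 0ℤ)
      eq₂ = solve-∀
      to : ∀ x → w * (x * x * x) - e ≈ 0ℤ → x - c ≈ 0ℤ
      to x h = ≈⇒-≈0 (begin
        x                      ≈⟨ ≈-sym (^3m (λ x≈0 → e≉0 (by₂ (- 1ℤ) (w * (x * x)) h x≈0 (eq₂ x w e)))) ⟩
        x ^ (m ℕ.+ m ℕ.+ m)    ≡⟨ sym (cube-^ x m) ⟩
        (x * x * x) ^ m        ≈⟨ ^-cong-≈ {x * x * x} {d * e} m (by₂ d (- (x * x * x)) h dw≈1 (eq₁ d w e (x * x * x))) ⟩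
        c                      ∎)
        where open ≈-Reasoning
      c³≈ : c * c * c ≈ d * e
      c³≈ = ≈-trans (≈-reflexive (^-cube (d * e) m)) (^3m de≉0)
      eq₃ : ∀ d w e X → (w * X - e) - 0ℤ ≡ w * (X - d * e) + e * (d * w - 1ℤ)
      eq₃ = solve-∀
      from : ∀ x → x - c ≈ 0ℤ → w * (x * x * x) - e ≈ 0ℤ
      from x h = by₂ w e (≈-trans (*-cong-≈ (*-cong-≈ x≈c x≈c) x≈c) c³≈) dw≈1 (eq₃ d w e (x * x * x))
        where
        x≈c : x ≈ c
        x≈c = -≈0⇒≈ h

    pairs-two : ∀ {e} → e ≉ 0ℤ → pairs e ≡ + p - + 2
    pairs-two {e} e≉0 = trans (pairs-cubeCount e≉0) (trans (∑-cong λ t →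
      [ (λ (h , eq) → trans (cubeCount-zero {e} {quad t} e≉0 h) (cong (λ d → 1ℤ - d) (sym eq)))
      , (λ (h , eq) → trans (cubeCount-one {e} {quad t} e≉0 h) (cong (λ d → 1ℤ - d) (sym eq))) ]′ (δ-cases (quad t))) ∑-nonzero-quad)

  -- Geometric sums, the cofactors of x - v in xⁿ - vⁿ

  geometric : ℤ → ℤ → ℕ → ℤ
  geometric x v zero    = 0ℤ
  geometric x v (suc n) = x ^ n + v * geometric x v n

  geometric-telescopes : ∀ x v n → (x - v) * geometric x v n ≡ x ^ n - v ^ n
  geometric-telescopes x v zero    = *-zeroʳ (x - v)
  geometric-telescopes x v (suc n) = trans (eq₁ x v (x ^ n) (geometric x v n))
    (trans (cong (λ z → (x - v) * x ^ n + v * z) (geometric-telescopes x v n)) (eq₂ x v (x ^ n) (v ^ n)))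
    where
    eq₁ : ∀ x v X G → (x - v) * (X + v * G) ≡ (x - v) * X + v * ((x - v) * G)
    eq₁ = solve-∀
    eq₂ : ∀ x v X V → (x - v) * X + v * (X - V) ≡ x * X - v * V
    eq₂ = solve-∀

  -- At x ≡ v each of the n terms is vⁿ⁻¹; the extra factor v on both sides avoids the exponent n -
  -- 1.
  geometric-diagonal : ∀ {x v} n → x ≈ v → v * geometric x v n ≈ + n * v ^ n
  geometric-diagonal {x} {v} zero    h = ≈-reflexive (*-zeroʳ v)
  geometric-diagonal {x} {v} (suc n) h = by₂ v v (^-cong-≈ {x} {v} n h) (geometric-diagonal n h)
    (trans (cong (λ s → v * (x ^ n + v * geometric x v n) - s * (v * v ^ n)) (suc-homo n)) (eq v (x ^ n) (v ^ n) (geometric x v n) (+ n)))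
    where
    suc-homo : ∀ n → + suc n ≡ 1ℤ + + n
    suc-homo n = refl
    eq : ∀ v X V G n → v * (X + v * G) - (1ℤ + n) * (v * V) ≡ v * (X - V) + v * (v * G - n * V)
    eq = solve-∀

  -- Turns a count known mod p into its exact value. The trivial bound on a count is p and not p -
  -- 1, but x = p would give m ≡ 0.
  small-residue : ∀ {x m} → x ≈ + m → 0ℤ ≤ x → x ≤ + p → 0 ℕ.< m → m ℕ.< p → x ≡ + m
  small-residue {+ n} {m} h _ (+≤+ n≤p) 0<m m<p with ℕ.m≤n⇒m<n∨m≡n n≤p
  ... | inj₂ refl = ⊥-elim (small≉0 0<m m<p (≈-trans (≈-sym h) p≈0))
  ... | inj₁ n<p = cong +_ (trans (sym (Fin.toℕ-fromℕ< n<p)) (trans (cong toℕ (residue-unique {Fin.fromℕ< n<p} {Fin.fromℕ< m<p}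
      (subst₂ (λ i j → + i ≈ + j) (sym (Fin.toℕ-fromℕ< n<p)) (sym (Fin.toℕ-fromℕ< m<p)) h))) (Fin.toℕ-fromℕ< m<p)))

  0≤∑ : ∀ {f} → (∀ x → 0ℤ ≤ f x) → 0ℤ ≤ ∑ₚ f
  0≤∑ h = ≤-trans (≤-reflexive (sym (∑-zero {λ _ → 0ℤ} λ _ → refl))) (∑-mono h)

  ∑≤p : ∀ {f} → (∀ x → f x ≤ 1ℤ) → ∑ₚ f ≤ + p
  ∑≤p h = ≤-trans (∑-mono h) (≤-reflexive (trans (∑-const 1ℤ) (*-identityʳ (+ p))))

  -- Parity of symmetric counts

  symmetric-sum : ∀ {n} (g : Fin n → Fin n → ℤ) → (∀ i j → g i j ≡ g j i) →
    ∃ λ m → sum (λ i → sum (λ j → g i j)) ≡ sum (λ i → g i i) + + 2 * m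
  symmetric-sum {zero}  g g-sym = 0ℤ , refl
  symmetric-sum {suc n} g g-sym = row + proj₁ ih , (begin
    (g₀₀ + row) + sum (λ i → g (Fin.suc i) Fin.zero + sum (λ j → g (Fin.suc i) (Fin.suc j)))
      ≡⟨ cong (λ s → (g₀₀ + row) + s) (∑.∑-distrib-+ (λ i → g (Fin.suc i) Fin.zero) (λ i → sum (λ j → g (Fin.suc i) (Fin.suc j)))) ⟩
    (g₀₀ + row) + (sum (λ i → g (Fin.suc i) Fin.zero) + sum (λ i → sum (λ j → g (Fin.suc i) (Fin.suc j))))
      ≡⟨ cong₂ (λ a b → (g₀₀ + row) + (a + b)) (∑.sum-cong-≗ (λ i → g-sym (Fin.suc i) Fin.zero)) (proj₂ ih) ⟩
    (g₀₀ + row) + (row + (diag + + 2 * proj₁ ih))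
      ≡⟨ eq g₀₀ row diag (proj₁ ih) ⟩
    (g₀₀ + diag) + + 2 * (row + proj₁ ih) ∎)
    where
    open ≡-Reasoning
    ih : ∃ λ m → sum (λ i → sum (λ j → g (Fin.suc i) (Fin.suc j))) ≡ sum (λ i → g (Fin.suc i) (Fin.suc i)) + + 2 * m
    ih = symmetric-sum (λ i j → g (Fin.suc i) (Fin.suc j)) (λ i j → g-sym (Fin.suc i) (Fin.suc j))
    g₀₀ row diag : ℤ
    g₀₀ = g Fin.zero Fin.zero
    row = sum (λ j → g Fin.zero (Fin.suc j))
    diag = sum (λ i → g (Fin.suc i) (Fin.suc i))
    eq : ∀ g r d m → (g + r) + (r + (d + + 2 * m)) ≡ (g + d) + + 2 * (r + m)
    eq = solve-∀

  ∑-symmetric : ∀ (g : ℤ → ℤ → ℤ) → (∀ x y → g x y ≡ g y x) →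
    ∃ λ m → ∑ₚ (λ x → ∑ₚ (λ y → g x y)) ≡ ∑ₚ (λ x → g x x) + + 2 * m
  ∑-symmetric g g-sym = proj₁ r , trans (trans (∑ₚ-def (λ x → ∑ₚ (λ y → g x y))) (∑.sum-cong-≗ {p} (λ i → ∑ₚ-def (g (+ toℕ i)))))
    (trans (proj₂ r) (cong (λ s → s + + 2 * proj₁ r) (sym (∑ₚ-def (λ x → g x x)))))
    where
    r : ∃ λ m → sum {p} (λ i → sum {p} (λ j → g (+ toℕ i) (+ toℕ j))) ≡ sum {p} (λ i → g (+ toℕ i) (+ toℕ i)) + + 2 * m
    r = symmetric-sum {p} (λ i j → g (+ toℕ i) (+ toℕ j)) (λ i j → g-sym (+ toℕ i) (+ toℕ j))

  -- The solutions off the diagonal come in couples (x, y), (y, x); on the diagonal the equation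
  -- reads 2x³ = e.
  pairs-parity : ∀ e → ∃ λ m → pairs e ≡ cubeCount e (+ 2) + + 2 * m
  pairs-parity e = proj₁ r , trans (proj₂ r) (cong (λ s → s + + 2 * proj₁ r) (∑-cong λ x → cong δ (eq₂ x e)))
    where
    eq₁ : ∀ x y e → x * y * (x + y) - e ≡ y * x * (y + x) - e
    eq₁ = solve-∀
    eq₂ : ∀ x e → x * x * (x + x) - e ≡ + 2 * (x * x * x) - e
    eq₂ = solve-∀
    r : ∃ λ m → pairs e ≡ ∑ₚ (λ x → δ (x * x * (x + x) - e)) + + 2 * m
    r = ∑-symmetric (λ x y → δ (x * y * (x + y) - e)) (λ x y → cong δ (eq₁ x y e))

  deficit : ℤ → ℤ
  deficit e = + p - + 2 - pairs e

  -- Points on the conics c (t² + t) = t′² + t′ with t′² + t′ ≠ 0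

  nonzero*δ≡0 : ∀ q y → (q ≉ 0ℤ → y ≉ 0ℤ) → (1ℤ - δ q) * δ y ≡ 0ℤ
  nonzero*δ≡0 q y f =
    [ (λ (_ , eq) → cong (λ d → (1ℤ - d) * δ y) eq)
    , (λ (h , _) → trans (cong (λ d → (1ℤ - δ q) * d) (δ≡0 (f h))) (*-zeroʳ (1ℤ - δ q))) ]′ (δ-cases q)

  nonzero*δ≤δ : ∀ q y z → (q ≉ 0ℤ → y ≈ 0ℤ → z ≈ 0ℤ) → (1ℤ - δ q) * δ y ≤ δ z
  nonzero*δ≤δ q y z f =
    [ (λ (_ , eq) → ≤-trans (≤-reflexive (cong (λ d → (1ℤ - d) * δ y) eq)) (0≤δ z))
    , (λ (h , eq) → ≤-trans (≤-reflexive (trans (cong (λ d → (1ℤ - d) * δ y) eq) (*-identityˡ (δ y))))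
        ([ (λ (h′ , eq′) → ≤-reflexive (trans eq′ (sym (δ≡1 (f h h′))))) , (λ (_ , eq′) → ≤-trans (≤-reflexive eq′) (0≤δ z)) ]′ (δ-cases y))) ]′ (δ-cases q)

  module Conic (c : ℤ) where

    term : ℤ → ℤ → ℤ
    term t t′ = (1ℤ - δ (quad t′)) * δ (quad t * c - quad t′)

    term-periodic : ∀ t → Periodic (term t)
    term-periodic t {x} {y} h = cong₂ (λ d d′ → (1ℤ - d) * d′) (δ-cong quad≈) (δ-cong (∸-cong-≈ (≈-refl {quad t * c}) quad≈))
      where
      quad≈ : quad x ≈ quad y
      quad≈ = +-cong-≈ (*-cong-≈ h h) h

    -- For c ≡ 1 the conic is the pair of lines t = t′ and t = -1 - t′, so each t′ has at most two
    -- points.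
    unit-bound : c ≈ 1ℤ → ∑ₚ (λ t′ → ∑ₚ (λ t → term t t′)) ≤ + p * + 2
    unit-bound c≈1 = ≤-trans (∑-mono λ t′ → ≤-trans (∑-mono λ t → nonzero*δ≤δ (quad t′) (quad t * c - quad t′) ((t - t′) * (t - (- 1ℤ - t′)))
        λ _ h → by₂ 1ℤ (- quad t) h c≈1 (eq t t′ c))
      (≤-trans (≤-reflexive (∑-δ-pair t′ (- 1ℤ - t′))) (≤-trans (+-monoʳ-≤ (+ 2) (neg-mono-≤ (0≤δ (t′ - (- 1ℤ - t′))))) ≤-refl)))
      (≤-reflexive (∑-const (+ 2)))
      where
      eq : ∀ t t′ c → (t - t′) * (t - (- 1ℤ - t′)) - 0ℤ ≡ 1ℤ * (((t * t + t) * c - (t′ * t′ + t′)) - 0ℤ) + - (t * t + t) * (c - 1ℤ)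
      eq = solve-∀

    quad-multiple≈0 : ∀ t {m} → m ≈ 0ℤ → quad (t * m) ≈ 0ℤ
    quad-multiple≈0 t {m} h = by₁ (t * t * m + t) h (eq t m)
      where
      eq : ∀ t m → (t * m * (t * m) + t * m) - 0ℤ ≡ (t * t * m + t) * (m - 0ℤ)
      eq = solve-∀

    -- The conic c (t² + t) = t′² + t′ passes through the origin, so each line
    -- t′ = m t meets it in at most one further point.
    on-line : ∀ t m → quad (t * m) ≉ 0ℤ → quad t * c - quad (t * m) ≈ 0ℤ → (c - m * m) * t - (m - c) ≈ 0ℤ
    on-line t m q≉0 h = [ (λ t≈0 → ⊥-elim (q≉0 (by₁ (t * m * m + m) t≈0 (eq₁ t m)))) , (λ h′ → h′) ]′
      (*≈0 t ((c - m * m) * t - (m - c)) (by₁ 1ℤ h (eq₂ t m c)))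
      where
      eq₁ : ∀ t m → (t * m * (t * m) + t * m) - 0ℤ ≡ (t * m * m + m) * (t - 0ℤ)
      eq₁ = solve-∀
      eq₂ : ∀ t m c → t * ((c - m * m) * t - (m - c)) - 0ℤ ≡ 1ℤ * (((t * t + t) * c - (t * m * (t * m) + t * m)) - 0ℤ)
      eq₂ = solve-∀

    -- The equation of `on-line` is linear in t. If its leading coefficient c - m² vanishes, a
    -- solution forces m ≡ c too, hence c ≡ c². Then c ≡ 1 is excluded by hypothesis, and c ≡ 0
    -- gives m ≡ 0, so that t′ = t m lies where t′² + t′ ≡ 0.
    line-bound : c ≉ 1ℤ → ∀ m → ∑ₚ (λ t → term t (t * m)) ≤ 1ℤ
    line-bound c≉1 m = [ (λ (h , _) → ≤-trans (≤-reflexive (∑-zero λ t → nonzero*δ≡0 (quad (t * m)) (quad t * c - quad (t * m)) (degenerate h t))) (+≤+ ℕ.z≤n))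
                       , (λ (h , _) → ≤-trans (∑-mono λ t → nonzero*δ≤δ (quad (t * m)) (quad t * c - quad (t * m)) ((c - m * m) * t - (m - c)) (on-line t m))
                                        (≤-reflexive (∑-δ-linear {c - m * m} (m - c) h))) ]′ (δ-cases (c - m * m))
      where
      eq₁ : ∀ t m c → c * (c - 1ℤ) - 0ℤ ≡ (- 1ℤ - t * (m + c)) * ((c - m * m) - 0ℤ) + (m + c) * (((c - m * m) * t - (m - c)) - 0ℤ)
      eq₁ = solve-∀
      eq₂ : ∀ t m c → m - 0ℤ ≡ t * ((c - m * m) - 0ℤ) + - 1ℤ * (((c - m * m) * t - (m - c)) - 0ℤ) + 1ℤ * (c - 0ℤ)
      eq₂ = solve-∀
      degenerate : c - m * m ≈ 0ℤ → ∀ t → quad (t * m) ≉ 0ℤ → quad t * c - quad (t * m) ≉ 0ℤ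
      degenerate h t q≉0 h′ = [ (λ c≈0 → q≉0 (quad-multiple≈0 t (by₃ t (- 1ℤ) 1ℤ h line c≈0 (eq₂ t m c))))
                              , (λ c-1≈0 → c≉1 (-≈0⇒≈ c-1≈0)) ]′ (*≈0 c (c - 1ℤ) (by₂ (- 1ℤ - t * (m + c)) (m + c) h line (eq₁ t m c)))
        where
        line : (c - m * m) * t - (m - c) ≈ 0ℤ
        line = on-line t m q≉0 h′

    -- For t ≢ 0 the map m ↦ t m permutes the residues. At t ≡ 0 the equation gives t′² + t′ ≡ 0,
    -- which the first factor of `term` suppresses on both sides.
    through-origin : ∀ t → ∑ₚ (λ t′ → term t t′) ≡ ∑ₚ (λ m → term t (t * m))
    through-origin t = [ (λ (t≈0 , _) → trans (∑-zero λ t′ → origin t≈0 t′) (sym (∑-zero λ m → origin t≈0 (t * m))))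
                       , (λ (t≉0 , _) → trans (sym (∑-reindex {term t} (term-periodic t) {t} 0ℤ t≉0)) (∑-cong λ m → cong (term t) (+-identityʳ (t * m)))) ]′ (δ-cases t)
      where
      eq : ∀ t c q → q - 0ℤ ≡ - 1ℤ * (((t * t + t) * c - q) - 0ℤ) + (t + 1ℤ) * c * (t - 0ℤ)
      eq = solve-∀
      origin : t ≈ 0ℤ → ∀ t′ → term t t′ ≡ 0ℤ
      origin t≈0 t′ = nonzero*δ≡0 (quad t′) (quad t * c - quad t′) λ q≉0 h → q≉0 (by₂ (- 1ℤ) ((t + 1ℤ) * c) h t≈0 (eq t c (quad t′)))

    non-unit-bound : c ≉ 1ℤ → ∑ₚ (λ t′ → ∑ₚ (λ t → term t t′)) ≤ + p
    non-unit-bound c≉1 = ≤-trans (≤-reflexive (trans (∑-swap (λ t′ t → term t t′)) (trans (∑-cong through-origin) (∑-swap (λ t m → term t (t * m))))))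
      (∑≤p (line-bound c≉1))

    bound : ∑ₚ (λ t′ → ∑ₚ (λ t → term t t′)) ≤ + p + + p * δ (c - 1ℤ)
    bound = [ (λ (h , eq) → ≤-trans (unit-bound (-≈0⇒≈ h)) (≤-reflexive (trans (ring (+ p)) (cong (λ d → + p + + p * d) (sym eq)))))
            , (λ (h , eq) → ≤-trans (non-unit-bound (h ∘ ≈⇒-≈0)) (≤-reflexive (trans (ring′ (+ p)) (cong (λ d → + p + + p * d) (sym eq))))) ]′ (δ-cases (c - 1ℤ))
      where
      ring : ∀ q → q * + 2 ≡ q + q * 1ℤ
      ring = solve-∀
      ring′ : ∀ q → q ≡ q + q * 0ℤ
      ring′ = solve-∀

  -- The form U² + 3V² and the representation p = A² + 3B²

  0≤square : ∀ i → 0ℤ ≤ i * i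
  0≤square i = ≤-trans (+≤+ ℕ.z≤n) (≤-reflexive (sym (square i)))
    where
    square : ∀ i → i * i ≡ + (∣ i ∣ ℕ.* ∣ i ∣)
    square (+ n)    = sym (pos-* n n)
    square -[1+ n ] = refl

  1≤square : ∀ i → i ≢ 0ℤ → 1ℤ ≤ i * i
  1≤square (+ zero)  i≢0 = ⊥-elim (i≢0 refl)
  1≤square +[1+ n ]  i≢0 = +≤+ (ℕ.s≤s ℕ.z≤n)
  1≤square -[1+ n ]  i≢0 = +≤+ (ℕ.s≤s ℕ.z≤n)

  -- For u ≠ 0 the integer 3u + 1 has absolute value at least 2, and for u = 0, V ≠ 0 the form is at
  -- least 1 + 3. Both (-1, 0) and (0, ±1) reach 4, so the strict bound is the best possible.
  form<4 : ∀ u V → (+ 3 * u + 1ℤ) * (+ 3 * u + 1ℤ) + + 3 * (V * V) < + 4 → u ≡ 0ℤ × V ≡ 0ℤ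
  form<4 u V bound = u≡0 u≟0 , V≡0
    where
    open ≤-Reasoning
    u≟0 : Dec (u ≡ 0ℤ)
    u≟0 = u ≟ 0ℤ
    eq₁ : ∀ n → (+ 3 * (1ℤ + n) + 1ℤ) * (+ 3 * (1ℤ + n) + 1ℤ) ≡ + 4 + (+ 12 + + 24 * n + + 9 * (n * n))
    eq₁ = solve-∀
    eq₂ : ∀ n → (+ 3 * - (1ℤ + n) + 1ℤ) * (+ 3 * - (1ℤ + n) + 1ℤ) ≡ + 4 + (+ 12 * n + + 9 * (n * n))
    eq₂ = solve-∀
    big : ∀ v → v ≢ 0ℤ → + 4 ≤ (+ 3 * v + 1ℤ) * (+ 3 * v + 1ℤ)
    big (+ zero)  v≢0 = ⊥-elim (v≢0 refl)
    big +[1+ n ]  v≢0 = ≤-trans (i≤i+j (+ 4) (+ (12 ℕ.+ 24 ℕ.* n ℕ.+ 9 ℕ.* (n ℕ.* n))))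
      (≤-reflexive (trans (cong (λ z → + 4 + z) (cong₂ _+_ (cong (λ z → + 12 + z) (pos-* 24 n)) (trans (pos-* 9 (n ℕ.* n)) (cong (λ z → + 9 * z) (pos-* n n))))) (sym (eq₁ (+ n)))))
    big -[1+ n ]  v≢0 = ≤-trans (i≤i+j (+ 4) (+ (12 ℕ.* n ℕ.+ 9 ℕ.* (n ℕ.* n))))
      (≤-reflexive (trans (cong (λ z → + 4 + z) (cong₂ _+_ (pos-* 12 n) (trans (pos-* 9 (n ℕ.* n)) (cong (λ z → + 9 * z) (pos-* n n))))) (sym (eq₂ (+ n)))))
    u≡0 : Dec (u ≡ 0ℤ) → u ≡ 0ℤ
    u≡0 (yes eq) = eq
    u≡0 (no u≢0) = ⊥-elim (<-irrefl refl (begin-strict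
      + 4                                                      ≤⟨ big u u≢0 ⟩
      (+ 3 * u + 1ℤ) * (+ 3 * u + 1ℤ)                          ≡⟨ sym (+-identityʳ _) ⟩
      (+ 3 * u + 1ℤ) * (+ 3 * u + 1ℤ) + 0ℤ                     ≤⟨ +-monoʳ-≤ ((+ 3 * u + 1ℤ) * (+ 3 * u + 1ℤ)) (*-monoˡ-≤-nonNeg (+ 3) (0≤square V)) ⟩
      (+ 3 * u + 1ℤ) * (+ 3 * u + 1ℤ) + + 3 * (V * V)          <⟨ bound ⟩
      + 4                                                      ∎))
    V≡0 : V ≡ 0ℤ
    V≡0 with V ≟ 0ℤ
    ... | yes eq = eq
    ... | no V≢0 = ⊥-elim (<-irrefl refl (begin-strict
      + 4                                                      ≤⟨ +-monoʳ-≤ (+ 1) (*-monoˡ-≤-nonNeg (+ 3) (1≤square V V≢0)) ⟩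
      + 1 + + 3 * (V * V)                                      ≡⟨ cong (λ v → (+ 3 * v + 1ℤ) * (+ 3 * v + 1ℤ) + + 3 * (V * V)) (sym (u≡0 u≟0)) ⟩
      (+ 3 * u + 1ℤ) * (+ 3 * u + 1ℤ) + + 3 * (V * V)          <⟨ bound ⟩
      + 4                                                      ∎))

  ≈0⇒multiple : ∀ {x} → x ≈ 0ℤ → ∃ λ q → x ≡ q * + p
  ≈0⇒multiple {x} (mod (divides q eq)) = q , trans (sym (+-identityʳ x)) eq

  -- If p divided B it would divide A, and then p² would divide A² + 3B² = p.
  B≉0 : ∀ A B → + p ≡ A * A + + 3 * (B * B) → B ≉ 0ℤ
  B≉0 A B p≡A²+3B² B≈0 = 1≉0 (≈-trans (≈-reflexive (*-cancelˡ-≡ (+ p) 1ℤ _ (trans (*-identityʳ (+ p)) (trans p≡A²+3B²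
      (trans (cong₂ (λ a b → a * a + + 3 * (b * b)) (proj₂ A-multiple) (proj₂ B-multiple)) (eq₂ (proj₁ A-multiple) (proj₁ B-multiple) (+ p)))))))
      (*-zeroʳ-≈ (proj₁ A-multiple * proj₁ A-multiple + + 3 * (proj₁ B-multiple * proj₁ B-multiple)) p≈0))
    where
    eq₁ : ∀ A B → A * A - 0ℤ ≡ 1ℤ * ((A * A + + 3 * (B * B)) - 0ℤ) + - (+ 3 * B) * (B - 0ℤ)
    eq₁ = solve-∀
    eq₂ : ∀ a b q → a * q * (a * q) + + 3 * (b * q * (b * q)) ≡ q * ((a * a + + 3 * (b * b)) * q)
    eq₂ = solve-∀
    A≈0 : A ≈ 0ℤ
    A≈0 = [ (λ h → h) , (λ h → h) ]′ (*≈0 A A (by₂ 1ℤ (- (+ 3 * B)) (subst (_≈ 0ℤ) p≡A²+3B² p≈0) B≈0 (eq₁ A B)))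
    A-multiple : ∃ λ q → A ≡ q * + p
    A-multiple = ≈0⇒multiple A≈0
    B-multiple : ∃ λ q → B ≡ q * + p
    B-multiple = ≈0⇒multiple B≈0

  opaque
    p-odd : 2 ℕ.< p → ∃ λ q → + p ≡ + 2 * q + 1ℤ
    p-odd 2<p with p ℕ.% 2 in eq | p ℕ./ 2 in eq′ | ℕ.m≡m%n+[m/n]*n p 2 | ℕ.m%n<n p 2 | ℕ.m/n<m p 2 (ℕ.s≤s (ℕ.s≤s ℕ.z≤n))
    ... | 0 | q | p≡2q   | _ | q<p = ⊥-elim ([ small≉0 (ℕ.s≤s ℕ.z≤n) 2<p , small≉0 0<q q<p ]′
      (*≈0 (+ 2) (+ q) (≈-trans (≈-reflexive (trans (sym (pos-* 2 q)) (cong +_ (trans (ℕ.*-comm 2 q) (sym p≡2q))))) p≈0)))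
      where
      0<q : 0 ℕ.< q
      0<q = ℕ.n≢0⇒n>0 λ { refl → ℕ.<⇒≱ 1<p (subst (ℕ._≤ 1) (sym p≡2q) ℕ.z≤n) }
    ... | 1 | q | p≡2q+1 | _ | _ = + q , (trans (cong +_ (trans p≡2q+1 (trans (ℕ.+-comm 1 (q ℕ.* 2)) (cong (ℕ._+ 1) (ℕ.*-comm q 2)))))
      (cong (λ z → z + 1ℤ) (pos-* 2 q)))
    ... | suc (suc _) | _ | _ | ℕ.s≤s (ℕ.s≤s ()) | _

  -- Cubic characters for p = 3k + 1

  module OneMod3 (k : ℕ) (0<k : 0 ℕ.< k) (p≡ : p ≡ suc (k ℕ.+ k ℕ.+ k)) where

    3<p : 3 ℕ.< p
    3<p = subst (3 ℕ.<_) (sym p≡) (ℕ.s≤s (ℕ.+-mono-≤ (ℕ.+-mono-≤ 0<k 0<k) 0<k))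

    ^3k : ∀ {x} → x ≉ 0ℤ → x ^ (k ℕ.+ k ℕ.+ k) ≈ 1ℤ
    ^3k {x} x≉0 = subst (λ q → x ^ (q ℕ.∸ 1) ≈ 1ℤ) p≡ (fermat x≉0)

    cube-^k : ∀ {x} → x ≉ 0ℤ → (x * x * x) ^ k ≈ 1ℤ
    cube-^k {x} x≉0 = ≈-trans (≈-reflexive (cube-^ x k)) (^3k x≉0)

    ^k-cube : ∀ {x} → x ≉ 0ℤ → x ^ k * x ^ k * x ^ k ≈ 1ℤ
    ^k-cube {x} x≉0 = ≈-trans (≈-reflexive (^-cube x k)) (^3k x≉0)

    0^k : 0ℤ ^ k ≡ 0ℤ
    0^k = 0^ k {{ℕ.>-nonZero 0<k}}

    power-sum-cubes : ∀ {n} → n ℕ.< k → ∑ₚ (λ x → (x * x * x) ^ n) ≈ 0ℤ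
    power-sum-cubes {n} n<k = ≈-trans (≈-reflexive (∑-cong λ x → cube-^ x n))
      (power-sum (n ℕ.+ n ℕ.+ n) (subst (suc (n ℕ.+ n ℕ.+ n) ℕ.<_) (sym p≡) (ℕ.s≤s (ℕ.+-mono-< (ℕ.+-mono-< n<k n<k) n<k))))

    ∑-geometric-cubes : ∀ v {n} → n ℕ.≤ k → ∑ₚ (λ x → geometric (x * x * x) v n) ≈ 0ℤ
    ∑-geometric-cubes v {zero}  _   = ≈-reflexive (∑-zero λ _ → refl)
    ∑-geometric-cubes v {suc n} n<k = begin
      ∑ₚ (λ x → (x * x * x) ^ n + v * geometric (x * x * x) v n)
        ≡⟨ trans (∑-+ (λ x → (x * x * x) ^ n) (λ x → v * geometric (x * x * x) v n))
             (cong (λ s → ∑ₚ (λ x → (x * x * x) ^ n) + s) (∑-* v (λ x → geometric (x * x * x) v n))) ⟩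
      ∑ₚ (λ x → (x * x * x) ^ n) + v * ∑ₚ (λ x → geometric (x * x * x) v n)
        ≈⟨ +-cong-≈ {∑ₚ (λ x → (x * x * x) ^ n)} {0ℤ} {v * ∑ₚ (λ x → geometric (x * x * x) v n)} {0ℤ}
             (power-sum-cubes n<k) (*-zeroʳ-≈ v (∑-geometric-cubes v (ℕ.<⇒≤ n<k))) ⟩
      0ℤ ∎
      where open ≈-Reasoning

    -- For vᵏ = 1 the factor G of x³ᵏ − vᵏ = (x³ − v) G vanishes unless x = 0 or
    -- x³ = v, while its sum over x is 0 by the vanishing of power sums.
    geometric-pointwise : ∀ {v} → v ≉ 0ℤ → v ^ k ≈ 1ℤ → ∀ x → v * geometric (x * x * x) v k ≈ δ x + + k * δ (x * x * x - v)
    geometric-pointwise {v} v≉0 v^k≈1 x =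
      [ at-0 , (λ (x≉0 , δx≡0) → [ at-root x≉0 δx≡0 , off-root x≉0 δx≡0 ]′ (δ-cases (x * x * x - v))) ]′ (δ-cases x)
      where
      open ≈-Reasoning
      G : ℤ
      G = geometric (x * x * x) v k
      telescopes : (x * x * x - v) * G ≈ (x * x * x) ^ k - 1ℤ
      telescopes = ≈-trans (≈-reflexive (geometric-telescopes (x * x * x) v k)) (∸-cong-≈ (≈-refl {(x * x * x) ^ k}) v^k≈1)
      at-0 : x ≈ 0ℤ × δ x ≡ 1ℤ → v * G ≈ δ x + + k * δ (x * x * x - v)
      at-0 (x≈0 , δx≡1) = begin
        v * G                                         ≈⟨ by₂ (- 1ℤ) (G * (x * x)) telescopes x≈0 (eq x v G ((x * x * x) ^ k)) ⟩
        1ℤ - (x * x * x) ^ k                          ≈⟨ ∸-cong-≈ (≈-refl {1ℤ}) (^-cong-≈ {x * x * x} {0ℤ} k (*-zeroʳ-≈ (x * x) x≈0)) ⟩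
        1ℤ - 0ℤ ^ k                                   ≡⟨ cong (λ z → 1ℤ - z) 0^k ⟩
        1ℤ                                            ≡⟨ sym (trans (cong₂ (λ a b → a + + k * b) δx≡1 (δ≡0 λ h → v≉0 (by₂ (- 1ℤ) (x * x) h x≈0 (eq′ x v))))
                                                           (cong (λ z → 1ℤ + z) (*-zeroʳ (+ k)))) ⟩
        δ x + + k * δ (x * x * x - v)                 ∎
        where
        eq : ∀ x v G X → v * G - (1ℤ - X) ≡ - 1ℤ * ((x * x * x - v) * G - (X - 1ℤ)) + G * (x * x) * (x - 0ℤ)
        eq = solve-∀
        eq′ : ∀ x v → v - 0ℤ ≡ - 1ℤ * ((x * x * x - v) - 0ℤ) + x * x * (x - 0ℤ)
        eq′ = solve-∀
      at-root : x ≉ 0ℤ → δ x ≡ 0ℤ → x * x * x - v ≈ 0ℤ × δ (x * x * x - v) ≡ 1ℤ → v * G ≈ δ x + + k * δ (x * x * x - v)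
      at-root x≉0 δx≡0 (h , δ≡1) = begin
        v * G                            ≈⟨ geometric-diagonal {x * x * x} {v} k (-≈0⇒≈ h) ⟩
        + k * v ^ k                      ≈⟨ *-cong-≈ (≈-refl {+ k}) v^k≈1 ⟩
        + k * 1ℤ                         ≡⟨ sym (+-identityˡ (+ k * 1ℤ)) ⟩
        0ℤ + + k * 1ℤ                    ≡⟨ sym (cong₂ (λ a b → a + + k * b) δx≡0 δ≡1) ⟩
        δ x + + k * δ (x * x * x - v)    ∎
      off-root : x ≉ 0ℤ → δ x ≡ 0ℤ → x * x * x - v ≉ 0ℤ × δ (x * x * x - v) ≡ 0ℤ → v * G ≈ δ x + + k * δ (x * x * x - v)
      off-root x≉0 δx≡0 (h , δ≡0) = begin
        v * G                            ≈⟨ *-zeroʳ-≈ v G≈0 ⟩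
        0ℤ                               ≡⟨ sym (trans (+-identityˡ (+ k * 0ℤ)) (*-zeroʳ (+ k))) ⟩
        0ℤ + + k * 0ℤ                    ≡⟨ sym (cong₂ (λ a b → a + + k * b) δx≡0 δ≡0) ⟩
        δ x + + k * δ (x * x * x - v)    ∎
        where
        G≈0 : G ≈ 0ℤ
        G≈0 = [ (λ h′ → ⊥-elim (h h′)) , (λ h′ → h′) ]′ (*≈0 (x * x * x - v) G (≈-trans telescopes (≈⇒-≈0 (cube-^k x≉0))))

    -- Summing `geometric-pointwise` over a period gives 1 + k S ≡ 0 for the number S of roots. As
    -- 3k ≡ -1, this is S ≡ 3, and 0 ≤ S ≤ p with p > 3 makes it an equality.
    ∑-cube-root : ∀ {v} → v ≉ 0ℤ → v ^ k ≈ 1ℤ → ∑ₚ (λ x → δ (x * x * x - v)) ≡ + 3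
    ∑-cube-root {v} v≉0 v^k≈1 = small-residue {S} {3} S≈3 (0≤∑ λ x → 0≤δ (x * x * x - v)) (∑≤p λ x → δ≤1 (x * x * x - v)) (ℕ.s≤s ℕ.z≤n) 3<p
      where
      open ≈-Reasoning
      S : ℤ
      S = ∑ₚ (λ x → δ (x * x * x - v))
      1+kS≈0 : 1ℤ + + k * S ≈ 0ℤ
      1+kS≈0 = begin
        1ℤ + + k * S
          ≡⟨ cong₂ _+_ (sym (trans (∑-cong λ x → cong δ (sym (+-identityʳ x))) (∑-δ-1 0ℤ))) (sym (∑-* (+ k) (λ x → δ (x * x * x - v)))) ⟩
        ∑ₚ δ + ∑ₚ (λ x → + k * δ (x * x * x - v))
          ≡⟨ sym (∑-+ δ (λ x → + k * δ (x * x * x - v))) ⟩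
        ∑ₚ (λ x → δ x + + k * δ (x * x * x - v))
          ≈⟨ ∑-cong-≈ (λ x → ≈-sym (geometric-pointwise v≉0 v^k≈1 x)) ⟩
        ∑ₚ (λ x → v * geometric (x * x * x) v k)
          ≡⟨ ∑-* v (λ x → geometric (x * x * x) v k) ⟩
        v * ∑ₚ (λ x → geometric (x * x * x) v k)
          ≈⟨ *-zeroʳ-≈ v (∑-geometric-cubes v ℕ.≤-refl) ⟩
        0ℤ ∎
      1+3k≈0 : 1ℤ + (+ k + + k + + k) ≈ 0ℤ
      1+3k≈0 = subst (λ q → + q ≈ 0ℤ) p≡ p≈0
      eq : ∀ S k → S - + 3 ≡ - + 3 * ((1ℤ + k * S) - 0ℤ) + S * ((1ℤ + (k + k + k)) - 0ℤ)
      eq = solve-∀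
      S≈3 : S ≈ + 3
      S≈3 = by₂ (- + 3) S 1+kS≈0 1+3k≈0 (eq S (+ k))

    cubeCount-no : ∀ {e w} → e ≉ 0ℤ → w ^ k ≉ e ^ k → cubeCount e w ≡ 0ℤ
    cubeCount-no {e} {w} e≉0 w^k≉e^k = ∑-zero λ x → δ≡0 λ h → w^k≉e^k (≈-sym (begin
      e ^ k                    ≈⟨ ^-cong-≈ {e} {w * (x * x * x)} k (≈-sym (-≈0⇒≈ h)) ⟩
      (w * (x * x * x)) ^ k    ≡⟨ ^-distribʳ-* w (x * x * x) k ⟩
      w ^ k * (x * x * x) ^ k  ≈⟨ *-cong-≈ (≈-refl {w ^ k}) (cube-^k {x} λ x≈0 → e≉0 (by₂ (- 1ℤ) (w * (x * x)) h x≈0 (eq x w e))) ⟩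
      w ^ k * 1ℤ               ≡⟨ *-identityʳ (w ^ k) ⟩
      w ^ k                    ∎))
      where
      open ≈-Reasoning
      eq : ∀ x w e → e - 0ℤ ≡ - 1ℤ * ((w * (x * x * x) - e) - 0ℤ) + w * (x * x) * (x - 0ℤ)
      eq = solve-∀

    cubeCount-yes : ∀ {e w} → e ≉ 0ℤ → w ≉ 0ℤ → w ^ k ≈ e ^ k → cubeCount e w ≡ + 3
    cubeCount-yes {e} {w} e≉0 w≉0 w^k≈e^k = trans (∑-cong λ x → δ-⇔ (to x) (from x)) (∑-cube-root de≉0 de^k≈1)
      where
      open ≈-Reasoning
      d : ℤ
      d = proj₁ (inverse w≉0)
      dw≈1 : d * w ≈ 1ℤ
      dw≈1 = proj₂ (inverse w≉0)
      eq₀ : ∀ d w e → e - 0ℤ ≡ w * (d * e - 0ℤ) + - e * (d * w - 1ℤ)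
      eq₀ = solve-∀
      de≉0 : d * e ≉ 0ℤ
      de≉0 h = e≉0 (by₂ w (- e) h dw≈1 (eq₀ d w e))
      de^k≈1 : (d * e) ^ k ≈ 1ℤ
      de^k≈1 = begin
        (d * e) ^ k     ≡⟨ ^-distribʳ-* d e k ⟩
        d ^ k * e ^ k   ≈⟨ *-cong-≈ (≈-refl {d ^ k}) (≈-sym w^k≈e^k) ⟩
        d ^ k * w ^ k   ≡⟨ sym (^-distribʳ-* d w k) ⟩
        (d * w) ^ k     ≈⟨ ^-cong-≈ {d * w} {1ℤ} k dw≈1 ⟩
        1ℤ ^ k          ≡⟨ ^-zeroˡ k ⟩
        1ℤ              ∎
      eq₁ : ∀ d w e X → (X - d * e) - 0ℤ ≡ d * ((w * X - e) - 0ℤ) + - X * (d * w - 1ℤ)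
      eq₁ = solve-∀
      eq₂ : ∀ d w e X → (w * X - e) - 0ℤ ≡ w * ((X - d * e) - 0ℤ) + e * (d * w - 1ℤ)
      eq₂ = solve-∀
      to : ∀ x → w * (x * x * x) - e ≈ 0ℤ → x * x * x - d * e ≈ 0ℤ
      to x h = by₂ d (- (x * x * x)) h dw≈1 (eq₁ d w e (x * x * x))
      from : ∀ x → x * x * x - d * e ≈ 0ℤ → w * (x * x * x) - e ≈ 0ℤ
      from x h = by₂ w e h dw≈1 (eq₂ d w e (x * x * x))

    opaque
      cubeCount-value : ∀ e w → e ≉ 0ℤ →
        (w ≈ 0ℤ × cubeCount e w ≡ 0ℤ) ⊎ (w ≉ 0ℤ × w ^ k ≉ e ^ k × cubeCount e w ≡ 0ℤ) ⊎ (w ≉ 0ℤ × w ^ k ≈ e ^ k × cubeCount e w ≡ + 3)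
      cubeCount-value e w e≉0 with w ≈? 0ℤ | w ^ k ≈? e ^ k
      ... | yes w≈0 | _     = inj₁ (w≈0 , cubeCount-zero {e} {w} e≉0 w≈0)
      ... | no w≉0  | no h  = inj₂ (inj₁ (w≉0 , h , cubeCount-no {e} {w} e≉0 h))
      ... | no w≉0  | yes h = inj₂ (inj₂ (w≉0 , h , cubeCount-yes {e} {w} e≉0 w≉0 h))

    2≉0 : + 2 ≉ 0ℤ
    2≉0 = small≉0 (ℕ.s≤s ℕ.z≤n) (ℕ.<-trans (ℕ.n<1+n 2) 3<p)

    3≉0 : + 3 ≉ 0ℤ
    3≉0 = small≉0 (ℕ.s≤s ℕ.z≤n) 3<p

    -- Exhibits the count as 3 times an integer and as depending on e only through eᵏ. The first
    -- yields `deficit` mod 3, the second its invariance on classes modulo cubes.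
    cubeCount-formula : ∀ {e} → e ≉ 0ℤ → ∀ w → cubeCount e w ≡ + 3 * ((1ℤ - δ w) * δ (w ^ k - e ^ k))
    cubeCount-formula {e} e≉0 w =
      [ (λ (h , eq) → trans eq (sym (cong (λ d → + 3 * ((1ℤ - d) * δ (w ^ k - e ^ k))) (δ≡1 h))))
      , [ (λ (_ , h , eq) → trans eq (sym (trans (cong (λ d → + 3 * ((1ℤ - δ w) * d)) (δ≡0 (h ∘ -≈0⇒≈)))
            (cong (λ z → + 3 * z) (*-zeroʳ (1ℤ - δ w))))))
        , (λ (h , h′ , eq) → trans eq (sym (cong₂ (λ d d′ → + 3 * ((1ℤ - d) * d′)) (δ≡0 h) (δ≡1 (≈⇒-≈0 h′))))) ]′ ]′
      (cubeCount-value e w e≉0)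

    pairs-formula : ∀ {e} → e ≉ 0ℤ → pairs e ≡ + 3 * ∑ₚ (λ t → (1ℤ - δ (quad t)) * δ (quad t ^ k - e ^ k))
    pairs-formula {e} e≉0 = trans (pairs-cubeCount e≉0) (trans (∑-cong λ t → cubeCount-formula e≉0 (quad t))
      (∑-* (+ 3) (λ t → (1ℤ - δ (quad t)) * δ (quad t ^ k - e ^ k))))

    cubeCount-class : ∀ {e e′} → e ≉ 0ℤ → e′ ≉ 0ℤ → e ^ k ≈ e′ ^ k → ∀ w → cubeCount e w ≡ cubeCount e′ w
    cubeCount-class {e} {e′} e≉0 e′≉0 h w = trans (cubeCount-formula e≉0 w) (trans
      (cong (λ d → + 3 * ((1ℤ - δ w) * d)) (δ-cong (∸-cong-≈ (≈-refl {w ^ k}) h))) (sym (cubeCount-formula e′≉0 w)))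

    pairs-class : ∀ {e e′} → e ≉ 0ℤ → e′ ≉ 0ℤ → e ^ k ≈ e′ ^ k → pairs e ≡ pairs e′
    pairs-class e≉0 e′≉0 h = trans (pairs-cubeCount e≉0)
      (trans (∑-cong λ t → cubeCount-class e≉0 e′≉0 h (quad t)) (sym (pairs-cubeCount e′≉0)))

    -- Orthogonality of cubic characters. As E³ ≡ 1, the products E² W and E W² are ρ and ρ² for ρ =
    -- W / E, and 1 + ρ + ρ² is 3 for ρ = 1 and 0 for the other cube roots of unity. The term with
    -- `δ` removes the 1 when w ≡ 0.
    cubeCount-≈ : ∀ {e} → e ≉ 0ℤ → ∀ w → cubeCount e w ≈ e ^ k * e ^ k * w ^ k + e ^ k * (w ^ k * w ^ k) + (1ℤ - δ w)
    cubeCount-≈ {e} e≉0 w = [ at-0 , [ other , same ]′ ]′ (cubeCount-value e w e≉0)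
      where
      open ≈-Reasoning
      E W : ℤ
      E = e ^ k
      W = w ^ k
      E³≈1 : E * E * E ≈ 1ℤ
      E³≈1 = ^k-cube e≉0
      at-0 : w ≈ 0ℤ × cubeCount e w ≡ 0ℤ → cubeCount e w ≈ E * E * W + E * (W * W) + (1ℤ - δ w)
      at-0 (h , eq) = begin
        cubeCount e w                              ≡⟨ eq ⟩
        0ℤ                                         ≈⟨ by₁ (- (E * E + E * W)) W≈0 (ring E W) ⟩
        E * E * W + E * (W * W) + (1ℤ - 1ℤ)        ≡⟨ cong (λ d → E * E * W + E * (W * W) + (1ℤ - d)) (sym (δ≡1 h)) ⟩
        E * E * W + E * (W * W) + (1ℤ - δ w)       ∎
        where
        W≈0 : W ≈ 0ℤ
        W≈0 = ≈-trans (^-cong-≈ {w} {0ℤ} k h) (≈-reflexive 0^k)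
        ring : ∀ E W → 0ℤ - (E * E * W + E * (W * W) + (1ℤ - 1ℤ)) ≡ - (E * E + E * W) * (W - 0ℤ)
        ring = solve-∀
      other : w ≉ 0ℤ × W ≉ E × cubeCount e w ≡ 0ℤ → cubeCount e w ≈ E * E * W + E * (W * W) + (1ℤ - δ w)
      other (w≉0 , W≉E , eq) = begin
        cubeCount e w                              ≡⟨ eq ⟩
        0ℤ                                         ≈⟨ by₂ (- E) 1ℤ quotient≈0 E³≈1 (ring′ E W) ⟩
        E * E * W + E * (W * W) + (1ℤ - 0ℤ)        ≡⟨ cong (λ d → E * E * W + E * (W * W) + (1ℤ - d)) (sym (δ≡0 w≉0)) ⟩
        E * E * W + E * (W * W) + (1ℤ - δ w)       ∎
        where
        ring : ∀ E W → (W - E) * (W * W + W * E + E * E) - 0ℤ ≡ 1ℤ * (W * W * W - 1ℤ) + - 1ℤ * (E * E * E - 1ℤ)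
        ring = solve-∀
        ring′ : ∀ E W → 0ℤ - (E * E * W + E * (W * W) + (1ℤ - 0ℤ)) ≡ - E * ((W * W + W * E + E * E) - 0ℤ) + 1ℤ * (E * E * E - 1ℤ)
        ring′ = solve-∀
        quotient≈0 : W * W + W * E + E * E ≈ 0ℤ
        quotient≈0 = [ (λ h → ⊥-elim (W≉E (-≈0⇒≈ h))) , (λ h → h) ]′
          (*≈0 (W - E) (W * W + W * E + E * E) (by₂ 1ℤ (- 1ℤ) (^k-cube w≉0) E³≈1 (ring E W)))
      same : w ≉ 0ℤ × W ≈ E × cubeCount e w ≡ + 3 → cubeCount e w ≈ E * E * W + E * (W * W) + (1ℤ - δ w)
      same (w≉0 , W≈E , eq) = begin
        cubeCount e w                              ≡⟨ eq ⟩
        + 3                                        ≈⟨ by₂ (- (E * E + E * (W + E))) (- + 2) W≈E E³≈1 (ring E W) ⟩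
        E * E * W + E * (W * W) + (1ℤ - 0ℤ)        ≡⟨ cong (λ d → E * E * W + E * (W * W) + (1ℤ - d)) (sym (δ≡0 w≉0)) ⟩
        E * E * W + E * (W * W) + (1ℤ - δ w)       ∎
        where
        ring : ∀ E W → + 3 - (E * E * W + E * (W * W) + (1ℤ - 0ℤ)) ≡ - (E * E + E * (W + E)) * (W - E) + - + 2 * (E * E * E - 1ℤ)
        ring = solve-∀

    -- (t² + t)ᵏ has degree 2k < p − 1.
    ∑-quad^k : ∑ₚ (λ t → quad t ^ k) ≈ 0ℤ
    ∑-quad^k = begin
      ∑ₚ (λ t → quad t ^ k)
        ≡⟨ ∑-cong expand ⟩
      ∑ₚ (λ t → sum {suc k} (λ i → + (k C toℕ i) * t ^ (k ℕ.+ toℕ i)))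
        ≡⟨ ∑-sum-swap (suc k) (λ t i → + (k C i) * t ^ (k ℕ.+ i)) ⟩
      sum {suc k} (λ i → ∑ₚ (λ t → + (k C toℕ i) * t ^ (k ℕ.+ toℕ i)))
        ≈⟨ sum-cong-≈ {suc k} (λ i → ≈-trans (≈-reflexive (∑-* (+ (k C toℕ i)) (λ t → t ^ (k ℕ.+ toℕ i))))
             (*-zeroʳ-≈ (+ (k C toℕ i)) {∑ₚ (λ t → t ^ (k ℕ.+ toℕ i))} (power-sum (k ℕ.+ toℕ i) (bound (toℕ i) (ℕ.s≤s⁻¹ (Fin.toℕ<n i)))))) ⟩
      sum {suc k} (λ _ → 0ℤ)
        ≡⟨ trans (sum-const (suc k) 0ℤ) (*-zeroʳ (+ suc k)) ⟩
      0ℤ ∎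
      where
      open ≈-Reasoning
      bound : ∀ i → i ℕ.≤ k → suc (k ℕ.+ i) ℕ.< p
      bound i i≤k = subst (suc (k ℕ.+ i) ℕ.<_) (sym p≡) (ℕ.s≤s (ℕ.≤-<-trans (ℕ.+-monoʳ-≤ k i≤k) (ℕ.m<m+n (k ℕ.+ k) 0<k)))
      eq : ∀ t → t * t + t ≡ t * (t + 1ℤ)
      eq = solve-∀
      ring : ∀ a b c → a * (b * c) ≡ b * (a * c)
      ring = solve-∀
      expand : ∀ t → quad t ^ k ≡ sum {suc k} (λ i → + (k C toℕ i) * t ^ (k ℕ.+ toℕ i))
      expand t = trans (cong (_^ k) (eq t)) (trans (^-distribʳ-* t (t + 1ℤ) k) (trans (cong (λ z → t ^ k * z) (binomial-expansion t k))
        (trans (∑.*-distribˡ-sum {suc k} (t ^ k) (λ i → + (k C toℕ i) * t ^ toℕ i))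
          (∑.sum-cong-≗ {suc k} (λ i → trans (ring (t ^ k) (+ (k C toℕ i)) (t ^ toℕ i)) (cong (λ z → + (k C toℕ i) * z) (sym (^-distribˡ-+-* t k (toℕ i)))))))))

    S : ℤ
    S = ∑ₚ (λ t → quad t ^ k * quad t ^ k)

    -- Summed over w = t² + t, the three terms of `cubeCount-≈` contribute 0, E S and p - 2; the
    -- last cancels the constant in `deficit`.
    deficit-≈ : ∀ {e} → e ≉ 0ℤ → deficit e ≈ - (e ^ k * S)
    deficit-≈ {e} e≉0 = by₂ (- 1ℤ) (- (E * E)) pairs-≈ ∑-quad^k (ring (+ p) (pairs e) E S (∑ₚ (λ t → quad t ^ k)))
      where
      open ≈-Reasoning
      E : ℤ
      E = e ^ k
      ring : ∀ q P E S S₁ → (q - + 2 - P) - - (E * S) ≡ - 1ℤ * (P - (E * E * S₁ + E * S + (q - + 2))) + - (E * E) * (S₁ - 0ℤ)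
      ring = solve-∀
      pairs-≈ : pairs e ≈ E * E * ∑ₚ (λ t → quad t ^ k) + E * S + (+ p - + 2)
      pairs-≈ = begin
        pairs e
          ≡⟨ pairs-cubeCount e≉0 ⟩
        ∑ₚ (λ t → cubeCount e (quad t))
          ≈⟨ ∑-cong-≈ (λ t → cubeCount-≈ e≉0 (quad t)) ⟩
        ∑ₚ (λ t → E * E * quad t ^ k + E * (quad t ^ k * quad t ^ k) + (1ℤ - δ (quad t)))
          ≡⟨ trans (∑-+ (λ t → E * E * quad t ^ k + E * (quad t ^ k * quad t ^ k)) (λ t → 1ℤ - δ (quad t)))
               (cong₂ _+_ (trans (∑-+ (λ t → E * E * quad t ^ k) (λ t → E * (quad t ^ k * quad t ^ k)))
                 (cong₂ _+_ (∑-* (E * E) (λ t → quad t ^ k)) (∑-* E (λ t → quad t ^ k * quad t ^ k)))) ∑-nonzero-quad) ⟩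
        E * E * ∑ₚ (λ t → quad t ^ k) + E * S + (+ p - + 2) ∎

    -- First and second moments over the classes of 2, 2g, 2g² modulo cubes

    module Cosets (g : ℤ) (g≉0 : g ≉ 0ℤ) (ω-eq : g ^ k * g ^ k + g ^ k + 1ℤ ≈ 0ℤ) where

      e₀ e₁ e₂ : ℤ
      e₀ = + 2
      e₁ = + 2 * g
      e₂ = + 2 * (g * g)

      e₁≉0 : e₁ ≉ 0ℤ
      e₁≉0 = *≉0 {+ 2} {g} 2≉0 g≉0

      e₂≉0 : e₂ ≉ 0ℤ
      e₂≉0 = *≉0 {+ 2} {g * g} 2≉0 (*≉0 {g} {g} g≉0 g≉0)

      E h : ℤ
      E = e₀ ^ k
      h = g ^ k

      e₁^k : e₁ ^ k ≡ E * h
      e₁^k = ^-distribʳ-* (+ 2) g k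

      e₂^k : e₂ ^ k ≡ E * (h * h)
      e₂^k = trans (^-distribʳ-* (+ 2) (g * g) k) (cong (λ z → E * z) (^-distribʳ-* g g k))

      E≉0 : E ≉ 0ℤ
      E≉0 = ^≉0 {+ 2} k 2≉0

      h≉0 : h ≉ 0ℤ
      h≉0 = ^≉0 {g} k g≉0

      h≉1 : h ≉ 1ℤ
      h≉1 h≈1 = 3≉0 (by₂ 1ℤ (- (h + + 2)) ω-eq h≈1 (eq h))
        where
        eq : ∀ h → + 3 - 0ℤ ≡ 1ℤ * ((h * h + h + 1ℤ) - 0ℤ) + - (h + + 2) * (h - 1ℤ)
        eq = solve-∀

      E₀≉E₁ : E ≉ E * h
      E₀≉E₁ eq = h≉1 (≈-sym (*-cancelˡ-≈ E E≉0 (≈-trans (≈-reflexive (*-identityʳ E)) eq)))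

      E₁≉E₂ : E * h ≉ E * (h * h)
      E₁≉E₂ eq = h≉1 (≈-sym (*-cancelˡ-≈ (E * h) (*≉0 {E} {h} E≉0 h≉0)
        (≈-trans (≈-reflexive (*-identityʳ (E * h))) (≈-trans eq (≈-reflexive (sym (*-assoc E h h)))))))

      E₀≉E₂ : E ≉ E * (h * h)
      E₀≉E₂ eq = h≉1 (≈-sym (*-cancelˡ-≈ E E≉0 (by₂ (- h) (- (E * (h - 1ℤ))) eq ω-eq (ring E h))))
        where
        ring : ∀ E h → E * 1ℤ - E * h ≡ - h * (E - E * (h * h)) + - (E * (h - 1ℤ)) * ((h * h + h + 1ℤ) - 0ℤ)
        ring = solve-∀

      AllCounts : ℤ → ℤ → ℤ → ℤ → Set
      AllCounts w c₀ c₁ c₂ = cubeCount e₀ w ≡ c₀ × cubeCount e₁ w ≡ c₁ × cubeCount e₂ w ≡ c₂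

      Classified : ℤ → Set
      Classified w = (AllCounts w (+ 3) 0ℤ 0ℤ × (∀ u → cubeCount e₀ u ≡ cubeCount w u)) ⊎
        (AllCounts w 0ℤ (+ 3) 0ℤ × (∀ u → cubeCount e₁ u ≡ cubeCount w u)) ⊎
        (AllCounts w 0ℤ 0ℤ (+ 3) × (∀ u → cubeCount e₂ u ≡ cubeCount w u))

      E³≈1 : E * E * E ≈ 1ℤ
      E³≈1 = ^k-cube {e₀} 2≉0

      opaque
        -- W = wᵏ is a root of Z³ - 1, which splits as (Z - E)(Z - E h)(Z - E h²) because E³ ≡ 1 and
        -- h is a primitive cube root of unity.
        classify : ∀ {w} → w ≉ 0ℤ → Classified w
        classify {w} w≉0 = [ first , [ second , third ]′ ∘ *≈0 (W - E * h) (W - E * (h * h)) ]′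
          (*≈0 (W - E) ((W - E * h) * (W - E * (h * h)))
            (by₃ 1ℤ (- 1ℤ) (- (W * W * E) + W * E * E * h - E * E * E * (h - 1ℤ)) W³≈1 E³≈1 ω-eq (ring W E h)))
          where
          W : ℤ
          W = w ^ k
          W³≈1 : W * W * W ≈ 1ℤ
          W³≈1 = ^k-cube {w} w≉0
          ring : ∀ W E h → (W - E) * ((W - E * h) * (W - E * (h * h))) - 0ℤ ≡
            1ℤ * (W * W * W - 1ℤ) + - 1ℤ * (E * E * E - 1ℤ) + (- (W * W * E) + W * E * E * h - E * E * E * (h - 1ℤ)) * ((h * h + h + 1ℤ) - 0ℤ)
          ring = solve-∀
          yes₀ : W ≈ E → cubeCount e₀ w ≡ + 3
          yes₀ = cubeCount-yes {e₀} {w} 2≉0 w≉0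
          no₀ : W ≉ E → cubeCount e₀ w ≡ 0ℤ
          no₀ = cubeCount-no {e₀} {w} 2≉0
          no₁ : W ≉ E * h → cubeCount e₁ w ≡ 0ℤ
          no₁ ¬eq = cubeCount-no {e₁} {w} e₁≉0 (λ eq → ¬eq (≈-trans eq (≈-reflexive e₁^k)))
          no₂ : W ≉ E * (h * h) → cubeCount e₂ w ≡ 0ℤ
          no₂ ¬eq = cubeCount-no {e₂} {w} e₂≉0 (λ eq → ¬eq (≈-trans eq (≈-reflexive e₂^k)))
          first : W - E ≈ 0ℤ → Classified w
          first d = inj₁ ((yes₀ W≈ , no₁ (λ eq → E₀≉E₁ (≈-trans (≈-sym W≈) eq)) , no₂ (λ eq → E₀≉E₂ (≈-trans (≈-sym W≈) eq)))
                         , cubeCount-class {e₀} {w} 2≉0 w≉0 (≈-sym W≈))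
            where
            W≈ : W ≈ E
            W≈ = -≈0⇒≈ d
          second : W - E * h ≈ 0ℤ → Classified w
          second d = inj₂ (inj₁ ((no₀ (λ eq → E₀≉E₁ (≈-trans (≈-sym eq) (-≈0⇒≈ d))) , cubeCount-yes {e₁} {w} e₁≉0 w≉0 W≈
                                 , no₂ (λ eq → E₁≉E₂ (≈-trans (≈-sym (-≈0⇒≈ d)) eq)))
                         , cubeCount-class {e₁} {w} e₁≉0 w≉0 (≈-sym W≈)))
            where
            W≈ : W ≈ e₁ ^ k
            W≈ = ≈-trans (-≈0⇒≈ d) (≈-reflexive (sym e₁^k))
          third : W - E * (h * h) ≈ 0ℤ → Classified w
          third d = inj₂ (inj₂ ((no₀ (λ eq → E₀≉E₂ (≈-trans (≈-sym eq) (-≈0⇒≈ d))) , no₁ (λ eq → E₁≉E₂ (≈-trans (≈-sym eq) (-≈0⇒≈ d)))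
                                 , cubeCount-yes {e₂} {w} e₂≉0 w≉0 W≈)
                         , cubeCount-class {e₂} {w} e₂≉0 w≉0 (≈-sym W≈)))
            where
            W≈ : W ≈ e₂ ^ k
            W≈ = ≈-trans (-≈0⇒≈ d) (≈-reflexive (sym e₂^k))

      first-moment-pointwise : ∀ w → cubeCount e₀ w + cubeCount e₁ w + cubeCount e₂ w ≡ + 3 * (1ℤ - δ w)
      first-moment-pointwise w =
        [ (λ (w≈0 , eq) → trans (+-cong₃ (cubeCount-zero {e₀} {w} 2≉0 w≈0) (cubeCount-zero {e₁} {w} e₁≉0 w≈0) (cubeCount-zero {e₂} {w} e₂≉0 w≈0))
            (cong (λ d → + 3 * (1ℤ - d)) (sym eq)))
        , (λ (w≉0 , eq) → trans ([ (λ ((a , b , c) , _) → +-cong₃ a b c) , [ (λ ((a , b , c) , _) → +-cong₃ a b c) , (λ ((a , b , c) , _) → +-cong₃ a b c) ]′ ]′ (classify {w} w≉0))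
            (cong (λ d → + 3 * (1ℤ - d)) (sym eq))) ]′ (δ-cases w)

      -- Only the representative of the class of w′ has a nonzero first factor, equal to 3, and in
      -- the second factor w′ itself can stand for that representative. Thus products of counts
      -- become single counts.
      second-moment-pointwise : ∀ w′ w →
        cubeCount e₀ w′ * cubeCount e₀ w + cubeCount e₁ w′ * cubeCount e₁ w + cubeCount e₂ w′ * cubeCount e₂ w ≡
        + 3 * ((1ℤ - δ w′) * cubeCount w′ w)
      second-moment-pointwise w′ w =
        [ (λ (w≈0 , eq) → trans (cong₃ (cubeCount-zero {e₀} {w′} 2≉0 w≈0) (cubeCount-zero {e₁} {w′} e₁≉0 w≈0) (cubeCount-zero {e₂} {w′} e₂≉0 w≈0))
            (cong (λ d → + 3 * ((1ℤ - d) * cubeCount w′ w)) (sym eq)))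
        , (λ (w≉0 , eq) → trans
            ([ (λ ((a , b , c) , same) → trans (cong₃ a b c) (trans (ring₀ (cubeCount e₀ w) (cubeCount e₁ w) (cubeCount e₂ w)) (cong (λ z → + 3 * (1ℤ * z)) (same w))))
             , [ (λ ((a , b , c) , same) → trans (cong₃ a b c) (trans (ring₁ (cubeCount e₀ w) (cubeCount e₁ w) (cubeCount e₂ w)) (cong (λ z → + 3 * (1ℤ * z)) (same w))))
               , (λ ((a , b , c) , same) → trans (cong₃ a b c) (trans (ring₂ (cubeCount e₀ w) (cubeCount e₁ w) (cubeCount e₂ w)) (cong (λ z → + 3 * (1ℤ * z)) (same w)))) ]′ ]′ (classify {w′} w≉0))
            (cong (λ d → + 3 * ((1ℤ - d) * cubeCount w′ w)) (sym eq))) ]′ (δ-cases w′)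
        where
        cong₃ : ∀ {a a′ b b′ c c′ : ℤ} → a ≡ a′ → b ≡ b′ → c ≡ c′ →
          a * cubeCount e₀ w + b * cubeCount e₁ w + c * cubeCount e₂ w ≡ a′ * cubeCount e₀ w + b′ * cubeCount e₁ w + c′ * cubeCount e₂ w
        cong₃ refl refl refl = refl
        ring₀ : ∀ x y z → + 3 * x + 0ℤ * y + 0ℤ * z ≡ + 3 * (1ℤ * x)
        ring₀ = solve-∀
        ring₁ : ∀ x y z → 0ℤ * x + + 3 * y + 0ℤ * z ≡ + 3 * (1ℤ * y)
        ring₁ = solve-∀
        ring₂ : ∀ x y z → 0ℤ * x + 0ℤ * y + + 3 * z ≡ + 3 * (1ℤ * z)
        ring₂ = solve-∀

      C : ℤ → ℤ → ℤ
      C e t = cubeCount e (quad t)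

      first-moment : pairs e₀ + pairs e₁ + pairs e₂ ≡ + 3 * (+ p - + 2)
      first-moment = begin
        pairs e₀ + pairs e₁ + pairs e₂
          ≡⟨ cong₂ _+_ (cong₂ _+_ (pairs-cubeCount 2≉0) (pairs-cubeCount e₁≉0)) (pairs-cubeCount e₂≉0) ⟩
        ∑ₚ (C e₀) + ∑ₚ (C e₁) + ∑ₚ (C e₂)
          ≡⟨ sym (trans (∑-+ (λ t → C e₀ t + C e₁ t) (C e₂)) (cong (λ s → s + ∑ₚ (C e₂)) (∑-+ (C e₀) (C e₁)))) ⟩
        ∑ₚ (λ t → C e₀ t + C e₁ t + C e₂ t)
          ≡⟨ ∑-cong (λ t → first-moment-pointwise (quad t)) ⟩
        ∑ₚ (λ t → + 3 * (1ℤ - δ (quad t)))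
          ≡⟨ trans (∑-* (+ 3) (λ t → 1ℤ - δ (quad t))) (cong (λ s → + 3 * s) ∑-nonzero-quad) ⟩
        + 3 * (+ p - + 2) ∎
        where open ≡-Reasoning

      ∑∑-square : ∀ f → ∑ₚ (λ t → ∑ₚ (λ u → f t * f u)) ≡ ∑ₚ f * ∑ₚ f
      ∑∑-square f = trans (∑-cong λ t → trans (∑-* (f t) f) (*-comm (f t) (∑ₚ f))) (∑-* (∑ₚ f) f)

      -- `cubeCount (quad t′) (quad t)` counts the u with u³ (t² + t) = t′² + t′. After exchanging
      -- sums there is one conic, c = u³, for each u; each contributes at most p, and the three u
      -- with u³ ≡ 1 at most p more.
      second-moment : pairs e₀ * pairs e₀ + pairs e₁ * pairs e₁ + pairs e₂ * pairs e₂ ≤ + 3 * (+ p * + p + + p * + 3)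
      second-moment = ≤-trans (≤-reflexive (begin
        pairs e₀ * pairs e₀ + pairs e₁ * pairs e₁ + pairs e₂ * pairs e₂
          ≡⟨ cong₂ _+_ (cong₂ _+_ (square 2≉0) (square e₁≉0)) (square e₂≉0) ⟩
        ∑ₚ (λ t′ → ∑ₚ (λ t → C e₀ t′ * C e₀ t)) + ∑ₚ (λ t′ → ∑ₚ (λ t → C e₁ t′ * C e₁ t)) + ∑ₚ (λ t′ → ∑ₚ (λ t → C e₂ t′ * C e₂ t))
          ≡⟨ sym (trans (∑-cong λ t′ → trans (∑-+ (λ t → C e₀ t′ * C e₀ t + C e₁ t′ * C e₁ t) (λ t → C e₂ t′ * C e₂ t))
                     (cong (λ s → s + ∑ₚ (λ t → C e₂ t′ * C e₂ t)) (∑-+ (λ t → C e₀ t′ * C e₀ t) (λ t → C e₁ t′ * C e₁ t))))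
               (trans (∑-+ (λ t′ → ∑ₚ (λ t → C e₀ t′ * C e₀ t) + ∑ₚ (λ t → C e₁ t′ * C e₁ t)) (λ t′ → ∑ₚ (λ t → C e₂ t′ * C e₂ t)))
                      (cong (λ s → s + ∑ₚ (λ t′ → ∑ₚ (λ t → C e₂ t′ * C e₂ t))) (∑-+ (λ t′ → ∑ₚ (λ t → C e₀ t′ * C e₀ t)) (λ t′ → ∑ₚ (λ t → C e₁ t′ * C e₁ t)))))) ⟩
        ∑ₚ (λ t′ → ∑ₚ (λ t → C e₀ t′ * C e₀ t + C e₁ t′ * C e₁ t + C e₂ t′ * C e₂ t))
          ≡⟨ ∑-cong (λ t′ → ∑-cong (λ t → second-moment-pointwise (quad t′) (quad t))) ⟩
        ∑ₚ (λ t′ → ∑ₚ (λ t → + 3 * ((1ℤ - δ (quad t′)) * cubeCount (quad t′) (quad t))))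
          ≡⟨ trans (∑-cong λ t′ → trans (∑-* (+ 3) (λ t → (1ℤ - δ (quad t′)) * cubeCount (quad t′) (quad t)))
                 (cong (λ s → + 3 * s) (trans (∑-cong λ t → sym (∑-* (1ℤ - δ (quad t′)) (λ u → δ (quad t * (u * u * u) - quad t′))))
                   (∑-swap (λ t u → Conic.term (u * u * u) t t′)))))
               (∑-* (+ 3) (λ t′ → ∑ₚ (λ u → ∑ₚ (λ t → Conic.term (u * u * u) t t′)))) ⟩
        + 3 * ∑ₚ (λ t′ → ∑ₚ (λ u → ∑ₚ (λ t → Conic.term (u * u * u) t t′)))
          ≡⟨ cong (λ s → + 3 * s) (∑-swap (λ t′ u → ∑ₚ (λ t → Conic.term (u * u * u) t t′))) ⟩
        + 3 * ∑ₚ (λ u → ∑ₚ (λ t′ → ∑ₚ (λ t → Conic.term (u * u * u) t t′))) ∎))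
        (*-monoˡ-≤-nonNeg (+ 3) (≤-trans (∑-mono λ u → Conic.bound (u * u * u)) (≤-reflexive
          (trans (∑-+ (λ _ → + p) (λ u → + p * δ (u * u * u - 1ℤ))) (cong₂ _+_ (∑-const (+ p))
            (trans (∑-* (+ p) (λ u → δ (u * u * u - 1ℤ))) (cong (λ s → + p * s) (∑-cube-root {1ℤ} 1≉0 (≈-reflexive (^-zeroˡ k))))))))))
        where
        open ≡-Reasoning
        square : ∀ {e} → e ≉ 0ℤ → pairs e * pairs e ≡ ∑ₚ (λ t′ → ∑ₚ (λ t → C e t′ * C e t))
        square {e} e≉0 = trans (cong₂ _*_ (pairs-cubeCount e≉0) (pairs-cubeCount e≉0)) (sym (∑∑-square (C e)))

      -- Determination of the three deficits from A and B

      module Form (A B : ℤ) (p≡A²+3B² : + p ≡ A * A + + 3 * (B * B)) (A≡1[3] : ∃ λ a → A ≡ + 3 * a + 1ℤ) (ω≡ : + 2 * B * g ^ k ≈ A - B) where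

        D₀ D₁ D₂ : ℤ
        D₀ = deficit e₀
        D₁ = deficit e₁
        D₂ = deficit e₂

        deficit-sum : D₀ + D₁ + D₂ ≡ 0ℤ
        deficit-sum = trans (eq (+ p) (pairs e₀) (pairs e₁) (pairs e₂)) (trans (cong (λ s → + 3 * (+ p - + 2) - s) first-moment) (+-inverseʳ (+ 3 * (+ p - + 2))))
          where
          eq : ∀ q a b c → (q - + 2 - a) + (q - + 2 - b) + (q - + 2 - c) ≡ + 3 * (q - + 2) - (a + b + c)
          eq = solve-∀

        -- By `first-moment` the mean of the three counts is p - 2, so this is a variance: 3 (p² +
        -- 3p) - 3 (p - 2)² = 21p - 12.
        deficit-squares : D₀ * D₀ + D₁ * D₁ + D₂ * D₂ ≤ + 21 * + p - + 12
        deficit-squares = begin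
          D₀ * D₀ + D₁ * D₁ + D₂ * D₂
            ≡⟨ eq (+ p) (pairs e₀) (pairs e₁) (pairs e₂) ⟩
          + 3 * ((+ p - + 2) * (+ p - + 2)) - + 2 * (+ p - + 2) * (pairs e₀ + pairs e₁ + pairs e₂) + (pairs e₀ * pairs e₀ + pairs e₁ * pairs e₁ + pairs e₂ * pairs e₂)
            ≡⟨ cong (λ s → + 3 * ((+ p - + 2) * (+ p - + 2)) - + 2 * (+ p - + 2) * s + (pairs e₀ * pairs e₀ + pairs e₁ * pairs e₁ + pairs e₂ * pairs e₂)) first-moment ⟩
          + 3 * ((+ p - + 2) * (+ p - + 2)) - + 2 * (+ p - + 2) * (+ 3 * (+ p - + 2)) + (pairs e₀ * pairs e₀ + pairs e₁ * pairs e₁ + pairs e₂ * pairs e₂)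
            ≤⟨ +-monoʳ-≤ (+ 3 * ((+ p - + 2) * (+ p - + 2)) - + 2 * (+ p - + 2) * (+ 3 * (+ p - + 2))) second-moment ⟩
          + 3 * ((+ p - + 2) * (+ p - + 2)) - + 2 * (+ p - + 2) * (+ 3 * (+ p - + 2)) + + 3 * (+ p * + p + + p * + 3)
            ≡⟨ eq′ (+ p) ⟩
          + 21 * + p - + 12 ∎
          where
          open ≤-Reasoning
          eq : ∀ q a b c → (q - + 2 - a) * (q - + 2 - a) + (q - + 2 - b) * (q - + 2 - b) + (q - + 2 - c) * (q - + 2 - c) ≡
            + 3 * ((q - + 2) * (q - + 2)) - + 2 * (q - + 2) * (a + b + c) + (a * a + b * b + c * c)
          eq = solve-∀
          eq′ : ∀ q → + 3 * ((q - + 2) * (q - + 2)) - + 2 * (q - + 2) * (+ 3 * (q - + 2)) + + 3 * (q * q + q * + 3) ≡ + 21 * q - + 12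
          eq′ = solve-∀

        p≡3k+1 : + p ≡ + 3 * + k + 1ℤ
        p≡3k+1 = trans (cong +_ p≡) (eq (+ k))
          where
          eq : ∀ k → 1ℤ + (k + k + k) ≡ + 3 * k + 1ℤ
          eq = solve-∀

        deficit-mod3 : ∀ {e} → e ≉ 0ℤ → ∃ λ n → deficit e ≡ + 3 * n - 1ℤ
        deficit-mod3 {e} e≉0 = + k - N , trans (cong₂ (λ q P → q - + 2 - P) p≡3k+1 (pairs-formula e≉0)) (eq (+ k) N)
          where
          N : ℤ
          N = ∑ₚ (λ t → (1ℤ - δ (quad t)) * δ (quad t ^ k - e ^ k))
          eq : ∀ k N → (+ 3 * k + 1ℤ) - + 2 - + 3 * N ≡ + 3 * (k - N) - 1ℤ
          eq = solve-∀

        -- The diagonal equation 2x³ = 2 has three solutions, so the number of pairs is odd, and so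
        -- is p - 2.
        deficit-even : ∃ λ X → D₀ ≡ + 2 * X
        deficit-even = q - + 2 - m , trans (cong₂ (λ q P → q - + 2 - P) (proj₂ p-odd′) (trans (proj₂ parity) (cong (λ c → c + + 2 * m) (cubeCount-yes {e₀} {e₀} 2≉0 2≉0 ≈-refl))))
          (eq q m)
          where
          p-odd′ : ∃ λ q → + p ≡ + 2 * q + 1ℤ
          p-odd′ = p-odd (ℕ.<-trans (ℕ.n<1+n 2) 3<p)
          parity : ∃ λ m → pairs e₀ ≡ cubeCount e₀ (+ 2) + + 2 * m
          parity = pairs-parity e₀
          q m : ℤ
          q = proj₁ p-odd′
          m = proj₁ parity
          eq : ∀ q m → (+ 2 * q + 1ℤ) - + 2 - (+ 3 + + 2 * m) ≡ + 2 * (q - + 2 - m)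
          eq = solve-∀

        -- The formulas for `x` and `Y` come from the residues of D₀ and D₂ mod 3: X = 3X - 2X = 3X
        -- - (3n₀ - 1), and D₂ + X = (3n₂ - 1) + (3x + 1).
        X n₀ n₂ x Y a : ℤ
        X = proj₁ deficit-even
        n₀ = proj₁ (deficit-mod3 2≉0)
        n₂ = proj₁ (deficit-mod3 e₂≉0)
        x = X - n₀
        Y = n₂ + x
        a = proj₁ A≡1[3]

        D₀≡ : D₀ ≡ + 2 * X
        D₀≡ = proj₂ deficit-even

        X≡ : X ≡ + 3 * x + 1ℤ
        X≡ = trans (eq₁ X) (trans (cong (λ z → + 3 * X - z) (trans (sym D₀≡) (proj₂ (deficit-mod3 2≉0)))) (eq₂ X n₀))
          where
          eq₁ : ∀ X → X ≡ + 3 * X - + 2 * X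
          eq₁ = solve-∀
          eq₂ : ∀ X n → + 3 * X - (+ 3 * n - 1ℤ) ≡ + 3 * (X - n) + 1ℤ
          eq₂ = solve-∀

        D₂≡ : D₂ ≡ - X + + 3 * Y
        D₂≡ = trans (proj₂ (deficit-mod3 e₂≉0)) (trans (eq n₂ x) (cong (λ z → - z + + 3 * Y) (sym X≡)))
          where
          eq : ∀ n x → + 3 * n - 1ℤ ≡ - (+ 3 * x + 1ℤ) + + 3 * (n + x)
          eq = solve-∀

        D₁≡ : D₁ ≡ - X - + 3 * Y
        D₁≡ = trans (eq₁ D₀ D₁ D₂) (trans (cong₂ (λ s d → s - d - D₂) deficit-sum D₀≡) (trans (cong (λ d → 0ℤ - + 2 * X - d) D₂≡) (eq₂ X Y)))
          where
          eq₁ : ∀ a b c → b ≡ (a + b + c) - a - c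
          eq₁ = solve-∀
          eq₂ : ∀ X Y → 0ℤ - + 2 * X - (- X + + 3 * Y) ≡ - X - + 3 * Y
          eq₂ = solve-∀

        form-bound : + 6 * (X * X + + 3 * (Y * Y)) < + 4 * (+ 6 * + p)
        form-bound = begin-strict
          + 6 * (X * X + + 3 * (Y * Y))
            ≡⟨ eq X Y ⟩
          (+ 2 * X) * (+ 2 * X) + (- X - + 3 * Y) * (- X - + 3 * Y) + (- X + + 3 * Y) * (- X + + 3 * Y)
            ≡⟨ sym (cong₃ D₀≡ D₁≡ D₂≡) ⟩
          D₀ * D₀ + D₁ * D₁ + D₂ * D₂
            ≤⟨ deficit-squares ⟩
          + 21 * + p - + 12
            -- The gap 24p - (21p - 12) is 3p + 12, of which the strict inequality takes 1.
            <⟨ suc[i]≤j⇒i<j (≤-trans (i≤i+j (sucℤ (+ 21 * + p - + 12)) (+ (3 ℕ.* p ℕ.+ 11))) (≤-reflexive (trans (cong (λ z → sucℤ (+ 21 * + p - + 12) + (z + + 11)) (pos-* 3 p)) (eq′ (+ p))))) ⟩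
          + 4 * (+ 6 * + p) ∎
          where
          open ≤-Reasoning
          eq : ∀ X Y → + 6 * (X * X + + 3 * (Y * Y)) ≡ (+ 2 * X) * (+ 2 * X) + (- X - + 3 * Y) * (- X - + 3 * Y) + (- X + + 3 * Y) * (- X + + 3 * Y)
          eq = solve-∀
          eq′ : ∀ q → (1ℤ + (+ 21 * q - + 12)) + (+ 3 * q + + 11) ≡ + 4 * (+ 6 * q)
          eq′ = solve-∀
          cong₃ : ∀ {a a′ b b′ c c′ : ℤ} → a ≡ a′ → b ≡ b′ → c ≡ c′ → a * a + b * b + c * c ≡ a′ * a′ + b′ * b′ + c′ * c′
          cong₃ refl refl refl = refl

        -- Comparing `deficit-≈` for 2 and 2g² eliminates S and leaves D₂ ≡ h² D₀. Multiplied by B,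
        -- with h² ≡ -1 - h and 2Bh ≡ A - B, this turns linear in X and Y. The hypothesis `ω≡` is h
        -- ≡ (-1 + A/B)/2 cleared of denominators; it couples the sign of B to the choice of g.
        XA+3BY≈0 : X * A + + 3 * B * Y ≈ 0ℤ
        XA+3BY≈0 = by₃ B (X * + 2 * B) (- X) D₂≈h²D₀ ω-eq ω≡ (eq X Y A B h)
          where
          eq′ : ∀ E h S d₀ d₂ → d₂ - h * h * d₀ ≡ 1ℤ * (d₂ - - (E * (h * h) * S)) + - (h * h) * (d₀ - - (E * S))
          eq′ = solve-∀
          D₂≈h²D₀ : - X + + 3 * Y ≈ h * h * (+ 2 * X)
          D₂≈h²D₀ = subst₂ (λ d₂ d₀ → d₂ ≈ h * h * d₀) D₂≡ D₀≡
            (by₂ 1ℤ (- (h * h)) (subst (λ z → D₂ ≈ - (z * S)) e₂^k (deficit-≈ e₂≉0)) (deficit-≈ 2≉0) (eq′ E h S D₀ D₂))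
          eq : ∀ X Y A B h → (X * A + + 3 * B * Y) - 0ℤ ≡
            B * ((- X + + 3 * Y) - h * h * (+ 2 * X)) + X * + 2 * B * ((h * h + h + 1ℤ) - 0ℤ) + - X * (+ 2 * B * h - (A - B))
          eq = solve-∀

        -- 3B (A Y - B X) = A (X A + 3 B Y) - X (A² + 3B²), and 3 and B are units mod p.
        AY-BX≈0 : A * Y - B * X ≈ 0ℤ
        AY-BX≈0 = [ (λ h → ⊥-elim (3≉0 h)) , (λ h → [ (λ h′ → ⊥-elim (B≉0 A B p≡A²+3B² h′)) , (λ h′ → h′) ]′ (*≈0 B (A * Y - B * X) h)) ]′
          (*≈0 (+ 3) (B * (A * Y - B * X)) (by₂ A (- X) XA+3BY≈0 (subst (_≈ 0ℤ) p≡A²+3B² p≈0) (eq X Y A B)))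
          where
          eq : ∀ X Y A B → + 3 * (B * (A * Y - B * X)) - 0ℤ ≡ A * ((X * A + + 3 * B * Y) - 0ℤ) + - X * ((A * A + + 3 * (B * B)) - 0ℤ)
          eq = solve-∀

        -- In ℤ[√-3] the two congruences say (X + Y√-3)(A - B√-3) = p (U + V√-3). Multiplying by A +
        -- B√-3 and cancelling p gives X + Y√-3 = (A + B√-3)(U + V√-3), whose coordinates are `X-UV`
        -- and `Y-UV`.
        U V : ℤ
        U = proj₁ (≈0⇒multiple XA+3BY≈0)
        V = proj₁ (≈0⇒multiple AY-BX≈0)

        U-eq : X * A + + 3 * B * Y ≡ U * + p
        U-eq = proj₂ (≈0⇒multiple XA+3BY≈0)

        V-eq : A * Y - B * X ≡ V * + p
        V-eq = proj₂ (≈0⇒multiple AY-BX≈0)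

        X-UV : X ≡ A * U - + 3 * B * V
        X-UV = *-cancelʳ-≡ X (A * U - + 3 * B * V) (+ p) (trans (cong (X *_) p≡A²+3B²) (trans (eq₁ X Y A B)
          (trans (cong₂ (λ s t → A * s - + 3 * B * t) U-eq V-eq) (eq₂ A B U V (+ p)))))
          where
          eq₁ : ∀ X Y A B → X * (A * A + + 3 * (B * B)) ≡ A * (X * A + + 3 * B * Y) - + 3 * B * (A * Y - B * X)
          eq₁ = solve-∀
          eq₂ : ∀ A B U V q → A * (U * q) - + 3 * B * (V * q) ≡ (A * U - + 3 * B * V) * q
          eq₂ = solve-∀

        Y-UV : Y ≡ B * U + A * V
        Y-UV = *-cancelʳ-≡ Y (B * U + A * V) (+ p) (trans (cong (Y *_) p≡A²+3B²) (trans (eq₁ X Y A B)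
          (trans (cong₂ (λ s t → B * s + A * t) U-eq V-eq) (eq₂ A B U V (+ p)))))
          where
          eq₁ : ∀ X Y A B → Y * (A * A + + 3 * (B * B)) ≡ B * (X * A + + 3 * B * Y) + A * (A * Y - B * X)
          eq₁ = solve-∀
          eq₂ : ∀ A B U V q → B * (U * q) + A * (V * q) ≡ (B * U + A * V) * q
          eq₂ = solve-∀

        UV-form : (U * U + + 3 * (V * V)) * + p ≡ X * X + + 3 * (Y * Y)
        UV-form = trans (cong ((U * U + + 3 * (V * V)) *_) p≡A²+3B²) (trans (eq A B U V) (sym (cong₂ (λ X Y → X * X + + 3 * (Y * Y)) X-UV Y-UV)))
          where
          eq : ∀ A B U V → (U * U + + 3 * (V * V)) * (A * A + + 3 * (B * B)) ≡
            (A * U - + 3 * B * V) * (A * U - + 3 * B * V) + + 3 * ((B * U + A * V) * (B * U + A * V))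
          eq = solve-∀

        u : ℤ
        u = x - a * U + B * V

        -- X = A U - 3 B V is read modulo 3, where X and A are both 1; `u` is the resulting
        -- quotient.
        U≡ : U ≡ + 3 * u + 1ℤ
        U≡ = trans (eq₁ U a B V) (trans (cong (λ A → A * U - + 3 * B * V + + 3 * (B * V - a * U)) (sym (proj₂ A≡1[3])))
          (trans (cong (λ X → X + + 3 * (B * V - a * U)) (trans (sym X-UV) X≡)) (eq₂ U a x B V)))
          where
          eq₁ : ∀ U a B V → U ≡ (+ 3 * a + 1ℤ) * U - + 3 * B * V + + 3 * (B * V - a * U)
          eq₁ = solve-∀
          eq₂ : ∀ U a x B V → (+ 3 * x + 1ℤ) + + 3 * (B * V - a * U) ≡ + 3 * (x - a * U + B * V) + 1ℤ
          eq₂ = solve-∀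

        u≡0×V≡0 : u ≡ 0ℤ × V ≡ 0ℤ
        u≡0×V≡0 = form<4 u V (subst (λ U → U * U + + 3 * (V * V) < + 4) U≡
          (*-cancelʳ-<-nonNeg (+ 6 * + p) {{6p≥0}} (subst (_< + 4 * (+ 6 * + p)) (trans (cong (+ 6 *_) (sym UV-form)) (eq (U * U + + 3 * (V * V)) (+ p))) form-bound)))
          where
          eq : ∀ f q → + 6 * (f * q) ≡ f * (+ 6 * q)
          eq = solve-∀
          6p≥0 : NonNegative (+ 6 * + p)
          6p≥0 = subst NonNegative (pos-* 6 p) _

        U≡1 : U ≡ 1ℤ
        U≡1 = trans U≡ (cong (λ u → + 3 * u + 1ℤ) (proj₁ u≡0×V≡0))

        X≡A : X ≡ A
        X≡A = unit-multiple A B U V X-UV U≡1 (proj₂ u≡0×V≡0)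
          where
          eq : ∀ A B → A * 1ℤ - + 3 * B * 0ℤ ≡ A
          eq = solve-∀
          unit-multiple : ∀ {X} A B U V → X ≡ A * U - + 3 * B * V → U ≡ 1ℤ → V ≡ 0ℤ → X ≡ A
          unit-multiple A B _ _ X≡ refl refl = trans X≡ (eq A B)

        Y≡B : Y ≡ B
        Y≡B = unit-multiple A B U V Y-UV U≡1 (proj₂ u≡0×V≡0)
          where
          eq : ∀ A B → B * 1ℤ + A * 0ℤ ≡ B
          eq = solve-∀
          unit-multiple : ∀ {Y} A B U V → Y ≡ B * U + A * V → U ≡ 1ℤ → V ≡ 0ℤ → Y ≡ B
          unit-multiple A B _ _ Y≡ refl refl = trans Y≡ (eq A B)

        opaque
          deficit₀ : deficit e₀ ≡ + 2 * A
          deficit₀ = trans D₀≡ (cong (+ 2 *_) X≡A)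

          deficit₂ : deficit e₂ ≡ - A + + 3 * B
          deficit₂ = trans D₂≡ (cong₂ (λ X Y → - X + + 3 * Y) X≡A Y≡B)

    -- The class of an arbitrary e

    opaque
      -- If xᵏ ≡ 1 held for all x ≢ 0, the sum of xᵏ over a period would be p - 1 ≡ -1, whereas it
      -- vanishes by `power-sum`, since 0 < k < p - 1.
      noncube : ∃ λ g → g ≉ 0ℤ × g ^ k ≉ 1ℤ
      noncube = [ (λ g → g) , (λ none → ⊥-elim (1≉0 (absurd (λ x → ^k≈1-δ x (none x))))) ]′
        (search {λ x → x ≉ 0ℤ × x ^ k ≉ 1ℤ}
          (λ {x} {y} x≈y (x≉0 , x^k≉1) → (λ y≈0 → x≉0 (≈-trans x≈y y≈0)) , (λ y^k≈1 → x^k≉1 (≈-trans (^-cong-≈ {x} {y} k x≈y) y^k≈1)))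
          (λ x → Dec.¬? (x ≈? 0ℤ) Dec.×-dec Dec.¬? (x ^ k ≈? 1ℤ)))
        where
        ^k≈1-δ : ∀ x → ¬ (x ≉ 0ℤ × x ^ k ≉ 1ℤ) → x ^ k ≈ 1ℤ - δ x
        ^k≈1-δ x h = [ (λ (x≈0 , eq) → ≈-trans (≈-trans (^-cong-≈ {x} {0ℤ} k x≈0) (≈-reflexive 0^k)) (≈-reflexive (cong (λ d → 1ℤ - d) (sym eq))))
                 , (λ (x≉0 , eq) → ≈-trans (Dec.decidable-stable (x ^ k ≈? 1ℤ) (λ ¬eq → h (x≉0 , ¬eq))) (≈-reflexive (cong (λ d → 1ℤ - d) (sym eq)))) ]′ (δ-cases x)
        eq : ∀ q s → 1ℤ - 0ℤ ≡ 1ℤ * (q - 0ℤ) + 1ℤ * (s - (q - 1ℤ)) + - 1ℤ * (s - 0ℤ)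
        eq = solve-∀
        absurd : (∀ x → x ^ k ≈ 1ℤ - δ x) → 1ℤ ≈ 0ℤ
        absurd all = by₃ 1ℤ 1ℤ (- 1ℤ) p≈0
          (≈-trans (∑-cong-≈ all) (≈-reflexive (trans (∑-∸ (λ _ → 1ℤ) δ) (cong₂ _-_ (trans (∑-const 1ℤ) (*-identityʳ (+ p)))
            (trans (∑-cong λ x → cong δ (sym (+-identityʳ x))) (∑-δ-1 0ℤ))))))
          (power-sum k (subst (suc k ℕ.<_) (sym p≡) (ℕ.s≤s (ℕ.<-≤-trans (ℕ.m<m+n k 0<k) (ℕ.m≤m+n (k ℕ.+ k) k)))))
          (eq (+ p) (∑ₚ (_^ k)))

    deficit-class : ∀ {e e′} → e ≉ 0ℤ → e′ ≉ 0ℤ → e ^ k ≈ e′ ^ k → deficit e ≡ deficit e′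
    deficit-class e≉0 e′≉0 h = cong (λ P → + p - + 2 - P) (pairs-class e≉0 e′≉0 h)

    module _ (A B : ℤ) (p≡A²+3B² : + p ≡ A * A + + 3 * (B * B)) (A≡1[3] : ∃ λ a → A ≡ + 3 * a + 1ℤ) (e : ℤ) (e≉0 : e ≉ 0ℤ) where

      E T : ℤ
      E = e ^ k
      T = (+ 2) ^ k

      E³≈1 : E * E * E ≈ 1ℤ
      E³≈1 = ^k-cube e≉0

      T³≈1 : T * T * T ≈ 1ℤ
      T³≈1 = ^k-cube {+ 2} 2≉0

      g₀ : ℤ
      g₀ = + 2 * (e * e)

      g₀≉0 : g₀ ≉ 0ℤ
      g₀≉0 = *≉0 {+ 2} {e * e} 2≉0 (*≉0 {e} {e} e≉0 e≉0)

      g₀^k : g₀ ^ k ≡ T * (E * E)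
      g₀^k = trans (^-distribʳ-* (+ 2) (e * e) k) (cong (λ z → T * z) (^-distribʳ-* e e k))

      -- Here e lies in the class of 2, and any noncube g may complete the three classes. Its h
      -- satisfies (2Bh + B)² ≡ -3B² ≡ A², so 2Bh + B ≡ ±A. The sign is absorbed by passing to -B,
      -- which does not affect the value 2A.
      deficit-cubic : g₀ ^ k ≈ 1ℤ → deficit e ≡ + 2 * A
      deficit-cubic g₀^k≈1 = trans (deficit-class {e} {+ 2} e≉0 2≉0 E≈T)
        ([ with-B , with-negated-B ]′ (*≈0 (+ 2 * B * h + B - A) (+ 2 * B * h + B + A)
          (by₂ (+ 4 * (B * B)) (- 1ℤ) ω-eq (subst (_≈ 0ℤ) p≡A²+3B² p≈0) (eq₂ A B h))))
        where
        eq₁ : ∀ T E → E - T ≡ - E * (T * (E * E) - 1ℤ) + T * (E * E * E - 1ℤ)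
        eq₁ = solve-∀
        E≈T : E ≈ T
        E≈T = by₂ (- E) T (subst (_≈ 1ℤ) g₀^k g₀^k≈1) E³≈1 (eq₁ T E)
        g h : ℤ
        g = proj₁ noncube
        h = g ^ k
        g≉0 : g ≉ 0ℤ
        g≉0 = proj₁ (proj₂ noncube)
        eq₀ : ∀ h → (h - 1ℤ) * (h * h + h + 1ℤ) - 0ℤ ≡ 1ℤ * (h * h * h - 1ℤ)
        eq₀ = solve-∀
        ω-eq : h * h + h + 1ℤ ≈ 0ℤ
        ω-eq = [ (λ h≈1 → ⊥-elim (proj₂ (proj₂ noncube) (-≈0⇒≈ h≈1))) , (λ eq → eq) ]′
          (*≈0 (h - 1ℤ) (h * h + h + 1ℤ) (by₁ 1ℤ (^k-cube {g} g≉0) (eq₀ h)))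
        eq₂ : ∀ A B h → (+ 2 * B * h + B - A) * (+ 2 * B * h + B + A) - 0ℤ ≡
          + 4 * (B * B) * ((h * h + h + 1ℤ) - 0ℤ) + - 1ℤ * ((A * A + + 3 * (B * B)) - 0ℤ)
        eq₂ = solve-∀
        eq₃ : ∀ A B h → + 2 * B * h - (A - B) ≡ 1ℤ * ((+ 2 * B * h + B - A) - 0ℤ)
        eq₃ = solve-∀
        eq₄ : ∀ A B h → + 2 * - B * h - (A - - B) ≡ - 1ℤ * ((+ 2 * B * h + B + A) - 0ℤ)
        eq₄ = solve-∀
        eq₅ : ∀ A B → A * A + + 3 * (B * B) ≡ A * A + + 3 * (- B * - B)
        eq₅ = solve-∀
        with-B : + 2 * B * h + B - A ≈ 0ℤ → deficit (+ 2) ≡ + 2 * A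
        with-B eq = Cosets.Form.deficit₀ g g≉0 ω-eq A B p≡A²+3B² A≡1[3] (by₁ 1ℤ eq (eq₃ A B h))
        with-negated-B : + 2 * B * h + B + A ≈ 0ℤ → deficit (+ 2) ≡ + 2 * A
        with-negated-B eq = Cosets.Form.deficit₀ g g≉0 ω-eq A (- B) (trans p≡A²+3B² (eq₅ A B)) A≡1[3] (by₁ (- 1ℤ) eq (eq₄ A B h))

      -- The number g₀ = 2e² itself serves as g: since 2 g₀² = (2e)³ e, e lies in the third class.
      -- That g₀ᵏ is a primitive cube root of unity follows from 4B² (h² + h + 1) = (2Bh + B +
      -- A)(2Bh - (A - B)) + (A² + 3B²), in which 4 and B are units.
      deficit-noncubic : + 2 * B * g₀ ^ k ≈ A - B → deficit e ≡ - A + + 3 * B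
      deficit-noncubic ω≡ = trans (deficit-class e≉0 e₂≉0 E≈) (Cosets.Form.deficit₂ g₀ g₀≉0 ω-eq A B p≡A²+3B² A≡1[3] ω≡)
        where
        h : ℤ
        h = g₀ ^ k
        eq₁ : ∀ A B h → + 4 * (B * (B * (h * h + h + 1ℤ))) - 0ℤ ≡
          (+ 2 * B * h + B + A) * (+ 2 * B * h - (A - B)) + 1ℤ * ((A * A + + 3 * (B * B)) - 0ℤ)
        eq₁ = solve-∀
        4≉0 : + 4 ≉ 0ℤ
        4≉0 = *≉0 {+ 2} {+ 2} 2≉0 2≉0
        cancel : ∀ c x → c ≉ 0ℤ → c * x ≈ 0ℤ → x ≈ 0ℤ
        cancel c x c≉0 eq = [ (λ c≈0 → ⊥-elim (c≉0 c≈0)) , (λ x≈0 → x≈0) ]′ (*≈0 c x eq)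
        ω-eq : h * h + h + 1ℤ ≈ 0ℤ
        ω-eq = cancel B (h * h + h + 1ℤ) (B≉0 A B p≡A²+3B²) (cancel B (B * (h * h + h + 1ℤ)) (B≉0 A B p≡A²+3B²)
          (cancel (+ 4) (B * (B * (h * h + h + 1ℤ))) 4≉0 (by₂ (+ 2 * B * h + B + A) 1ℤ ω≡ (subst (_≈ 0ℤ) p≡A²+3B² p≈0) (eq₁ A B h))))
        e₂≉0 : + 2 * (g₀ * g₀) ≉ 0ℤ
        e₂≉0 = *≉0 {+ 2} {g₀ * g₀} 2≉0 (*≉0 {g₀} {g₀} g₀≉0 g₀≉0)
        e₂^k : (+ 2 * (g₀ * g₀)) ^ k ≡ T * (T * (E * E) * (T * (E * E)))
        e₂^k = trans (^-distribʳ-* (+ 2) (g₀ * g₀) k) (cong (λ z → T * z) (trans (^-distribʳ-* g₀ g₀ k) (cong₂ _*_ g₀^k g₀^k)))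
        eq₂ : ∀ T E → E - T * (T * (E * E) * (T * (E * E))) ≡ - (E * E * E * E) * (T * T * T - 1ℤ) + - E * (E * E * E - 1ℤ)
        eq₂ = solve-∀
        E≈ : E ≈ (+ 2 * (g₀ * g₀)) ^ k
        E≈ = subst (E ≈_) (sym e₂^k) (by₂ (- (E * E * E * E)) (- E) T³≈1 E³≈1 (eq₂ T E))

  -- Reduction of rational numbers

  -- The p-integral rational q has the same residue as the integer z.
  record _↦_ (q : ℚ) (z : ℤ) : Set where
    constructor reduces
    field
      ↧≉0 : ↧ q ≉ 0ℤ
      ↥≈  : ↥ q ≈ z * ↧ q
  open _↦_

  infix 4 _↦_

  -- N / D is q before reduction to lowest terms, the form in which sums and products are computed.
  -- If p divided `↧ q`, the cross product and D ≢ 0 would make it divide `↥ q` as well, against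
  -- coprimality.
  ↦-fraction : ∀ (q : ℚ) N D {z} → ↥ q * D ≡ N * ↧ q → D ≉ 0ℤ → N ≈ z * D → q ↦ z
  ↦-fraction q N D {z} cross D≉0 N≈zD = reduces ↧≉0′ (-≈0⇒≈ (≈0-of (*≈0 D (↥ q - z * ↧ q) (by₁ (↧ q) N≈zD
      (trans (eq₁ D (↥ q) z (↧ q)) (trans (cong (λ c → c - D * (z * ↧ q)) cross) (eq₂ N z D (↧ q))))))))
    where
    eq₁ : ∀ D n z d → D * (n - z * d) - 0ℤ ≡ n * D - D * (z * d)
    eq₁ = solve-∀
    eq₂ : ∀ N z D d → N * d - D * (z * d) ≡ d * (N - z * D)
    eq₂ = solve-∀
    ≈0-of : ∀ {x} → D ≈ 0ℤ ⊎ x ≈ 0ℤ → x ≈ 0ℤ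
    ≈0-of = [ (λ h → ⊥-elim (D≉0 h)) , (λ h → h) ]′
    coprime : ∀ q → Coprimality.Coprime ∣ ↥ q ∣ (↧ₙ q)
    coprime (mkℚ _ _ c) = Coprimality.recompute c
    eq₃ : ∀ N d → N * d - 0ℤ ≡ N * (d - 0ℤ)
    eq₃ = solve-∀
    ↧≉0′ : ↧ q ≉ 0ℤ
    ↧≉0′ h = ℕ.<-irrefl (sym (coprime q (≈0⇒∣ ↥≈0 , ≈0⇒∣ h))) 1<p
      where
      ↥≈0 : ↥ q ≈ 0ℤ
      ↥≈0 = ≈0-of (*≈0 D (↥ q) (≈-trans (≈-reflexive (trans (*-comm D (↥ q)) cross)) (*-zeroʳ-≈ N h)))

  ↦-/ : ∀ i d .{{_ : ℕ.NonZero d}} {z} → + d ≉ 0ℤ → i ≈ z * + d → (i ℚ./ d) ↦ z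
  ↦-/ i (suc d) d≉0 h = ↦-fraction (i ℚ./ suc d) i (+ suc d) (cross (ℚ.toℚᵘ-fromℚᵘ (ℚᵘ.mkℚᵘ i d))) d≉0 h
    where
    ↥-toℚᵘ : ∀ q → ℚᵘ.↥ (ℚ.toℚᵘ q) ≡ ↥ q
    ↥-toℚᵘ (mkℚ _ _ _) = refl
    ↧-toℚᵘ : ∀ q → ℚᵘ.↧ (ℚ.toℚᵘ q) ≡ ↧ q
    ↧-toℚᵘ (mkℚ _ _ _) = refl
    cross : ℚ.toℚᵘ (i ℚ./ suc d) ℚᵘ.≃ ℚᵘ.mkℚᵘ i d → ↥ (i ℚ./ suc d) * + suc d ≡ i * ↧ (i ℚ./ suc d)
    cross (ℚᵘ.*≡* eq) = subst₂ (λ n m → n * + suc d ≡ i * m) (↥-toℚᵘ (i ℚ./ suc d)) (↧-toℚᵘ (i ℚ./ suc d)) eq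

  ↦-+ : ∀ {q r z w} → q ↦ z → r ↦ w → q ℚ.+ r ↦ z + w
  ↦-+ {q@(mkℚ _ _ _)} {r@(mkℚ _ _ _)} {z} {w} (reduces d≉0 n≈) (reduces d′≉0 n′≈) =
    ↦-/ (↥ q * ↧ r + ↥ r * ↧ q) (↧ₙ q ℕ.* ↧ₙ r) (*≉0 {↧ q} {↧ r} d≉0 d′≉0) (by₂ (↧ r) (↧ q) n≈ n′≈ (eq (↥ q) (↥ r) (↧ q) (↧ r) z w))
    where
    eq : ∀ n n′ d d′ z w → (n * d′ + n′ * d) - (z + w) * (d * d′) ≡ d′ * (n - z * d) + d * (n′ - w * d′)
    eq = solve-∀

  ↦-* : ∀ {q r z w} → q ↦ z → r ↦ w → q ℚ.* r ↦ z * w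
  ↦-* {q@(mkℚ _ _ _)} {r@(mkℚ _ _ _)} {z} {w} (reduces d≉0 n≈) (reduces d′≉0 n′≈) =
    ↦-/ (↥ q * ↥ r) (↧ₙ q ℕ.* ↧ₙ r) (*≉0 {↧ q} {↧ r} d≉0 d′≉0) (by₂ (↥ r) (z * ↧ q) n≈ n′≈ (eq (↥ q) (↥ r) (↧ q) (↧ r) z w))
    where
    eq : ∀ n n′ d d′ z w → n * n′ - z * w * (d * d′) ≡ n′ * (n - z * d) + z * d * (n′ - w * d′)
    eq = solve-∀

  ↦-neg : ∀ {q z} → q ↦ z → ℚ.- q ↦ - z
  ↦-neg {q} {z} (reduces d≉0 n≈) = reduces (subst (_≉ 0ℤ) (sym (ℚ.↧-neg q)) d≉0)
    (subst₂ (λ n d → n ≈ - z * d) (sym (ℚ.↥-neg q)) (sym (ℚ.↧-neg q)) (by₁ (- 1ℤ) n≈ (eq (↥ q) z (↧ q))))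
    where
    eq : ∀ n z d → - n - - z * d ≡ - 1ℤ * (n - z * d)
    eq = solve-∀

  ↦-nℚ : ∀ n → nℚ n ↦ + n
  ↦-nℚ n = ↦-/ (+ n) 1 1≉0 (≈-reflexive (sym (*-identityʳ (+ n))))

  ↦-pow : ∀ {q z} n → q ↦ z → pow q n ↦ z ^ n
  ↦-pow zero    h = reduces 1≉0 ≈-refl
  ↦-pow (suc n) h = ↦-* h (↦-pow n h)

  ↦-divℤ : ∀ {n d z} → d ≉ 0ℤ → n ≈ z * d → divℤ n d ↦ z
  ↦-divℤ {n} {+ zero}  d≉0 h = ⊥-elim (d≉0 ≈-refl)
  ↦-divℤ {n} {+ suc k} d≉0 h = ↦-/ n (suc k) d≉0 h
  ↦-divℤ {n} { -[1+ k ]} {z} d≉0 h = ↦-/ (- n) (suc k) (λ h′ → d≉0 (neg-cong-≈ h′)) (by₁ (- 1ℤ) h (eq n z -[1+ k ]))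
    where
    eq : ∀ n z d → - n - z * - d ≡ - 1ℤ * (n - z * d)
    eq = solve-∀

  ↦-numerator : ∀ {q z} → q ↦ z → (p ℕ.∣ ∣ ↥ q ∣ → z ≈ 0ℤ) × (z ≈ 0ℤ → p ℕ.∣ ∣ ↥ q ∣)
  ↦-numerator {q} {z} (reduces d≉0 n≈) =
    (λ h → [ (λ h′ → h′) , (λ h′ → ⊥-elim (d≉0 h′)) ]′ (*≈0 z (↧ q) (≈-trans (≈-sym n≈) (∣⇒≈0 (↥ q) h)))) ,
    (λ h → ≈0⇒∣ (≈-trans n≈ (*-zeroˡ-≈ {z} (↧ q) h)))

  ≡ℚ⇒≈ : ∀ {q r z w} → q ↦ z → r ↦ w → q ≡ℚ r [mod p ] → z ≈ w
  ≡ℚ⇒≈ q↦z r↦w h = -≈0⇒≈ (proj₁ (↦-numerator (↦-+ q↦z (↦-neg r↦w))) h)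

  opaque
    reduction : ∀ a → InR p a → ∃ λ e → a ↦ e
    reduction a a∈R = ↥ a * proj₁ inv , reduces d≉0 (by₁ (- ↥ a) (proj₂ inv) (eq (↥ a) (proj₁ inv) (↧ a)))
      where
      d≉0 : ↧ a ≉ 0ℤ
      d≉0 h = a∈R (≈0⇒∣ h)
      inv : ∃ λ y → y * ↧ a ≈ 1ℤ
      inv = inverse d≉0
      eq : ∀ n y d → n - n * y * d ≡ - n * (y * d - 1ℤ)
      eq = solve-∀

  -- From `Vp` to the weighted count of fibres

  indicator-⇔ : ∀ {A : Set} {z} (A? : Dec A) → (A → z ≡ 1ℤ) → (¬ A → z ≡ 0ℤ) → indicator A? ≡ z
  indicator-⇔ (yes a) f g = sym (f a)
  indicator-⇔ (no ¬a) f g = sym (g ¬a)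

  side : ∀ {A B : Set} → A ⊎ B → ℤ
  side = [ (λ _ → 1ℤ) , (λ _ → 0ℤ) ]′

  side≡1 : ∀ {A B : Set} (s : A ⊎ B) → ¬ B → side s ≡ 1ℤ
  side≡1 (inj₁ _) ¬b = refl
  side≡1 (inj₂ b) ¬b = ⊥-elim (¬b b)

  side≡0 : ∀ {A B : Set} (s : A ⊎ B) → ¬ A → side s ≡ 0ℤ
  side≡0 (inj₁ a) ¬a = ⊥-elim (¬a a)
  side≡0 (inj₂ _) ¬a = refl

  length-filter : ∀ {Q : ℕ → Set} (Q? : ∀ b → Dec (Q b)) (f : ℕ → ℕ) n →
    + length (filter Q? (applyUpTo f n)) ≡ sum {n} (λ i → indicator (Q? (f (toℕ i))))
  length-filter Q? f zero    = refl
  length-filter Q? f (suc n) with Q? (f 0)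
  ... | yes _ = cong (λ z → 1ℤ + z) (length-filter Q? (f ∘ suc) n)
  ... | no _  = trans (length-filter Q? (f ∘ suc) n) (sym (+-identityˡ _))

  module Values (3<p : 3 ℕ.< p) (a : ℚ) (e : ℤ) (a↦e : a ↦ e) (e≉0 : e ≉ 0ℤ) where
    open Fibres e e≉0 (small≉0 (ℕ.s≤s ℕ.z≤n) 3<p)

    Attained : ℕ → Set
    Attained b = ∃ λ k → k ℕ.< p ℕ.∸ 1 × p ℕ.∣ ∣ ↥ (fval a k ℚ.- nℚ b) ∣

    fval-root : ∀ b k → k ℕ.< p ℕ.∸ 1 →
      (p ℕ.∣ ∣ ↥ (fval a k ℚ.- nℚ b) ∣ → cubic (+ b) (+ suc k) ≈ 0ℤ) × (cubic (+ b) (+ suc k) ≈ 0ℤ → p ℕ.∣ ∣ ↥ (fval a k ℚ.- nℚ b) ∣)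
    fval-root b k k<p-1 = (λ h → by₂ x (- e) (proj₁ num h) yx≈1 (eq₁ x e y (+ b))) , (λ h → proj₂ num (by₂ y (- (x * x) + + b) h yx≈1 (eq₂ x e y (+ b))))
      where
      x : ℤ
      x = + suc k
      x≉0 : x ≉ 0ℤ
      x≉0 = small≉0 (ℕ.s≤s ℕ.z≤n) (subst (suc k ℕ.<_) (ℕ.suc-pred p) (ℕ.s≤s k<p-1))
      y : ℤ
      y = proj₁ (inverse x≉0)
      yx≈1 : y * x ≈ 1ℤ
      yx≈1 = proj₂ (inverse x≉0)
      num : (p ℕ.∣ ∣ ↥ (fval a k ℚ.- nℚ b) ∣ → x * x + e * y - + b ≈ 0ℤ) × (x * x + e * y - + b ≈ 0ℤ → p ℕ.∣ ∣ ↥ (fval a k ℚ.- nℚ b) ∣)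
      num = ↦-numerator (↦-+ (↦-+ (↦-* (↦-nℚ (suc k)) (↦-nℚ (suc k))) (↦-* a↦e (↦-/ 1ℤ (suc k) {y} x≉0 (≈-sym yx≈1)))) (↦-neg (↦-nℚ b)))
      eq₁ : ∀ x e y b → (x * x * x - b * x + e) - 0ℤ ≡ x * ((x * x + e * y - b) - 0ℤ) + - e * (y * x - 1ℤ)
      eq₁ = solve-∀
      eq₂ : ∀ x e y b → (x * x + e * y - b) - 0ℤ ≡ y * ((x * x * x - b * x + e) - 0ℤ) + (- (x * x) + b) * (y * x - 1ℤ)
      eq₂ = solve-∀

    attained : ∀ b x → cubic (+ b) x ≈ 0ℤ → Attained b
    attained b x root = from-residue (toℕ (proj₁ (residue x))) (Fin.toℕ<n (proj₁ (residue x))) (proj₂ (residue x))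
      where
      eq : ∀ x b e → e - 0ℤ ≡ 1ℤ * ((x * x * x - b * x + e) - 0ℤ) + - (x * x - b) * (x - 0ℤ)
      eq = solve-∀
      from-residue : ∀ n → n ℕ.< p → x ≈ + n → Attained b
      -- Residue 0 is not among the x in {1, ..., p - 1}; nor is it a root, because the cubic takes
      -- the value e there.
      from-residue zero    _   x≈0 = ⊥-elim (e≉0 (by₂ 1ℤ (- (x * x - + b)) root x≈0 (eq x (+ b) e)))
      from-residue (suc k) k<p x≈k = k , k<p-1 , proj₂ (fval-root b k k<p-1) (≈-trans (cubic-cong (+ b) (≈-sym x≈k)) root)
        where
        k<p-1 : k ℕ.< p ℕ.∸ 1
        k<p-1 = ℕ.s≤s⁻¹ (subst (suc k ℕ.<_) (sym (ℕ.suc-pred p)) k<p)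

    value? : ∀ b → (∃ λ x → cubic b x ≈ 0ℤ) ⊎ (∀ x → cubic b x ≉ 0ℤ)
    value? b = search {λ x → cubic b x ≈ 0ℤ} (λ x≈y → ≈-trans (cubic-cong b (≈-sym x≈y))) (λ x → cubic b x ≈? 0ℤ)

    -- Solvability in arbitrary integers x, for arbitrary integers b, is the form that `value-count`
    -- requires; `attained` and `fval-root` relate it to the bounded search in `Vp`.
    value : ℤ → ℤ
    value b = side (value? b)

    value≡1 : ∀ b x → cubic b x ≈ 0ℤ → value b ≡ 1ℤ
    value≡1 b x root = side≡1 (value? b) (λ none → none x root)

    value≡0 : ∀ b → (∀ x → cubic b x ≉ 0ℤ) → value b ≡ 0ℤ
    value≡0 b none = side≡0 (value? b) (λ (x , root) → none x root)

    Vp-pairs : + 3 * + Vp p a ≡ + 3 * + p - + 3 - pairs e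
    Vp-pairs = trans (cong (+ 3 *_) (trans (length-filter attained? (λ b → b) p)
      (trans (∑.sum-cong-≗ {p} (λ i → indicator-⇔ (attained? (toℕ i)) (yes-case (toℕ i)) (no-case (toℕ i)))) (sym (∑ₚ-def value)))))
      (value-count value value≡1 value≡0)
      where
      attained? : ∀ b → Dec _
      attained? b = any? (λ k → p ℕ.∣? ∣ ↥ (fval a k ℚ.- nℚ b) ∣) (upTo (p ℕ.∸ 1))
      yes-case : ∀ b → _ → value (+ b) ≡ 1ℤ
      yes-case b any = value≡1 (+ b) (+ suc (proj₁ w)) (proj₁ (fval-root b (proj₁ w) (proj₁ (proj₂ w))) (proj₂ (proj₂ w)))
        where
        w : Attained b
        w = Any.applyUpTo⁻ (λ k → k) any
      no-case : ∀ b → ¬ _ → value (+ b) ≡ 0ℤ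
      no-case b none = value≡0 (+ b) λ x root →
        let (k , k<p-1 , d) = attained b x root in none (Any.applyUpTo⁺ {P = λ k → p ℕ.∣ ∣ ↥ (fval a k ℚ.- nℚ b) ∣} (λ k → k) d k<p-1)

  -- The two residues of p modulo 3

  module Theorem (3<p : 3 ℕ.< p) (a : ℚ) (a∈R : InR p a) (a≢0 : ¬ (a ≡ℚ 0ℚ [mod p ])) where

    e : ℤ
    e = proj₁ (reduction a a∈R)

    a↦e : a ↦ e
    a↦e = proj₂ (reduction a a∈R)

    e≉0 : e ≉ 0ℤ
    e≉0 e≈0 = a≢0 (proj₂ (↦-numerator (↦-+ a↦e (↦-neg (reduces {0ℚ} {0ℤ} 1≉0 ≈-refl)))) (≈-trans (≈-reflexive (+-identityʳ e)) e≈0))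

    2p∸1 : + (2 ℕ.* p ℕ.∸ 1) ≡ + 2 * + p - 1ℤ
    2p∸1 = trans (sym (⊖-≥ (ℕ.≤-trans (ℕ.<⇒≤ 1<p) (ℕ.m≤m+n p (p ℕ.+ 0))))) (trans (sym (m-n≡m⊖n (2 ℕ.* p) 1)) (cong (λ z → z - 1ℤ) (pos-* 2 p)))

    3Vp : + (3 ℕ.* Vp p a) ≡ + (2 ℕ.* p ℕ.∸ 1) + deficit e
    3Vp = trans (pos-* 3 (Vp p a)) (trans (Values.Vp-pairs 3<p a e a↦e e≉0) (trans (eq (+ p) (pairs e)) (cong (λ z → z + deficit e) (sym 2p∸1))))
      where
      eq : ∀ q P → + 3 * q - + 3 - P ≡ (+ 2 * q - 1ℤ) + (q - + 2 - P)
      eq = solve-∀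

    p≡[p/3] : ∀ {r} → p ℕ.% 3 ≡ r → p ≡ r ℕ.+ (p ℕ./ 3 ℕ.+ p ℕ./ 3 ℕ.+ p ℕ./ 3)
    p≡[p/3] {r} eq = trans (ℕ.m≡m%n+[m/n]*n p 3) (cong₂ ℕ._+_ eq (lem (p ℕ./ 3)))
      where
      lem : ∀ k → k ℕ.* 3 ≡ k ℕ.+ k ℕ.+ k
      lem k = trans (ℕ.*-comm k 3) (trans (cong (λ z → k ℕ.+ (k ℕ.+ z)) (ℕ.+-identityʳ k)) (sym (ℕ.+-assoc k k k)))

    case-2 : p ℕ.% 3 ≡ 2 → 3 ℕ.* Vp p a ≡ 2 ℕ.* p ℕ.∸ 1
    case-2 p%3≡2 = +-injective (trans 3Vp (trans (cong (λ d → + (2 ℕ.* p ℕ.∸ 1) + d) deficit≡0) (+-identityʳ _)))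
      where
      deficit≡0 : deficit e ≡ 0ℤ
      deficit≡0 = trans (cong (λ P → + p - + 2 - P) (TwoMod3.pairs-two (p ℕ./ 3) (p≡[p/3] p%3≡2) e≉0)) (+-inverseʳ (+ p - + 2))

    module Case-1 (p%3≡1 : p ℕ.% 3 ≡ 1) (A B : ℤ) (p≡A²+3B² : + p ≡ A * A + + 3 * (B * B)) (A≡1[3] : ∃ λ k → A ≡ + 3 * k + 1ℤ) where

      k : ℕ
      k = p ℕ./ 3

      p≡ : p ≡ suc (k ℕ.+ k ℕ.+ k)
      p≡ = p≡[p/3] p%3≡1

      0<k : 0 ℕ.< k
      0<k = ℕ.n≢0⇒n>0 λ k≡0 → ℕ.<⇒≢ 1<p (sym (subst (λ k → p ≡ suc (k ℕ.+ k ℕ.+ k)) k≡0 p≡))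

      [p-1]/3 : (p ℕ.∸ 1) ℕ./ 3 ≡ k
      [p-1]/3 = trans (cong (λ q → (q ℕ.∸ 1) ℕ./ 3) p≡′) (ℕ.m*n/n≡m k 3)
        where
        p≡′ : p ≡ suc (k ℕ.* 3)
        p≡′ = trans (ℕ.m≡m%n+[m/n]*n p 3) (cong (ℕ._+ k ℕ.* 3) p%3≡1)

      open OneMod3 k 0<k p≡ using (2≉0; deficit-cubic; deficit-noncubic)

      θ↦ : pow (nℚ 2 ℚ.* (a ℚ.* a)) ((p ℕ.∸ 1) ℕ./ 3) ↦ (+ 2 * (e * e)) ^ k
      θ↦ = subst (λ n → pow (nℚ 2 ℚ.* (a ℚ.* a)) n ↦ (+ 2 * (e * e)) ^ k) (sym [p-1]/3) (↦-pow k (↦-* (↦-nℚ 2) (↦-* a↦e a↦e)))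

      cubic-case : pow (nℚ 2 ℚ.* (a ℚ.* a)) ((p ℕ.∸ 1) ℕ./ 3) ≡ℚ 1ℚ [mod p ] → + (3 ℕ.* Vp p a) ≡ + (2 ℕ.* p ℕ.∸ 1) + + 2 * A
      cubic-case h = trans 3Vp (cong (λ d → + (2 ℕ.* p ℕ.∸ 1) + d)
        (deficit-cubic A B p≡A²+3B² A≡1[3] e e≉0 (≡ℚ⇒≈ θ↦ (reduces {1ℚ} {1ℤ} 1≉0 ≈-refl) h)))

      -- Both signs are the case ε = 1 with ε B in place of B: (ε B)² = B² leaves the form
      -- unchanged, and ε A / B = A / (ε B).
      noncubic-case : ∀ ε → ε ≡ 1ℤ ⊎ ε ≡ -1ℤ →
        pow (nℚ 2 ℚ.* (a ℚ.* a)) ((p ℕ.∸ 1) ℕ./ 3) ≡ℚ (ℚ.- 1ℚ ℚ.+ divℤ (ε * A) B) ℚ.* ½ [mod p ] →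
        + (3 ℕ.* Vp p a) ≡ + (2 ℕ.* p ℕ.∸ 1) - A + + 3 * ε * B
      noncubic-case ε ε≡±1 h = trans 3Vp (trans (cong (λ d → + (2 ℕ.* p ℕ.∸ 1) + d)
          (deficit-noncubic A (ε * B) (trans p≡A²+3B² form≡) A≡1[3] e e≉0 ω≡)) (eq₃ (+ (2 ℕ.* p ℕ.∸ 1)) A ε B))
        where
        ε²≡1 : ε * ε ≡ 1ℤ
        ε²≡1 = [ (λ { refl → refl }) , (λ { refl → refl }) ]′ ε≡±1
        inv-B : ∃ λ y → y * B ≈ 1ℤ
        inv-B = inverse (B≉0 A B p≡A²+3B²)
        inv-2 : ∃ λ y → y * + 2 ≈ 1ℤ
        inv-2 = inverse 2≉0
        y c θ : ℤ
        y = proj₁ inv-B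
        c = proj₁ inv-2
        θ = (+ 2 * (e * e)) ^ k
        eq₀ : ∀ ε A y B → ε * A - ε * A * y * B ≡ - (ε * A) * (y * B - 1ℤ)
        eq₀ = solve-∀
        rhs↦ : (ℚ.- 1ℚ ℚ.+ divℤ (ε * A) B) ℚ.* ½ ↦ (- 1ℤ + ε * A * y) * c
        rhs↦ = ↦-* (↦-+ (↦-neg (reduces {1ℚ} {1ℤ} 1≉0 ≈-refl)) (↦-divℤ {ε * A} {B} {ε * A * y} (B≉0 A B p≡A²+3B²) (by₁ (- (ε * A)) (proj₂ inv-B) (eq₀ ε A y B))))
          (reduces {½} {c} 2≉0 (≈-sym (proj₂ inv-2)))
        θ≈ : θ ≈ (- 1ℤ + ε * A * y) * c
        θ≈ = ≡ℚ⇒≈ θ↦ rhs↦ h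
        eq₁ : ∀ ε A B y c θ → + 2 * (ε * B) * θ - (A - ε * B) ≡
          + 2 * (ε * B) * (θ - (- 1ℤ + ε * A * y) * c) + ε * B * (- 1ℤ + ε * A * y) * (c * + 2 - 1ℤ) + ε * ε * A * (y * B - 1ℤ) + (ε * ε - 1ℤ) * A
        eq₁ = solve-∀
        ω≡ : + 2 * (ε * B) * θ ≈ A - ε * B
        ω≡ = by₃ (+ 2 * (ε * B)) (ε * B * (- 1ℤ + ε * A * y)) (ε * ε * A) θ≈ (proj₂ inv-2) (proj₂ inv-B)
          (trans (eq₁ ε A B y c θ) (trans (cong (λ s → rest + (s - 1ℤ) * A) ε²≡1) (+-identityʳ rest)))
          where
          rest : ℤ
          rest = + 2 * (ε * B) * (θ - (- 1ℤ + ε * A * y) * c) + ε * B * (- 1ℤ + ε * A * y) * (c * + 2 - 1ℤ) + ε * ε * A * (y * B - 1ℤ)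
        eq₂ : ∀ A B ε → A * A + + 3 * (ε * B * (ε * B)) ≡ A * A + + 3 * (ε * ε * (B * B))
        eq₂ = solve-∀
        form≡ : A * A + + 3 * (B * B) ≡ A * A + + 3 * (ε * B * (ε * B))
        form≡ = trans (cong (λ z → A * A + + 3 * z) (sym (trans (cong (_* (B * B)) ε²≡1) (*-identityˡ (B * B))))) (sym (eq₂ A B ε))
        eq₃ : ∀ q A ε B → q + (- A + + 3 * (ε * B)) ≡ q - A + + 3 * ε * B
        eq₃ = solve-∀

open import Data.Nat as ℕ using (_<_; _%_; _∸_)

theorem2p1 : (p : ℕ) → Prime p → 3 < p → (a : ℚ) → InR p a → ¬ (a ≡ℚ 0ℚ [mod p ]) →
    (p % 3 ≡ 2 → 3 ℕ.* Vp p a ≡ 2 ℕ.* p ∸ 1) ×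
    (p % 3 ≡ 1 → (A B : ℤ) → + p ≡ A ℤ.* A ℤ.+ + 3 ℤ.* (B ℤ.* B) → (∃ λ k → A ≡ + 3 ℤ.* k ℤ.+ + 1) →
    ((pow (nℚ 2 ℚ.* (a ℚ.* a)) ((p ∸ 1) ℕ./ 3) ≡ℚ 1ℚ [mod p ] →
    + (3 ℕ.* Vp p a) ≡ + (2 ℕ.* p ∸ 1) ℤ.+ + 2 ℤ.* A) ×
    ((ε : ℤ) → (ε ≡ + 1 ⊎ ε ≡ -[1+ 0 ]) →
    pow (nℚ 2 ℚ.* (a ℚ.* a)) ((p ∸ 1) ℕ./ 3) ≡ℚ (ℚ.- 1ℚ ℚ.+ divℤ (ε ℤ.* A) B) ℚ.* ½ [mod p ] →
    + (3 ℕ.* Vp p a) ≡ + (2 ℕ.* p ∸ 1) ℤ.- A ℤ.+ + 3 ℤ.* ε ℤ.* B)))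
theorem2p1 p p-prime 3<p a a∈R a≢0 = case-2 , λ p%3≡1 A B p≡A²+3B² A≡1[3] →
  Case-1.cubic-case p%3≡1 A B p≡A²+3B² A≡1[3] , Case-1.noncubic-case p%3≡1 A B p≡A²+3B² A≡1[3]
  where
  open Residues p p-prime
  open Theorem 3<p a a∈R a≢0
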